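{- Let $q$ be an odd positive integer, $p>q$ a prime, and $a\in(\mathbb{Z}/pq\mathbb{Z})^*$ with $a^{(p-1)/2}\equiv-1\pmod{pq}$ and such that $\alpha:=a\bmod p$ generates $\mathbb{F}_p^*$. Let $\beta:=a\bmod q\in(\mathbb{Z}/q\mathbb{Z})^*$ and $n=\mathrm{ord}(\beta)$ (so $n\mid p-1$). Let $\psi:\langle\beta\rangle\to\mu_n$, $\beta^j\mapsto e^{2\pi \mathbf{i} j/n}$, and let $\chi$ be the character of $\mathbb{F}_p^*$ given by $\chi(\alpha^j)=e^{2\pi\mathbf{i} j/n}$. Let $B=\{b\in\langle\beta\rangle : b-1\in\langle\beta\rangle\}$ and, for $1\le i,j\le n-1$, $c_{i,j}=\sum_{b\in B}\psi(b)^{ -i}\psi(1-b)^{ -j}$. Then, with $S=S_{pq}(a)$, $$|S\cap(S+1)|=\frac{1}{n^2}\Big((p+1)|B|+\sum_{1\le i\le j<n-i}2(2-\delta_{i,j})\,\mathrm{Re}\big(c_{i,j}J(\chi^i,\chi^j)\big)\Big),$$ where $\delta_{i,j}$ is the Kronecker delta.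
   Context: $S_{pq}(a)=\{a^j:0\le j<p-1\}\subseteq\mathbb{Z}/pq\mathbb{Z}$, $S+1=\{s+1:s\in S\}$, $\mu_n$ is the group of complex $n$-th roots of unity. A character mod $p$ is a homomorphism $\chi:\mathbb{F}_p^*\to\mathbb{C}^*$; it is extended to $\mathbb{F}_p$ by $\chi(0)=0$ if $\chi$ is nontrivial and $\chi(0)=1$ if $\chi$ is trivial. For characters $\chi,\lambda$ mod $p$ the Jacobi sum is $J(\chi,\lambda)=\sum_{c,d\in\mathbb{F}_p,\,c+d=1}\chi(c)\lambda(d)$. $\mathbf{i}=\sqrt{ -1}$.
   Formalization: The case q = 1 is excluded, since the formula fails there: n = 1, B = {0} and the sum is empty, so the right side is p+1 while |S∩(S+1)| = p−2 (for p = 3, a = 2: 4 against 1). -}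

module Defs where

open import Level using (_⊔_) renaming (suc to lsuc)
open import Algebra.Bundles using (RawMonoid; RawRing; CommutativeRing)
import Algebra.Definitions.RawMonoid as RawMonoidDefs
import Algebra.Definitions.RawSemiring as RawSemiringDefs
open import Data.Bool.Base using (if_then_else_)
open import Data.Fin.Base using (Fin; toℕ; fromℕ<)
open import Data.Fin.Properties using (any?; toℕ-fromℕ<; toℕ-injective; toℕ<n) renaming (_≟_ to _≟ᶠ_)
open import Data.Fin.Subset using (Subset)
open import Data.Fin.Subset.Properties using (_∈?_)
open import Data.Nat.Base as ℕ using (ℕ; zero; suc; NonZero; _∸_; _%_; _!)
open import Data.Nat.DivMod using (_mod_; _/_; m%n<n; m<n⇒m%n≡m; m≡m%n+[m/n]*n; %-distribˡ-*)
import Data.Nat.Properties as ℕₚ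
open import Data.Product.Base using (∃; _×_; _,_; proj₁; proj₂)
open import Data.Sum.Base using (_⊎_; inj₁; inj₂)
open import Data.Vec.Base using (tabulate)
open import Function.Base using (_∘_)
open import Relation.Binary.Core using (Rel)
open import Relation.Binary.Structures using (IsStrictPartialOrder)
import Relation.Binary.PropositionalEquality as ≡
open ≡ using (_≡_)
open import Relation.Nullary using (¬_; yes; no; does)
open import Relation.Nullary.Decidable using (_×-dec_)
open import Relation.Unary using (Pred; Decidable)

------------------------------------------------------------------------
-- Subsets of, and sums over, finite sets

comprehension : ∀ {n ℓ} {P : Pred (Fin n) ℓ} → Decidable P → Subset n
comprehension P? = tabulate (does ∘ P?)

module FiniteSum {a ℓ} (M : RawMonoid a ℓ) where
  open RawMonoid M
  open RawMonoidDefs M public using (sum)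

  ∑[_] : ∀ {n p} {P : Pred (Fin n) p} → Decidable P → (Fin n → Carrier) → Carrier
  ∑[ P? ] f = sum (λ x → if does (P? x) then f x else ε)

------------------------------------------------------------------------
-- The ring ℤ/m, on the representatives 0, …, m-1

ℤ/_ : ℕ → Set
ℤ/ m = Fin m

module _ {m : ℕ} .{{_ : NonZero m}} where

  infixl 6 _+ₘ_ _-ₘ_
  infixl 7 _*ₘ_
  infixr 8 _^ₘ_
  infix  8 -ₘ_
  infix  4 _∈⟨_⟩

  0ₘ 1ₘ : ℤ/ m
  0ₘ = 0 mod m
  1ₘ = 1 mod m

  _+ₘ_ _*ₘ_ : ℤ/ m → ℤ/ m → ℤ/ m
  x +ₘ y = (toℕ x ℕ.+ toℕ y) mod m
  x *ₘ y = (toℕ x ℕ.* toℕ y) mod m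

  -ₘ_ : ℤ/ m → ℤ/ m
  -ₘ_ x = (m ∸ toℕ x) mod m

  _-ₘ_ : ℤ/ m → ℤ/ m → ℤ/ m
  _-ₘ_ x y = x +ₘ (-ₘ y)

  _^ₘ_ : ℤ/ m → ℕ → ℤ/ m
  x ^ₘ zero  = 1ₘ
  x ^ₘ suc j = x *ₘ x ^ₘ j

  IsUnit : ℤ/ m → Set
  IsUnit x = ∃ λ y → x *ₘ y ≡ 1ₘ

  -- For a unit g, which has finite order, the powers with exponent in ℕ
  -- make up the whole subgroup generated by g.
  _∈⟨_⟩ : ℤ/ m → ℤ/ m → Set
  x ∈⟨ g ⟩ = ∃ λ j → g ^ₘ j ≡ x

  GeneratesUnits : ℤ/ m → Set
  GeneratesUnits g = IsUnit g × (∀ x → IsUnit x → x ∈⟨ g ⟩)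

  record HasOrder (g : ℤ/ m) (n : ℕ) .{{_ : NonZero n}} : Set where
    field
      power≡1 : g ^ₘ n ≡ 1ₘ
      minimal : ∀ k → .{{NonZero k}} → g ^ₘ k ≡ 1ₘ → n ℕ.≤ k

  translate : Subset m → Subset m
  translate T = comprehension (λ x → any? (λ s → (s ∈? T) ×-dec (s +ₘ 1ₘ ≟ᶠ x)))

-- Only meaningful as a ring homomorphism when k divides m.
reduce : ∀ {m} (k : ℕ) .{{_ : NonZero k}} → ℤ/ m → ℤ/ k
reduce k x = toℕ x mod k

module _ {m : ℕ} .{{_ : NonZero m}} where

  private
    toℕ-mod : ∀ x → toℕ (x mod m) ≡ x % m
    toℕ-mod x = toℕ-fromℕ< (m%n<n x m)

    toℕ-^ : ∀ (g : ℤ/ m) j → toℕ (g ^ₘ j) ≡ (toℕ g ℕ.^ j) % m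
    toℕ-^ g zero    = toℕ-mod 1
    toℕ-^ g (suc j) = begin
      toℕ (g *ₘ g ^ₘ j)                       ≡⟨ toℕ-mod _ ⟩
      (toℕ g ℕ.* toℕ (g ^ₘ j)) % m            ≡⟨ ≡.cong (λ z → (toℕ g ℕ.* z) % m) (toℕ-^ g j) ⟩
      (toℕ g ℕ.* (G % m)) % m                 ≡⟨ ≡.cong (λ z → (z ℕ.* (G % m)) % m) (≡.sym (m<n⇒m%n≡m (toℕ<n g))) ⟩
      ((toℕ g % m) ℕ.* (G % m)) % m           ≡⟨ ≡.sym (%-distribˡ-* (toℕ g) G m) ⟩
      (toℕ g ℕ.* G) % m                       ∎
      where
      open ≡.≡-Reasoning
      G = toℕ g ℕ.^ j

    power-+ : ∀ (g : ℤ/ m) j k → g ^ₘ k ≡ 1ₘ → g ^ₘ (j ℕ.+ k) ≡ g ^ₘ j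
    power-+ g j k eq = toℕ-injective (begin
      toℕ (g ^ₘ (j ℕ.+ k))              ≡⟨ toℕ-^ g (j ℕ.+ k) ⟩
      (G ℕ.^ (j ℕ.+ k)) % m             ≡⟨ ≡.cong (_% m) (ℕₚ.^-distribˡ-+-* G j k) ⟩
      (G ℕ.^ j ℕ.* G ℕ.^ k) % m         ≡⟨ %-distribˡ-* (G ℕ.^ j) (G ℕ.^ k) m ⟩
      ((G ℕ.^ j) % m ℕ.* ((G ℕ.^ k) % m)) % m ≡⟨ ≡.cong (λ z → ((G ℕ.^ j) % m ℕ.* z) % m) Gk ⟩
      ((G ℕ.^ j) % m ℕ.* (1 % m)) % m   ≡⟨ ≡.sym (%-distribˡ-* (G ℕ.^ j) 1 m) ⟩
      (G ℕ.^ j ℕ.* 1) % m               ≡⟨ ≡.cong (_% m) (ℕₚ.*-identityʳ (G ℕ.^ j)) ⟩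
      (G ℕ.^ j) % m                     ≡⟨ ≡.sym (toℕ-^ g j) ⟩
      toℕ (g ^ₘ j)                      ∎)
      where
      open ≡.≡-Reasoning
      G = toℕ g
      Gk : (G ℕ.^ k) % m ≡ 1 % m
      Gk = ≡.trans (≡.sym (toℕ-^ g k)) (≡.trans (≡.cong toℕ eq) (toℕ-mod 1))

    power-* : ∀ (g : ℤ/ m) n d → g ^ₘ n ≡ 1ₘ → g ^ₘ (d ℕ.* n) ≡ 1ₘ
    power-* g n zero    eq = ≡.refl
    power-* g n (suc d) eq = ≡.trans (power-+ g n (d ℕ.* n) (power-* g n d eq)) eq

    power-% : ∀ (g : ℤ/ m) n .{{_ : NonZero n}} → g ^ₘ n ≡ 1ₘ → ∀ j → g ^ₘ (j % n) ≡ g ^ₘ j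
    power-% g n eq j = ≡.trans
      (≡.sym (power-+ g (j % n) (j / n ℕ.* n) (power-* g n (j / n) eq)))
      (≡.cong (g ^ₘ_) (≡.sym (m≡m%n+[m/n]*n j n)))

  ∈⟨_⟩? : ∀ {n} .{{_ : NonZero n}} {g : ℤ/ m} → HasOrder g n → Decidable (_∈⟨ g ⟩)
  ∈⟨_⟩? {n} {g} ord x with any? {n = n} (λ j → g ^ₘ toℕ j ≟ᶠ x)
  ... | yes (j , eq) = yes (toℕ j , eq)
  ... | no  ¬ex      = no λ (j , eq) → ¬ex
    ( fromℕ< (m%n<n j n)
    , ≡.trans (≡.cong (g ^ₘ_) (toℕ-fromℕ< (m%n<n j n)))
              (≡.trans (power-% g n (HasOrder.power≡1 ord) j) eq) )

S : ∀ p q .{{_ : NonZero (p ℕ.* q)}} → ℤ/ (p ℕ.* q) → Subset (p ℕ.* q)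
S p q a = comprehension (λ x → any? {n = p ∸ 1} (λ j → a ^ₘ toℕ j ≟ᶠ x))

-- { b ∈ ⟨β⟩ : b - 1 ∈ ⟨β⟩ }
consecutive : ∀ {m n} .{{_ : NonZero m}} .{{_ : NonZero n}} {β : ℤ/ m} → HasOrder β n → Subset m
consecutive ord = comprehension (λ b → ∈⟨ ord ⟩? b ×-dec ∈⟨ ord ⟩? (b -ₘ 1ₘ))

δ : ℕ → ℕ → ℕ
δ i j = if does (i ℕₚ.≟ j) then 1 else 0

------------------------------------------------------------------------
-- The real numbers: a Cauchy-complete Archimedean ordered field.
-- Classically these axioms determine ℝ up to unique isomorphism.  The
-- order is not assumed decidable, so that constructive models (such as
-- Cauchy sequences of rationals) are included.

record Reals c ℓ₁ ℓ₂ : Set (lsuc (c ⊔ ℓ₁ ⊔ ℓ₂)) where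
  field
    commutativeRing : CommutativeRing c ℓ₁

  open CommutativeRing commutativeRing public
    using (Carrier; _≈_; _+_; _*_; -_; _-_; 0#; 1#; +-rawMonoid)

  infix 4 _<_
  field
    _<_                  : Rel Carrier ℓ₂
    isStrictPartialOrder : IsStrictPartialOrder _≈_ _<_
    <-cotrans            : ∀ {x y} → x < y → ∀ z → x < z ⊎ z < y
    <-tight              : ∀ {x y} → ¬ (x < y) → ¬ (y < x) → x ≈ y
    0<1                  : 0# < 1#
    +-monoˡ-<            : ∀ {x y} z → x < y → x + z < y + z
    *-pos                : ∀ {x y} → 0# < x → 0# < y → 0# < x * y
    pos⇒invertible       : ∀ {x} → 0# < x → ∃ λ y → x * y ≈ 1#

  fromℕ : ℕ → Carrier
  fromℕ n = RawMonoidDefs._×_ +-rawMonoid n 1#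

  ∣_-_∣<_ : Carrier → Carrier → Carrier → Set ℓ₂
  ∣ x - y ∣< ε = (x < y + ε) × (y < x + ε)

  infix 4 _⟶_
  _⟶_ : (ℕ → Carrier) → Carrier → Set (c ⊔ ℓ₂)
  f ⟶ L = ∀ ε → 0# < ε → ∃ λ N → ∀ k → N ℕ.≤ k → ∣ f k - L ∣< ε

  Cauchy : (ℕ → Carrier) → Set (c ⊔ ℓ₂)
  Cauchy f = ∀ ε → 0# < ε → ∃ λ N → ∀ k l → N ℕ.≤ k → N ℕ.≤ l → ∣ f k - f l ∣< ε

  field
    archimedean : ∀ x → ∃ λ n → x < fromℕ n
    complete    : ∀ f → Cauchy f → ∃ λ L → f ⟶ L

  private
    module CR = CommutativeRing commutativeRing
    module SPO = IsStrictPartialOrder isStrictPartialOrder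

  0<fromℕ : ∀ n → .{{NonZero n}} → 0# < fromℕ n
  0<fromℕ (suc zero)    = SPO.<-respʳ-≈ (CR.sym (CR.+-identityʳ 1#)) 0<1
  0<fromℕ (suc (suc n)) = SPO.trans (0<fromℕ (suc n))
    (SPO.<-respˡ-≈ (CR.+-identityˡ (fromℕ (suc n))) (+-monoˡ-< (fromℕ (suc n)) 0<1))

  1/_ : ∀ n → .{{NonZero n}} → Carrier
  1/ n = proj₁ (pos⇒invertible (0<fromℕ n))

------------------------------------------------------------------------

module Complex {c ℓ₁ ℓ₂} (R : Reals c ℓ₁ ℓ₂) where
  private module ℝ = Reals R
  open Reals R public using (fromℕ; 1/_) renaming
    (Carrier to ℝ; _≈_ to _≈ᴿ_; _<_ to _<ᴿ_; _+_ to _+ᴿ_; _*_ to _*ᴿ_; -_ to -ᴿ_; _-_ to infixl 6 _-ᴿ_;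
     0# to 0ᴿ; 1# to 1ᴿ)

  open FiniteSum ℝ.+-rawMonoid public using () renaming (sum to sumᴿ; ∑[_] to ∑ᴿ[_])

  infix 6 _+i_
  record ℂ : Set c where
    constructor _+i_
    field
      re im : ℝ
  open ℂ public

  infix 4 _≈_
  record _≈_ (z w : ℂ) : Set ℓ₁ where
    constructor mk≈
    field
      re≈ : re z ≈ᴿ re w
      im≈ : im z ≈ᴿ im w
  open _≈_ public

  infixl 6 _+_
  infixl 7 _*_
  infix  8 -_
  _+_ _*_ : ℂ → ℂ → ℂ
  (x +i y) + (u +i v) = (x +ᴿ u) +i (y +ᴿ v)
  (x +i y) * (u +i v) = ((x *ᴿ u) -ᴿ (y *ᴿ v)) +i ((x *ᴿ v) +ᴿ (y *ᴿ u))

  -_ : ℂ → ℂ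
  - (x +i y) = (-ᴿ x) +i (-ᴿ y)

  0ᶜ 1ᶜ : ℂ
  0ᶜ = 0ᴿ +i 0ᴿ
  1ᶜ = 1ᴿ +i 0ᴿ

  ofReal : ℝ → ℂ
  ofReal x = x +i 0ᴿ

  ℂ-rawRing : RawRing c ℓ₁
  ℂ-rawRing = record
    { Carrier = ℂ ; _≈_ = _≈_ ; _+_ = _+_ ; _*_ = _*_ ; -_ = -_ ; 0# = 0ᶜ ; 1# = 1ᶜ }

  open RawSemiringDefs (RawRing.rawSemiring ℂ-rawRing) public using (_^_)
  open FiniteSum (RawRing.+-rawMonoid ℂ-rawRing) public

  infix 4 _⟶_
  -- Convergence of real and imaginary parts.
  _⟶_ : (ℕ → ℂ) → ℂ → Set (c ⊔ ℓ₂)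
  f ⟶ w = ((re ∘ f) ℝ.⟶ re w) × ((im ∘ f) ℝ.⟶ im w)

  -- exp z = ∑ zᵏ / k!
  IsExponential : (ℂ → ℂ) → Set (c ⊔ ℓ₂)
  IsExponential exp = ∀ z → partialSum z ⟶ exp z
    where
    partialSum : ℂ → ℕ → ℂ
    partialSum z N = sum {N} (λ k → ofReal (1/_ (toℕ k !) {{ℕₚ._!≢0 (toℕ k)}}) * z ^ toℕ k)

  sin : (ℂ → ℂ) → ℝ → ℝ
  sin exp x = im (exp (0ᴿ +i x))

  -- π is the least positive zero of the sine.
  record IsPi (exp : ℂ → ℂ) (π : ℝ) : Set (c ⊔ ℓ₁ ⊔ ℓ₂) where
    field
      positive : 0ᴿ <ᴿ π
      vanishes : sin exp π ≈ᴿ 0ᴿ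
      least    : ∀ x → 0ᴿ <ᴿ x → x <ᴿ π → ¬ (sin exp x ≈ᴿ 0ᴿ)

  -- e^(2πij/n)
  e^2πi : (ℂ → ℂ) → ℝ → ℕ → ∀ n → .{{NonZero n}} → ℂ
  e^2πi exp π j n = exp (0ᴿ +i (fromℕ (2 ℕ.* j) *ᴿ π *ᴿ 1/ n))

  record μ (n : ℕ) : Set (c ⊔ ℓ₁) where
    field
      val       : ℂ
      val⁻¹     : ℂ
      val*val⁻¹ : val * val⁻¹ ≈ 1ᶜ
      val^n≈1   : val ^ n ≈ 1ᶜ
  open μ public using (val; val⁻¹)

  -- A character mod p, extended to 0; at the other non-units (there are
  -- none when p is prime) nothing is required.  Values on units are
  -- automatically in ℂ*, by the first two conditions.
  record Character (p : ℕ) .{{_ : NonZero p}} : Set (c ⊔ ℓ₁) where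
    field
      ⟦_⟧ : ℤ/ p → ℂ
      1-homo : ⟦ 1ₘ ⟧ ≈ 1ᶜ
      *-homo : ∀ x y → IsUnit x → IsUnit y → ⟦ x *ₘ y ⟧ ≈ ⟦ x ⟧ * ⟦ y ⟧

    Trivial : Set ℓ₁
    Trivial = ∀ x → IsUnit x → ⟦ x ⟧ ≈ 1ᶜ

    field
      trivial⇒0↦1    : Trivial → ⟦ 0ₘ ⟧ ≈ 1ᶜ
      nontrivial⇒0↦0 : ¬ Trivial → ⟦ 0ₘ ⟧ ≈ 0ᶜ
  open Character public using (⟦_⟧)

  -- λ = χⁱ in the group of characters of (ℤ/p)*.  The value λ(0) is given
  -- by the convention for λ, so it need not be χ(0)ⁱ.
  _IsPower_Of_ : ∀ {p} .{{_ : NonZero p}} → Character p → ℕ → Character p → Set ℓ₁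
  ƛ IsPower i Of χ = ∀ x → IsUnit x → ⟦ ƛ ⟧ x ≈ ⟦ χ ⟧ x ^ i

  J : ∀ {p} .{{_ : NonZero p}} → Character p → Character p → ℂ
  J χ ƛ = sum (λ u → ∑[ (λ v → u +ₘ v ≟ᶠ 1ₘ) ] (λ v → ⟦ χ ⟧ u * ⟦ ƛ ⟧ v))

  -- ∑_{b ∈ B} ψ(b)⁻ⁱ ψ(1-b)⁻ʲ
  coeff : ∀ {q n} .{{_ : NonZero q}} → (ℤ/ q → μ n) → Subset q → ℕ → ℕ → ℂ
  coeff ψ B i j = ∑[ _∈? B ] (λ b → val⁻¹ (ψ b) ^ i * val⁻¹ (ψ (1ₘ -ₘ b)) ^ j)

{-# OPTIONS --safe #-}

-- The elements of S are the aʲ with 0 ≤ j < p - 1, so |S ∩ (S + 1)| counts the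
-- pairs (j , k) with αʲ = αᵏ + 1 and βʲ = βᵏ + 1.  With ζ = χ(α), orthogonality
-- of the powers of ζ detects j and k modulo n and turns n² |S ∩ (S + 1)| into
-- the sum over u , v modulo n of T(u , v) = c(u , v) J(χᵘ , χᵛ), where for
-- u = 0 or v = 0 the Jacobi sum is taken without the arguments 0.  The
-- symmetries x = y + 1 ⇔ x / y = 1 / y + 1 ⇔ - y = - x + 1 of the equation
-- identify the three lines u = 0, v = 0 and u + v = n, each of which
-- contributes |B| away from (0 , 0), where T is (p - 2) |B|; complex
-- conjugation folds u + v > n onto u + v < n, and T(u , v) = T(v , u) leaves
-- u ≤ v.
--
-- The exponential function enters only through ζᵏ ≠ 1 for 0 < k < n.  This
-- follows from exp(2iy) = exp(iy)² and sin y ≠ 0 for y = πk/n; the other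
-- properties of ζ come from χ and ψ being multiplicative.

module Submission where

open import Defs
open import Algebra.Bundles using (CommutativeRing)
import Algebra.Properties.CommutativeSemiring.Binomial
import Algebra.Properties.CommutativeSemiring.Exp
import Algebra.Properties.Ring
import Algebra.Properties.Semiring.Exp
import Algebra.Properties.Semiring.Mult
import Algebra.Properties.Semiring.Mult.TCOptimised
import Algebra.Properties.Semiring.Sum
import Algebra.Solver.Ring
import Algebra.Solver.Ring.AlmostCommutativeRing as ACR
open import Data.Bool.Base using (true; false; if_then_else_)
open import Data.Fin.Base as Fin using (Fin; toℕ; fromℕ<)
open import Data.Fin.Properties as Finₚ using (any?)
open import Data.Fin.Subset using (Subset; ∣_∣; _∩_; _∈_; inside; outside)
open import Data.Fin.Subset.Properties using (_∈?_; x∈p∩q⁺; x∈p∩q⁻)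
open import Data.Integer.Base as ℤ using (ℤ; +_; -[1+_])
import Data.Integer.Properties as ℤₚ
open import Data.Maybe.Base using (Maybe; just; nothing)
open import Data.Nat.Base as ℕ using (ℕ; zero; suc; NonZero; _∸_; _!; s≤s; z≤n)
open import Data.Nat.Combinatorics using (_C_; nCk≡n!/k![n-k]!; k![n∸k]!∣n!)
open import Data.Nat.Coprimality using (Coprime; coprime-divisor; coprime-Bézout; prime⇒coprime)
open import Data.Nat.Divisibility using (_∣_; divides; ∣⇒≤; *-monoˡ-∣; m∣m*n; n∣m*n)
open import Data.Nat.DivMod
import Data.Nat.GCD as GCD
open import Data.Nat.Primality using (Prime; prime⇒irreducible)
open import Data.Nat.Properties as ℕₚ using (_≤?_; _<?_; m*n≢0)
open import Data.Product.Base using (∃; _×_; _,_; proj₁; proj₂)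
import Data.Sign.Base as Sign
open import Data.Sum.Base using (_⊎_; inj₁; inj₂)
open import Data.Unit.Base using (tt)
open import Data.Vec.Base using ([]; _∷_)
open import Data.Vec.Properties using (lookup∘tabulate; []=⇒lookup; lookup⇒[]=)
open import Function.Base using (_∘_)
open import Function.Bundles using (mk⇔)
open import Level using (_⊔_; 0ℓ)
open import Relation.Binary.Definitions using (tri<; tri≈; tri>)
open import Relation.Binary.PropositionalEquality as ≡ using (_≡_; _≢_)
import Relation.Binary.Reasoning.Setoid
open import Relation.Binary.Structures using (IsStrictPartialOrder)
open import Relation.Nullary using (¬_; Dec; yes; no; does; contradiction)
open import Relation.Nullary.Decidable using (_×-dec_; does-⇔; dec-true; dec-false; ¬?)
open import Relation.Unary using (Pred; Decidable)

-- Commutative rings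

-- Each of the three lines contributes |B| because 1 never occurs as x in x = y + 1 with y a unit.
-- For 0 < u < n the sum of χᵘ over the whole group vanishes, so leaving out x = 1 makes the
-- α-factor of T(u , 0) equal to -1. Summed over all u, the β-factor tests for βˢ = 1 and vanishes.
-- Hence the sum of T(u , 0) over u ≠ 0 is minus that of the β-factor over u ≠ 0, which is its value
-- |B| at u = 0. The hypothesis on a^((p-1)/2) makes negation a shift of the exponent by (p-1)/2
-- modulo p and modulo q at once. The signs that arise in the two factors of T are inverse to each
-- other and cancel. The order of the reals is not decidable, and the exponential function is known
-- only as the limit of its series. Equality and ≤ are stable under double negation, which restores
-- case distinctions for such goals; the squaring formula is obtained from a Cauchy product with an
-- explicit bound on the remainder.

module IntegerSolver {c ℓ} (R : CommutativeRing c ℓ) where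
  open CommutativeRing R
  open Algebra.Properties.Ring ring
  open Algebra.Properties.Semiring.Mult.TCOptimised semiring renaming (_×_ to _·_)
  open Relation.Binary.Reasoning.Setoid setoid

  -- Integer coefficients have decidable equality, which the solver needs to compare coefficients
  -- and which is not assumed of the reals. With the optimised multiples, 0 and 1 go to the
  -- constants of the ring by computation.
  ⟦_⟧ℤ : ℤ → Carrier
  ⟦ + n ⟧ℤ      = n · 1#
  ⟦ -[1+ n ] ⟧ℤ = - (suc n · 1#)

  private
    swap-inner : ∀ a b x y → (a + x) + (b + y) ≈ (a + b) + (x + y)
    swap-inner a b x y = begin
      (a + x) + (b + y) ≈⟨ +-assoc a x (b + y) ⟩
      a + (x + (b + y)) ≈⟨ +-congˡ (sym (+-assoc x b y)) ⟩
      a + ((x + b) + y) ≈⟨ +-congˡ (+-congʳ (+-comm x b)) ⟩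
      a + ((b + x) + y) ≈⟨ +-congˡ (+-assoc b x y) ⟩
      a + (b + (x + y)) ≈⟨ +-assoc a b (x + y) ⟨
      (a + b) + (x + y) ∎

    ⊖-homo : ∀ m n → ⟦ m ℤ.⊖ n ⟧ℤ ≈ m · 1# - n · 1#
    ⊖-homo m zero = begin
      ⟦ m ℤ.⊖ 0 ⟧ℤ     ≡⟨ ≡.cong ⟦_⟧ℤ (ℤₚ.⊖-≥ {m} ℕ.z≤n) ⟩
      m · 1#           ≈⟨ +-identityʳ _ ⟨
      m · 1# + 0#      ≈⟨ +-congˡ -0#≈0# ⟨
      m · 1# - 0#      ∎
    ⊖-homo zero (suc n) = sym (+-identityˡ _)
    ⊖-homo (suc m) (suc n) = begin
      ⟦ suc m ℤ.⊖ suc n ⟧ℤ                  ≡⟨ ≡.cong ⟦_⟧ℤ (ℤₚ.[1+m]⊖[1+n]≡m⊖n m n) ⟩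
      ⟦ m ℤ.⊖ n ⟧ℤ                          ≈⟨ ⊖-homo m n ⟩
      m · 1# - n · 1#                       ≈⟨ +-identityˡ _ ⟨
      0# + (m · 1# - n · 1#)                ≈⟨ +-congʳ (-‿inverseʳ 1#) ⟨
      (1# - 1#) + (m · 1# - n · 1#)         ≈⟨ swap-inner 1# (m · 1#) (- 1#) (- (n · 1#)) ⟩
      (1# + m · 1#) + (- 1# - n · 1#)       ≈⟨ +-congˡ (-‿+-comm 1# (n · 1#)) ⟩
      (1# + m · 1#) - (1# + n · 1#)         ≈⟨ +-cong (1+× m 1#) (-‿cong (1+× n 1#)) ⟨
      suc m · 1# - suc n · 1#               ∎

    +-homo : ∀ i j → ⟦ i ℤ.+ j ⟧ℤ ≈ ⟦ i ⟧ℤ + ⟦ j ⟧ℤ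
    +-homo (+ m) (+ n) = ×-homo-+ 1# m n
    +-homo (+ m) -[1+ n ] = ⊖-homo m (suc n)
    +-homo -[1+ m ] (+ n) = trans (⊖-homo n (suc m)) (+-comm _ _)
    +-homo -[1+ m ] -[1+ n ] = begin
      - (suc (suc (m ℕ.+ n)) · 1#)          ≡⟨ ≡.cong (λ k → - (suc k · 1#)) (ℕₚ.+-suc m n) ⟨
      - ((suc m ℕ.+ suc n) · 1#)            ≈⟨ -‿cong (×-homo-+ 1# (suc m) (suc n)) ⟩
      - (suc m · 1# + suc n · 1#)           ≈⟨ -‿+-comm _ _ ⟨
      - (suc m · 1#) - suc n · 1#           ∎

    -‿homo : ∀ i → ⟦ ℤ.- i ⟧ℤ ≈ - ⟦ i ⟧ℤ
    -‿homo (+ zero)  = sym -0#≈0#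
    -‿homo (+ suc n) = refl
    -‿homo -[1+ n ]  = sym (-‿involutive _)

    +◃-homo : ∀ n → ⟦ Sign.+ ℤ.◃ n ⟧ℤ ≈ n · 1#
    +◃-homo n = reflexive (≡.cong ⟦_⟧ℤ (ℤₚ.+◃n≡+n n))

    -◃-homo : ∀ n → ⟦ Sign.- ℤ.◃ n ⟧ℤ ≈ - (n · 1#)
    -◃-homo n = trans (reflexive (≡.cong ⟦_⟧ℤ (ℤₚ.-◃n≡-n n))) (-‿homo (+ n))

    *-homo : ∀ i j → ⟦ i ℤ.* j ⟧ℤ ≈ ⟦ i ⟧ℤ * ⟦ j ⟧ℤ
    *-homo (+ m) (+ n) = trans (+◃-homo (m ℕ.* n)) (×1-homo-* m n)
    *-homo (+ m) -[1+ n ] = trans (-◃-homo (m ℕ.* suc n))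
      (trans (-‿cong (×1-homo-* m (suc n))) (-‿distribʳ-* _ _))
    *-homo -[1+ m ] (+ n) = trans (-◃-homo (suc m ℕ.* n))
      (trans (-‿cong (×1-homo-* (suc m) n)) (-‿distribˡ-* _ _))
    *-homo -[1+ m ] -[1+ n ] = begin
      ⟦ Sign.+ ℤ.◃ suc m ℕ.* suc n ⟧ℤ        ≈⟨ +◃-homo (suc m ℕ.* suc n) ⟩
      (suc m ℕ.* suc n) · 1#                ≈⟨ ×1-homo-* (suc m) (suc n) ⟩
      suc m · 1# * suc n · 1#               ≈⟨ -‿involutive _ ⟨
      - - (suc m · 1# * suc n · 1#)         ≈⟨ -‿cong (-‿distribˡ-* _ _) ⟩
      - (- (suc m · 1#) * suc n · 1#)       ≈⟨ -‿distribʳ-* _ _ ⟩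
      - (suc m · 1#) * - (suc n · 1#)       ∎

    almostCommutativeRing : ACR.AlmostCommutativeRing c ℓ
    almostCommutativeRing = ACR.fromCommutativeRing R

    morphism : ℤ.+-*-rawRing ACR.-Raw-AlmostCommutative⟶ almostCommutativeRing
    morphism = record
      { ⟦_⟧ = ⟦_⟧ℤ ; +-homo = +-homo ; *-homo = *-homo ; -‿homo = -‿homo
      ; 0-homo = refl ; 1-homo = refl }

    _≟_ : ∀ i j → Maybe (⟦ i ⟧ℤ ≈ ⟦ j ⟧ℤ)
    i ≟ j with i ℤₚ.≟ j
    ... | yes eq = just (reflexive (≡.cong ⟦_⟧ℤ eq))
    ... | no _   = nothing

  open Algebra.Solver.Ring ℤ.+-*-rawRing almostCommutativeRing morphism _≟_ public
    using (solve; _:=_; _:+_; _:*_; _:-_; :-_; con)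

-- Finite sums and indicator functions

module Sums {c ℓ} (A : CommutativeRing c ℓ) where
  open import Data.Nat.Base using (_<_)
  open CommutativeRing A
  open Algebra.Properties.Semiring.Sum semiring public
  open Algebra.Properties.Semiring.Mult semiring using () renaming (_×_ to _·_)
  open import Algebra.Properties.Ring ring using (+-cancelˡ)
  open Relation.Binary.Reasoning.Setoid setoid
  open IntegerSolver A using (solve; _:=_; _:+_)

  -- Indices are natural numbers rather than elements of `Fin`, because exponents get shifted,
  -- reversed and reflected, and sums of different lengths are compared.
  Σ : ℕ → (ℕ → Carrier) → Carrier
  Σ zero    f = 0#
  Σ (suc N) f = f 0 + Σ N (λ k → f (suc k))

  sum-Σ : ∀ N (f : ℕ → Carrier) → sum {N} (λ k → f (toℕ k)) ≈ Σ N f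
  sum-Σ zero    f = refl
  sum-Σ (suc N) f = +-congˡ (sum-Σ N (λ k → f (suc k)))

  Σ-cong : ∀ N {f g} → (∀ k → k < N → f k ≈ g k) → Σ N f ≈ Σ N g
  Σ-cong zero    eq = refl
  Σ-cong (suc N) eq = +-cong (eq 0 (s≤s z≤n)) (Σ-cong N λ k k<N → eq (suc k) (s≤s k<N))

  Σ-distrib-+ : ∀ N f g → Σ N (λ k → f k + g k) ≈ Σ N f + Σ N g
  Σ-distrib-+ zero    f g = sym (+-identityˡ 0#)
  Σ-distrib-+ (suc N) f g = trans (+-congˡ (Σ-distrib-+ N (f ∘ suc) (g ∘ suc)))
    (solve 4 (λ a b x y → (a :+ b) :+ (x :+ y) := (a :+ x) :+ (b :+ y)) refl (f 0) (g 0) _ _)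

  *-distribˡ-Σ : ∀ N x f → x * Σ N f ≈ Σ N (λ k → x * f k)
  *-distribˡ-Σ zero    x f = zeroʳ x
  *-distribˡ-Σ (suc N) x f = trans (distribˡ x _ _) (+-congˡ (*-distribˡ-Σ N x (f ∘ suc)))

  *-distribʳ-Σ : ∀ N x f → Σ N f * x ≈ Σ N (λ k → f k * x)
  *-distribʳ-Σ N x f = trans (*-comm _ x) (trans (*-distribˡ-Σ N x f) (Σ-cong N λ k _ → *-comm x (f k)))

  Σ-*-Σ : ∀ M N f g → Σ M f * Σ N g ≈ Σ M λ i → Σ N λ j → f i * g j
  Σ-*-Σ M N f g = trans (*-distribʳ-Σ M (Σ N g) f) (Σ-cong M λ i _ → *-distribˡ-Σ N (f i) g)

  Σ-0 : ∀ N {f} → (∀ k → k < N → f k ≈ 0#) → Σ N f ≈ 0#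
  Σ-0 zero    eq = refl
  Σ-0 (suc N) eq = trans (+-cong (eq 0 (s≤s z≤n)) (Σ-0 N λ k k<N → eq (suc k) (s≤s k<N))) (+-identityˡ 0#)

  Σ-comm : ∀ M N (f : ℕ → ℕ → Carrier) → Σ M (λ i → Σ N λ j → f i j) ≈ Σ N (λ j → Σ M λ i → f i j)
  Σ-comm zero    N f = sym (Σ-0 N λ _ _ → refl)
  Σ-comm (suc M) N f = trans (+-congˡ (Σ-comm M N λ i j → f (suc i) j)) (sym (Σ-distrib-+ N (f 0) λ j → Σ M λ i → f (suc i) j))

  Σ-const : ∀ N → Σ N (λ _ → 1#) ≈ N · 1#
  Σ-const zero    = refl
  Σ-const (suc N) = +-congˡ (Σ-const N)

  Σ-last : ∀ N f → Σ (suc N) f ≈ Σ N f + f N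
  Σ-last zero    f = trans (+-identityʳ _) (sym (+-identityˡ _))
  Σ-last (suc N) f = trans (+-congˡ (Σ-last N (f ∘ suc))) (sym (+-assoc _ _ _))

  Σ-split : ∀ M N f → Σ (M ℕ.+ N) f ≈ Σ M f + Σ N (λ k → f (M ℕ.+ k))
  Σ-split zero    N f = sym (+-identityˡ _)
  Σ-split (suc M) N f = trans (+-congˡ (Σ-split M N (f ∘ suc))) (sym (+-assoc _ _ _))

  Σ-reverse : ∀ N f → Σ N (λ k → f (N ∸ suc k)) ≈ Σ N f
  Σ-reverse zero    f = refl
  Σ-reverse (suc N) f = trans (+-congˡ (Σ-reverse N f)) (trans (+-comm _ _) (sym (Σ-last N f)))

  Periodic : ℕ → (ℕ → Carrier) → Set ℓ
  Periodic N f = ∀ k → f (k ℕ.+ N) ≈ f k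

  -- A shift by one moves the first term to the end, where periodicity identifies it with `f s`.
  -- Reading the sum of length `suc N` from both ends leaves this common term to be cancelled.
  Σ-shift : ∀ N f → Periodic N f → ∀ s → Σ N (λ k → f (k ℕ.+ s)) ≈ Σ N f
  Σ-shift N f per zero    = Σ-cong N λ k _ → reflexive (≡.cong f (ℕₚ.+-identityʳ k))
  Σ-shift N f per (suc s) = begin
    Σ N (λ k → f (k ℕ.+ suc s))   ≈⟨ Σ-cong N (λ k _ → reflexive (≡.cong f (ℕₚ.+-suc k s))) ⟩
    Σ N (λ k → f (suc k ℕ.+ s))   ≈⟨ +-cancelˡ (f s) _ _ rotate ⟩
    Σ N (λ k → f (k ℕ.+ s))       ≈⟨ Σ-shift N f per s ⟩
    Σ N f                         ∎
    where
    rotate : f s + Σ N (λ k → f (suc k ℕ.+ s)) ≈ f s + Σ N (λ k → f (k ℕ.+ s))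
    rotate = begin
      Σ (suc N) (λ k → f (k ℕ.+ s))            ≈⟨ Σ-last N (λ k → f (k ℕ.+ s)) ⟩
      Σ N (λ k → f (k ℕ.+ s)) + f (N ℕ.+ s)    ≈⟨ +-congˡ (reflexive (≡.cong f (ℕₚ.+-comm N s))) ⟩
      Σ N (λ k → f (k ℕ.+ s)) + f (s ℕ.+ N)    ≈⟨ +-congˡ (per s) ⟩
      Σ N (λ k → f (k ℕ.+ s)) + f s            ≈⟨ +-comm _ _ ⟩
      f s + Σ N (λ k → f (k ℕ.+ s))            ∎

  -- The arguments `N ∸ k` run from `N` down to 1 and not from `N - 1` down to 0, so reversal alone
  -- is off by one; a periodic shift by 1 makes up for it.
  Σ-reflect : ∀ N f → Periodic N f → Σ N (λ k → f (N ∸ k)) ≈ Σ N f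
  Σ-reflect N f per = begin
    Σ N (λ k → f (N ∸ k))               ≈⟨ Σ-cong N (λ k k<N → reflexive (≡.cong f (≡.sym (ℕₚ.+-∸-assoc 1 k<N)))) ⟨
    Σ N (λ k → f (suc (N ∸ suc k)))     ≈⟨ Σ-reverse N (f ∘ suc) ⟩
    Σ N (f ∘ suc)                       ≈⟨ Σ-cong N (λ k _ → reflexive (≡.cong f (ℕₚ.+-comm k 1))) ⟨
    Σ N (λ k → f (k ℕ.+ 1))             ≈⟨ Σ-shift N f per 1 ⟩
    Σ N f                               ∎

  -- The Iverson bracket, through which conditions on residues become factors of summands.
  [_] : ∀ {p} {P : Set p} → Dec P → Carrier
  [ P? ] = if does P? then 1# else 0#

  []-yes : ∀ {p} {P : Set p} (P? : Dec P) → P → [ P? ] ≈ 1#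
  []-yes P? p = reflexive (≡.cong (if_then 1# else 0#) (dec-true P? p))

  []-no : ∀ {p} {P : Set p} (P? : Dec P) → ¬ P → [ P? ] ≈ 0#
  []-no P? ¬p = reflexive (≡.cong (if_then 1# else 0#) (dec-false P? ¬p))

  []-⇔ : ∀ {p q} {P : Set p} {Q : Set q} (P? : Dec P) (Q? : Dec Q) → (P → Q) → (Q → P) → [ P? ] ≈ [ Q? ]
  []-⇔ P? Q? f g = reflexive (≡.cong (if_then 1# else 0#) (does-⇔ (mk⇔ f g) P? Q?))

  []-× : ∀ {p q} {P : Set p} {Q : Set q} (P? : Dec P) (Q? : Dec Q) → [ P? ×-dec Q? ] ≈ [ P? ] * [ Q? ]
  []-× P? Q? with does P?
  ... | true  = sym (*-identityˡ _)
  ... | false = sym (zeroˡ _)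

  if-[] : ∀ {p} {P : Set p} (P? : Dec P) x → (if does P? then x else 0#) ≈ [ P? ] * x
  if-[] P? x with does P?
  ... | true  = sym (*-identityˡ x)
  ... | false = sym (zeroˡ x)

  -- A vanishing bracket absorbs any discrepancy, so a summand may be rewritten with its own
  -- condition as a hypothesis.
  []-*-cong : ∀ {p} {P : Set p} (P? : Dec P) {x y} → (P → x ≈ y) → [ P? ] * x ≈ [ P? ] * y
  []-*-cong P? {x} {y} eq with P?
  ... | yes p = *-congˡ (eq p)
  ... | no _  = trans (zeroˡ x) (sym (zeroˡ y))

  sum-none : ∀ {n p} {P : Pred (Fin n) p} (P? : Decidable P) (f : Fin n → Carrier) → (∀ j → ¬ P j) → sum (λ j → [ P? j ] * f j) ≈ 0#
  sum-none {n} P? f none = trans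
    (sum-cong-≋ λ j → trans (*-congʳ ([]-no (P? j) (none j))) (zeroˡ (f j))) (sum-replicate-zero n)

  sum-only : ∀ {n p} {P : Pred (Fin n) p} (P? : Decidable P) (f : Fin n → Carrier) i → P i → (∀ j → P j → j ≡ i) →
             sum (λ j → [ P? j ] * f j) ≈ f i
  sum-only {suc n} P? f Fin.zero p unique = begin
    [ P? Fin.zero ] * f Fin.zero + sum (λ j → [ P? (Fin.suc j) ] * f (Fin.suc j))
      ≈⟨ +-cong (trans (*-congʳ ([]-yes (P? Fin.zero) p)) (*-identityˡ _))
                (sum-none (P? ∘ Fin.suc) (f ∘ Fin.suc) λ j q → Finₚ.0≢1+n (≡.sym (unique (Fin.suc j) q))) ⟩
    f Fin.zero + 0#     ≈⟨ +-identityʳ _ ⟩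
    f Fin.zero          ∎
  sum-only {suc n} P? f (Fin.suc i) p unique = begin
    [ P? Fin.zero ] * f Fin.zero + sum (λ j → [ P? (Fin.suc j) ] * f (Fin.suc j))
      ≈⟨ +-cong (trans (*-congʳ ([]-no (P? Fin.zero) λ q → Finₚ.0≢1+n (unique Fin.zero q))) (zeroˡ _))
                (sum-only (P? ∘ Fin.suc) (f ∘ Fin.suc) i p λ j q → Finₚ.suc-injective (unique (Fin.suc j) q)) ⟩
    0# + f (Fin.suc i)  ≈⟨ +-identityˡ _ ⟩
    f (Fin.suc i)       ∎

  Σ-only : ∀ {N p} {P : Pred ℕ p} (P? : Decidable P) (f : ℕ → Carrier) i → i < N → P i → (∀ j → j < N → P j → j ≡ i) →
           Σ N (λ j → [ P? j ] * f j) ≈ f i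
  Σ-only {N} {P = P} P? f i i<N p unique = trans (sym (sum-Σ N (λ j → [ P? j ] * f j))) (trans
    (sum-only {N} (P? ∘ toℕ) (f ∘ toℕ) (fromℕ< i<N) (≡.subst P (≡.sym (Finₚ.toℕ-fromℕ< i<N)) p)
      λ j q → Finₚ.toℕ-injective (≡.trans (unique (toℕ j) (Finₚ.toℕ<n j) q) (≡.sym (Finₚ.toℕ-fromℕ< i<N))))
    (reflexive (≡.cong f (Finₚ.toℕ-fromℕ< i<N))))

  Σ-none : ∀ N {p} {P : Pred ℕ p} (P? : Decidable P) (f : ℕ → Carrier) → (∀ j → j < N → ¬ P j) → Σ N (λ j → [ P? j ] * f j) ≈ 0#
  Σ-none N P? f none = trans (sym (sum-Σ N (λ j → [ P? j ] * f j))) (sum-none {N} (P? ∘ toℕ) (f ∘ toℕ) λ j → none (toℕ j) (Finₚ.toℕ<n j))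

  -- Uniqueness of the witness keeps the sum at 0 or 1. This is the passage from membership in a set
  -- of powers to a sum over exponents.
  Σ-∃ : ∀ N {p q} {P : Pred ℕ p} {Q : Set q} (P? : Decidable P) (Q? : Dec Q) →
        (∀ j k → j < N → k < N → P j → P k → j ≡ k) →
        (∀ j → j < N → P j → Q) → (Q → ∃ λ j → j < N × P j) → Σ N (λ j → [ P? j ]) ≈ [ Q? ]
  Σ-∃ N {P = P} P? Q? unique to from = trans (Σ-cong N λ j _ → sym (*-identityʳ [ P? j ])) (count Q?)
    where
    count : ∀ Q? → Σ N (λ j → [ P? j ] * 1#) ≈ [ Q? ]
    count (yes q) with i , i<N , p ← from q = Σ-only P? (λ _ → 1#) i i<N p λ j j<N p′ → unique j i j<N i<N p′ p
    count (no ¬q) = Σ-none N P? (λ _ → 1#) λ j j<N p → ¬q (to j j<N p)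

  sum-≟ : ∀ {M} (i : Fin M) (f : Fin M → Carrier) → sum (λ j → [ i Finₚ.≟ j ] * f j) ≈ f i
  sum-≟ i f = sum-only (i Finₚ.≟_) f i ≡.refl λ _ → ≡.sym

  ∣∣-sum : ∀ {n} (T : Subset n) → ∣ T ∣ · 1# ≈ sum (λ x → [ x ∈? T ])
  ∣∣-sum []            = refl
  ∣∣-sum (inside  ∷ T) = +-congˡ (∣∣-sum T)
  ∣∣-sum (outside ∷ T) = trans (∣∣-sum T) (sym (+-identityˡ _))

-- Residues modulo m

module Residues where
  open import Data.Nat.Base using (_<_; _≤_)
  open ≡ using (refl; sym; trans; cong; cong₂; subst; module ≡-Reasoning)

  module _ {m : ℕ} .{{_ : NonZero m}} where

    mod-≡ : ∀ {x y} → x % m ≡ y % m → x mod m ≡ y mod m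
    mod-≡ {x} {y} eq = Finₚ.toℕ-injective
      (trans (Finₚ.toℕ-fromℕ< (m%n<n x m)) (trans eq (sym (Finₚ.toℕ-fromℕ< (m%n<n y m)))))

    toℕ-mod : ∀ x → toℕ (x mod m) ≡ x % m
    toℕ-mod x = Finₚ.toℕ-fromℕ< (m%n<n x m)

    mod-toℕ : ∀ (x : ℤ/ m) → toℕ x mod m ≡ x
    mod-toℕ x = Finₚ.toℕ-injective (trans (toℕ-mod (toℕ x)) (m<n⇒m%n≡m (Finₚ.toℕ<n x)))

    mod-homo-+ : ∀ x y → (x mod m) +ₘ (y mod m) ≡ (x ℕ.+ y) mod m
    mod-homo-+ x y = mod-≡ (trans
      (cong₂ (λ u v → (u ℕ.+ v) % m) (toℕ-mod x) (toℕ-mod y)) (sym (%-distribˡ-+ x y m)))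

    mod-homo-* : ∀ x y → (x mod m) *ₘ (y mod m) ≡ (x ℕ.* y) mod m
    mod-homo-* x y = mod-≡ (trans
      (cong₂ (λ u v → (u ℕ.* v) % m) (toℕ-mod x) (toℕ-mod y)) (sym (%-distribˡ-* x y m)))

    private
      module _ {_∙_ : ℤ/ m → ℤ/ m → ℤ/ m} {_∙ₙ_ : ℕ → ℕ → ℕ}
        (homo : ∀ x y → (x mod m) ∙ (y mod m) ≡ (x ∙ₙ y) mod m) where

        -- Every residue is `toℕ y mod m`, so a nested operation can be pulled under a single `mod`;
        -- there the laws of ℕ apply.
        homoˡ : ∀ x y → (x mod m) ∙ y ≡ (x ∙ₙ toℕ y) mod m
        homoˡ x y = trans (cong ((x mod m) ∙_) (sym (mod-toℕ y))) (homo x (toℕ y))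

        homoʳ : ∀ x y → x ∙ (y mod m) ≡ (toℕ x ∙ₙ y) mod m
        homoʳ x y = trans (cong (_∙ (y mod m)) (sym (mod-toℕ x))) (homo (toℕ x) y)

    +ₘ-assoc : ∀ (x y z : ℤ/ m) → (x +ₘ y) +ₘ z ≡ x +ₘ (y +ₘ z)
    +ₘ-assoc x y z = trans (homoˡ {_+ₘ_} {ℕ._+_} mod-homo-+ (toℕ x ℕ.+ toℕ y) z)
      (trans (cong (_mod m) (ℕₚ.+-assoc (toℕ x) (toℕ y) (toℕ z))) (sym (homoʳ {_+ₘ_} {ℕ._+_} mod-homo-+ x _)))

    *ₘ-assoc : ∀ (x y z : ℤ/ m) → (x *ₘ y) *ₘ z ≡ x *ₘ (y *ₘ z)
    *ₘ-assoc x y z = trans (homoˡ {_*ₘ_} {ℕ._*_} mod-homo-* (toℕ x ℕ.* toℕ y) z)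
      (trans (cong (_mod m) (ℕₚ.*-assoc (toℕ x) (toℕ y) (toℕ z))) (sym (homoʳ {_*ₘ_} {ℕ._*_} mod-homo-* x _)))

    +ₘ-comm : ∀ (x y : ℤ/ m) → x +ₘ y ≡ y +ₘ x
    +ₘ-comm x y = cong (_mod m) (ℕₚ.+-comm (toℕ x) (toℕ y))

    *ₘ-comm : ∀ (x y : ℤ/ m) → x *ₘ y ≡ y *ₘ x
    *ₘ-comm x y = cong (_mod m) (ℕₚ.*-comm (toℕ x) (toℕ y))

    +ₘ-identityˡ : ∀ (x : ℤ/ m) → 0ₘ +ₘ x ≡ x
    +ₘ-identityˡ x = trans (homoˡ {_+ₘ_} {ℕ._+_} mod-homo-+ 0 x) (mod-toℕ x)

    *ₘ-identityˡ : ∀ (x : ℤ/ m) → 1ₘ *ₘ x ≡ x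
    *ₘ-identityˡ x = trans (homoˡ {_*ₘ_} {ℕ._*_} mod-homo-* 1 x)
      (trans (cong (_mod m) (ℕₚ.*-identityˡ (toℕ x))) (mod-toℕ x))

    *ₘ-distribˡ-+ₘ : ∀ (x y z : ℤ/ m) → x *ₘ (y +ₘ z) ≡ x *ₘ y +ₘ x *ₘ z
    *ₘ-distribˡ-+ₘ x y z = trans (homoʳ {_*ₘ_} {ℕ._*_} mod-homo-* x _)
      (trans (cong (_mod m) (ℕₚ.*-distribˡ-+ (toℕ x) (toℕ y) (toℕ z))) (sym (mod-homo-+ _ _)))

    -ₘ-inverseʳ : ∀ (x : ℤ/ m) → x +ₘ (-ₘ x) ≡ 0ₘ
    -ₘ-inverseʳ x = trans (homoʳ {_+ₘ_} {ℕ._+_} mod-homo-+ x _)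
      (mod-≡ (trans (cong (_% m) (ℕₚ.m+[n∸m]≡n (ℕₚ.<⇒≤ (Finₚ.toℕ<n x))))
                    (trans (n%n≡0 m) (sym (m*n%n≡0 0 m)))))

    ℤ/-commutativeRing : CommutativeRing 0ℓ 0ℓ
    ℤ/-commutativeRing = record
      { Carrier = ℤ/ m ; _≈_ = _≡_ ; _+_ = _+ₘ_ ; _*_ = _*ₘ_ ; -_ = -ₘ_ ; 0# = 0ₘ ; 1# = 1ₘ
      ; isCommutativeRing = record
        { isRing = record
          { +-isAbelianGroup = record
            { isGroup = record
              { isMonoid = record
                { isSemigroup = record
                  { isMagma = record { isEquivalence = ≡.isEquivalence ; ∙-cong = cong₂ _+ₘ_ }
                  ; assoc = +ₘ-assoc }
                ; identity = +ₘ-identityˡ , λ x → trans (+ₘ-comm x 0ₘ) (+ₘ-identityˡ x) }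
              ; inverse = (λ x → trans (+ₘ-comm _ x) (-ₘ-inverseʳ x)) , -ₘ-inverseʳ
              ; ⁻¹-cong = cong (λ x → -ₘ x) }
            ; comm = +ₘ-comm }
          ; *-cong = cong₂ _*ₘ_
          ; *-assoc = *ₘ-assoc
          ; *-identity = *ₘ-identityˡ , λ x → trans (*ₘ-comm x 1ₘ) (*ₘ-identityˡ x)
          ; distrib = *ₘ-distribˡ-+ₘ , λ x y z → trans (*ₘ-comm (y +ₘ z) x)
              (trans (*ₘ-distribˡ-+ₘ x y z) (cong₂ _+ₘ_ (*ₘ-comm x y) (*ₘ-comm x z))) }
        ; *-comm = *ₘ-comm } }

    *ₘ-cancelˡ-unit : ∀ (u : ℤ/ m) → IsUnit u → ∀ x y → u *ₘ x ≡ u *ₘ y → x ≡ y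
    *ₘ-cancelˡ-unit u (v , uv≡1) x y eq = begin
      x              ≡⟨ v*ux x ⟨
      v *ₘ (u *ₘ x)  ≡⟨ cong (v *ₘ_) eq ⟩
      v *ₘ (u *ₘ y)  ≡⟨ v*ux y ⟩
      y              ∎
      where
      open ≡-Reasoning
      v*ux : ∀ x → v *ₘ (u *ₘ x) ≡ x
      v*ux x = begin
        v *ₘ (u *ₘ x)  ≡⟨ *ₘ-assoc v u x ⟨
        (v *ₘ u) *ₘ x  ≡⟨ cong (_*ₘ x) (trans (*ₘ-comm v u) uv≡1) ⟩
        1ₘ *ₘ x        ≡⟨ *ₘ-identityˡ x ⟩
        x              ∎

    ^ₘ-homo-+ : ∀ (g : ℤ/ m) j k → g ^ₘ (j ℕ.+ k) ≡ g ^ₘ j *ₘ g ^ₘ k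
    ^ₘ-homo-+ g zero    k = sym (*ₘ-identityˡ _)
    ^ₘ-homo-+ g (suc j) k = trans (cong (g *ₘ_) (^ₘ-homo-+ g j k)) (sym (*ₘ-assoc g _ _))

    *ₘ-unit : ∀ (x y : ℤ/ m) → IsUnit x → IsUnit y → IsUnit (x *ₘ y)
    *ₘ-unit x y (u , xu) (v , yv) = u *ₘ v ,
      trans (solve 4 (λ x y u v → (x :* y) :* (u :* v) := (x :* u) :* (y :* v)) refl x y u v)
            (trans (cong₂ _*ₘ_ xu yv) (*ₘ-identityˡ 1ₘ))
      where open IntegerSolver ℤ/-commutativeRing

    ^ₘ-unit : ∀ (g : ℤ/ m) → IsUnit g → ∀ j → IsUnit (g ^ₘ j)
    ^ₘ-unit g u zero    = 1ₘ , *ₘ-identityˡ 1ₘ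
    ^ₘ-unit g u (suc j) = *ₘ-unit g (g ^ₘ j) u (^ₘ-unit g u j)

    -- Otherwise 0 = 1, and it is `1 < m` that keeps these two residues apart: in ℤ/1 zero is a
    -- unit.
    unit⇒≢0 : 1 < m → ∀ (x : ℤ/ m) → IsUnit x → x ≢ 0ₘ
    unit⇒≢0 1<m x (y , xy≡1) refl = ℕₚ.0≢1+n (begin
      0               ≡⟨ m*n%n≡0 0 m ⟨
      0 % m           ≡⟨ toℕ-mod 0 ⟨
      toℕ (0ₘ {m})    ≡⟨ cong toℕ (trans (sym (CommutativeRing.zeroˡ ℤ/-commutativeRing y)) xy≡1) ⟩
      toℕ (1ₘ {m})    ≡⟨ toℕ-mod 1 ⟩
      1 % m           ≡⟨ m<n⇒m%n≡m 1<m ⟩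
      1               ∎)
      where open ≡-Reasoning

    -- Bézout over ℕ comes in two sign patterns. From 1 + b x = a m the inverse is -b, from 1 + a m
    -- = b x it is b.
    coprime⇒unit : ∀ (x : ℤ/ m) → Coprime m (toℕ x) → IsUnit x
    coprime⇒unit x coprime with coprime-Bézout coprime
    ... | GCD.Bézout.+- a b 1+bx≡am = -ₘ (b mod m) , (begin
      x *ₘ (-ₘ (b mod m))       ≡⟨ -‿distribʳ-* x (b mod m) ⟨
      -ₘ (x *ₘ (b mod m))       ≡⟨ sym (+-inverseˡ-unique 1ₘ (x *ₘ (b mod m)) 1+xb≡0) ⟩
      1ₘ                        ∎)
      where
      open ≡-Reasoning
      open import Algebra.Properties.Ring (CommutativeRing.ring ℤ/-commutativeRing)
      1+xb≡0 : 1ₘ +ₘ x *ₘ (b mod m) ≡ 0ₘ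
      1+xb≡0 = begin
        1ₘ +ₘ x *ₘ (b mod m)           ≡⟨ cong (1ₘ +ₘ_) (*ₘ-comm x _) ⟩
        1ₘ +ₘ (b mod m) *ₘ x           ≡⟨ cong (1ₘ +ₘ_) (homoˡ {_*ₘ_} {ℕ._*_} mod-homo-* b x) ⟩
        1ₘ +ₘ (b ℕ.* toℕ x) mod m      ≡⟨ mod-homo-+ 1 _ ⟩
        (1 ℕ.+ b ℕ.* toℕ x) mod m      ≡⟨ cong (_mod m) 1+bx≡am ⟩
        (a ℕ.* m) mod m                ≡⟨ mod-≡ (trans (m*n%n≡0 a m) (sym (m*n%n≡0 0 m))) ⟩
        0ₘ                             ∎
    ... | GCD.Bézout.-+ a b 1+am≡bx = b mod m , (begin
      x *ₘ (b mod m)            ≡⟨ *ₘ-comm x _ ⟩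
      (b mod m) *ₘ x            ≡⟨ homoˡ {_*ₘ_} {ℕ._*_} mod-homo-* b x ⟩
      (b ℕ.* toℕ x) mod m       ≡⟨ cong (_mod m) (sym 1+am≡bx) ⟩
      (1 ℕ.+ a ℕ.* m) mod m     ≡⟨ mod-≡ ([m+kn]%n≡m%n 1 a m) ⟩
      1ₘ                        ∎)
      where open ≡-Reasoning

    ≢0⇒unit : Prime m → ∀ (x : ℤ/ m) → x ≢ 0ₘ → IsUnit x
    ≢0⇒unit pr x x≢0 = coprime⇒unit x (prime⇒coprime pr {{toℕx≢0}} (Finₚ.toℕ<n x))
      where
      toℕx≢0 : NonZero (toℕ x)
      toℕx≢0 = ℕ.≢-nonZero λ eq → x≢0 (trans (sym (mod-toℕ x)) (cong (_mod m) eq))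

  module _ {m : ℕ} .{{_ : NonZero m}} where

    -- Injectivity below `N` is the form in which counting uses the order: each power is hit by one
    -- exponent only. It is reached by different routes for α, β and a.
    record Order (g : ℤ/ m) (N : ℕ) .{{_ : NonZero N}} : Set where
      field
        power≡1   : g ^ₘ N ≡ 1ₘ
        injective : ∀ {j k} → j < N → k < N → g ^ₘ j ≡ g ^ₘ k → j ≡ k

    ^ₘ-periodic : ∀ (g : ℤ/ m) {N} → g ^ₘ N ≡ 1ₘ → ∀ j → g ^ₘ (j ℕ.+ N) ≡ g ^ₘ j
    ^ₘ-periodic g {N} eq j = begin
      g ^ₘ (j ℕ.+ N)       ≡⟨ ^ₘ-homo-+ g j N ⟩
      g ^ₘ j *ₘ g ^ₘ N     ≡⟨ cong (g ^ₘ j *ₘ_) eq ⟩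
      g ^ₘ j *ₘ 1ₘ         ≡⟨ trans (*ₘ-comm _ 1ₘ) (*ₘ-identityˡ _) ⟩
      g ^ₘ j               ∎
      where open ≡-Reasoning

    ^ₘ-periodic-* : ∀ (g : ℤ/ m) {N} → g ^ₘ N ≡ 1ₘ → ∀ j d → g ^ₘ (j ℕ.+ d ℕ.* N) ≡ g ^ₘ j
    ^ₘ-periodic-* g {N} eq j zero    = cong (g ^ₘ_) (ℕₚ.+-identityʳ j)
    ^ₘ-periodic-* g {N} eq j (suc d) = begin
      g ^ₘ (j ℕ.+ (N ℕ.+ d ℕ.* N))   ≡⟨ cong (g ^ₘ_) (ℕₚ.+-assoc j N (d ℕ.* N)) ⟨
      g ^ₘ (j ℕ.+ N ℕ.+ d ℕ.* N)     ≡⟨ ^ₘ-periodic-* g eq (j ℕ.+ N) d ⟩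
      g ^ₘ (j ℕ.+ N)                 ≡⟨ ^ₘ-periodic g eq j ⟩
      g ^ₘ j                         ∎
      where open ≡-Reasoning

    ^ₘ-% : ∀ (g : ℤ/ m) {N} .{{_ : NonZero N}} → g ^ₘ N ≡ 1ₘ → ∀ j → g ^ₘ (j % N) ≡ g ^ₘ j
    ^ₘ-% g {N} eq j = trans (sym (^ₘ-periodic-* g eq (j % N) (j / N)))
      (cong (g ^ₘ_) (sym (m≡m%n+[m/n]*n j N)))

    power-∸ : ∀ (g : ℤ/ m) → IsUnit g → ∀ {j k} → j < k → g ^ₘ j ≡ g ^ₘ k → g ^ₘ (k ∸ j) ≡ 1ₘ
    power-∸ g unit {j} {k} j<k eq = *ₘ-cancelˡ-unit (g ^ₘ j) (^ₘ-unit g unit j) _ _ (begin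
      g ^ₘ j *ₘ g ^ₘ (k ∸ j)   ≡⟨ ^ₘ-homo-+ g j (k ∸ j) ⟨
      g ^ₘ (j ℕ.+ (k ∸ j))     ≡⟨ cong (g ^ₘ_) (ℕₚ.m+[n∸m]≡n (ℕₚ.<⇒≤ j<k)) ⟩
      g ^ₘ k                   ≡⟨ eq ⟨
      g ^ₘ j                   ≡⟨ trans (*ₘ-comm _ 1ₘ) (*ₘ-identityˡ _) ⟨
      g ^ₘ j *ₘ 1ₘ             ∎)
      where open ≡-Reasoning

    -- Two equal powers make the power at the positive difference of their exponents trivial.
    ^ₘ-injective : ∀ (g : ℤ/ m) {N} → IsUnit g → (∀ d → 0 < d → d < N → g ^ₘ d ≢ 1ₘ) →
                   ∀ {j k} → j < N → k < N → g ^ₘ j ≡ g ^ₘ k → j ≡ k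
    ^ₘ-injective g {N} unit ≢1 {j} {k} j<N k<N eq with ℕₚ.<-cmp j k
    ... | tri≈ _ j≡k _ = j≡k
    ... | tri< j<k _ _ = contradiction (power-∸ g unit j<k eq) (≢1 (k ∸ j) (ℕₚ.m<n⇒0<n∸m j<k) (ℕₚ.≤-<-trans (ℕₚ.m∸n≤m k j) k<N))
    ... | tri> _ _ k<j = contradiction (power-∸ g unit k<j (sym eq)) (≢1 (j ∸ k) (ℕₚ.m<n⇒0<n∸m k<j) (ℕₚ.≤-<-trans (ℕₚ.m∸n≤m j k) j<N))

    HasOrder⇒Order : ∀ (g : ℤ/ m) {N} .{{_ : NonZero N}} → IsUnit g → HasOrder g N → Order g N
    HasOrder⇒Order g unit ord = record
      { power≡1   = HasOrder.power≡1 ord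
      ; injective = ^ₘ-injective g unit λ d 0<d d<N g^d≡1 →
          ℕₚ.<⇒≱ d<N (HasOrder.minimal ord d {{ℕ.>-nonZero 0<d}} g^d≡1) }

    -- A period d < m-1 would embed the m-1 nonzero residues, all of them
    -- powers of g, into the d exponents below d.
    generator-order : Prime m → ∀ (g : ℤ/ m) → GeneratesUnits g → ∀ {N} .{{_ : NonZero N}} →
                      suc N ≡ m → g ^ₘ N ≡ 1ₘ → Order g N
    generator-order pr g (unit , gen) {N} refl g^N≡1 = record
      { power≡1 = g^N≡1 ; injective = ^ₘ-injective g unit ≢1 }
      where
      log : ∀ (i : Fin N) → Fin.suc i ∈⟨ g ⟩
      log i = gen (Fin.suc i) (≢0⇒unit pr (Fin.suc i) λ eq → ℕₚ.1+n≢0 (trans (cong toℕ eq) (toℕ-mod {suc N} 0)))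
      ≢1 : ∀ d → 0 < d → d < N → g ^ₘ d ≢ 1ₘ
      ≢1 d 0<d d<N g^d≡1 = ℕₚ.<⇒≱ d<N (Finₚ.injective⇒≤ {f = λ i → proj₁ (log i) mod d} inj)
        where
        instance
          d≢0 : NonZero d
          d≢0 = ℕ.>-nonZero 0<d
        power : ∀ i → g ^ₘ toℕ (proj₁ (log i) mod d) ≡ Fin.suc i
        power i = trans (cong (g ^ₘ_) (toℕ-mod {d} (proj₁ (log i))))
          (trans (^ₘ-% g {d} g^d≡1 (proj₁ (log i))) (proj₂ (log i)))
        inj : ∀ {i j} → proj₁ (log i) mod d ≡ proj₁ (log j) mod d → i ≡ j
        inj {i} {j} eq = Finₚ.suc-injective
          (trans (sym (power i)) (trans (cong (λ e → g ^ₘ toℕ e) eq) (power j)))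

  -- Reduction modulo a divisor and the Chinese remainder theorem

  module _ {m k : ℕ} .{{_ : NonZero m}} .{{_ : NonZero k}} (k∣m : k ∣ m) where

    reduce-mod : ∀ x → reduce k (x mod m) ≡ x mod k
    reduce-mod x = mod-≡ (trans (cong (_% k) (toℕ-mod x)) (m∣n⇒o%n%m≡o%m k m x k∣m))

    reduce-homo-+ : ∀ (x y : ℤ/ m) → reduce k (x +ₘ y) ≡ reduce k x +ₘ reduce k y
    reduce-homo-+ x y = trans (reduce-mod _) (sym (mod-homo-+ (toℕ x) (toℕ y)))

    reduce-homo-* : ∀ (x y : ℤ/ m) → reduce k (x *ₘ y) ≡ reduce k x *ₘ reduce k y
    reduce-homo-* x y = trans (reduce-mod _) (sym (mod-homo-* (toℕ x) (toℕ y)))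

    reduce-homo-1 : reduce k (1ₘ {m}) ≡ 1ₘ
    reduce-homo-1 = reduce-mod 1

    reduce-homo-- : ∀ (x : ℤ/ m) → reduce k (-ₘ x) ≡ -ₘ reduce k x
    reduce-homo-- x = +-inverseʳ-unique (reduce k x) (reduce k (-ₘ x))
      (trans (sym (reduce-homo-+ x _)) (trans (cong (reduce k) (-ₘ-inverseʳ x)) (reduce-mod 0)))
      where open import Algebra.Properties.Ring (CommutativeRing.ring (ℤ/-commutativeRing {k}))

    reduce-homo-^ : ∀ (x : ℤ/ m) j → reduce k (x ^ₘ j) ≡ reduce k x ^ₘ j
    reduce-homo-^ x zero    = reduce-homo-1
    reduce-homo-^ x (suc j) = trans (reduce-homo-* x _) (cong (reduce k x *ₘ_) (reduce-homo-^ x j))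

    reduce-unit : ∀ (x : ℤ/ m) → IsUnit x → IsUnit (reduce k x)
    reduce-unit x (y , eq) = reduce k y , trans (sym (reduce-homo-* x y)) (trans (cong (reduce k) eq) reduce-homo-1)

  %≡%⇒∣∸ : ∀ {m x y} .{{_ : NonZero m}} → x ≤ y → x % m ≡ y % m → m ∣ y ∸ x
  %≡%⇒∣∸ {m} {x} {y} x≤y eq = divides (y / m ∸ x / m) (begin
    y ∸ x                                                   ≡⟨ cong₂ _∸_ (m≡m%n+[m/n]*n y m) (m≡m%n+[m/n]*n x m) ⟩
    (y % m ℕ.+ y / m ℕ.* m) ∸ (x % m ℕ.+ x / m ℕ.* m)       ≡⟨ cong (λ z → (y % m ℕ.+ y / m ℕ.* m) ∸ (z ℕ.+ x / m ℕ.* m)) eq ⟩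
    (y % m ℕ.+ y / m ℕ.* m) ∸ (y % m ℕ.+ x / m ℕ.* m)       ≡⟨ ℕₚ.[m+n]∸[m+o]≡n∸o (y % m) _ _ ⟩
    y / m ℕ.* m ∸ x / m ℕ.* m                               ≡⟨ ℕₚ.*-distribʳ-∸ m (y / m) (x / m) ⟨
    (y / m ∸ x / m) ℕ.* m                                   ∎)
    where open ≡-Reasoning

  module _ {p q : ℕ} .{{_ : NonZero p}} .{{_ : NonZero q}} .{{_ : NonZero (p ℕ.* q)}}
           (coprime : Coprime p q) where

    private
      -- By coprimality `p * q` divides the difference of the representatives, which is smaller than
      -- `p * q` and hence 0. The order of x and y is fixed because subtraction truncates.
      reduce-injective-≤ : ∀ {x y : ℤ/ (p ℕ.* q)} → toℕ x ≤ toℕ y →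
                           reduce p x ≡ reduce p y → reduce q x ≡ reduce q y → x ≡ y
      reduce-injective-≤ {x} {y} x≤y eqₚ eq_q = Finₚ.toℕ-injective (ℕₚ.≤-antisym x≤y (ℕₚ.m∸n≡0⇒m≤n y∸x≡0))
        where
        ∣p : p ∣ toℕ y ∸ toℕ x
        ∣p = %≡%⇒∣∸ x≤y (trans (sym (toℕ-mod (toℕ x))) (trans (cong toℕ eqₚ) (toℕ-mod (toℕ y))))
        ∣q : q ∣ toℕ y ∸ toℕ x
        ∣q = %≡%⇒∣∸ x≤y (trans (sym (toℕ-mod (toℕ x))) (trans (cong toℕ eq_q) (toℕ-mod (toℕ y))))
        ∣pq : p ℕ.* q ∣ toℕ y ∸ toℕ x
        ∣pq with divides c eq ← ∣q =
          subst (p ℕ.* q ∣_) (sym eq) (*-monoˡ-∣ q (coprime-divisor coprime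
            (subst (p ∣_) (trans eq (ℕₚ.*-comm c q)) ∣p)))
        y∸x≡0 : toℕ y ∸ toℕ x ≡ 0
        y∸x≡0 with toℕ y ∸ toℕ x in eq
        ... | zero  = refl
        ... | suc d = contradiction (∣⇒≤ (subst (p ℕ.* q ∣_) eq ∣pq))
          (ℕₚ.<⇒≱ (ℕₚ.≤-<-trans (ℕₚ.≤-trans (ℕₚ.≤-reflexive (sym eq)) (ℕₚ.m∸n≤m (toℕ y) (toℕ x))) (Finₚ.toℕ<n y)))

    reduce-injective : ∀ {x y : ℤ/ (p ℕ.* q)} → reduce p x ≡ reduce p y → reduce q x ≡ reduce q y → x ≡ y
    reduce-injective {x} {y} eqₚ eq_q with ℕₚ.≤-total (toℕ x) (toℕ y)
    ... | inj₁ x≤y = reduce-injective-≤ x≤y eqₚ eq_q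
    ... | inj₂ y≤x = sym (reduce-injective-≤ y≤x (sym eqₚ) (sym eq_q))

open Residues

-- Order and limits in the reals

module OrderedField {c ℓ₁ ℓ₂} (R : Reals c ℓ₁ ℓ₂) where
  open import Data.Sum.Base using ([_,_])
  open Reals R hiding (∣_-_∣<_)
  open CommutativeRing commutativeRing
    using (sym; trans; refl; reflexive; +-cong; +-congʳ; +-identityˡ; +-identityʳ; +-comm;
           *-congˡ; *-congʳ; *-identityˡ; *-identityʳ; *-comm; *-assoc; zeroˡ; zeroʳ; distribˡ; distribʳ; -‿cong; -‿inverseʳ; semiring)
  open IsStrictPartialOrder isStrictPartialOrder public
    using (irrefl; <-respˡ-≈; <-respʳ-≈) renaming (trans to <-trans)
  open IntegerSolver commutativeRing using (solve; _:=_; _:+_; _:*_; _:-_; :-_; con)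
  open Algebra.Properties.Semiring.Mult semiring using (×-homo-+)

  infix 4 _≤_
  -- Being a negation, this relation is stable, so it can be proved by cases although `<` is
  -- undecidable.
  _≤_ : Carrier → Carrier → Set ℓ₂
  x ≤ y = ¬ (y < x)

  <-resp-≈ : ∀ {x x′ y y′} → x ≈ x′ → y ≈ y′ → x < y → x′ < y′
  <-resp-≈ x≈ y≈ = <-respˡ-≈ x≈ ∘ <-respʳ-≈ y≈

  ≤-resp-≈ : ∀ {x x′ y y′} → x ≈ x′ → y ≈ y′ → x ≤ y → x′ ≤ y′
  ≤-resp-≈ x≈ y≈ x≤y = x≤y ∘ <-resp-≈ (sym y≈) (sym x≈)

  ≤-reflexive : ∀ {x y} → x ≈ y → x ≤ y
  ≤-reflexive x≈y = irrefl (sym x≈y)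

  ≤-trans : ∀ {x y z} → x ≤ y → y ≤ z → x ≤ z
  ≤-trans {y = y} x≤y y≤z z<x = [ y≤z , x≤y ] (<-cotrans z<x y)

  <⇒≤ : ∀ {x y} → x < y → x ≤ y
  <⇒≤ x<y y<x = irrefl refl (<-trans x<y y<x)

  <-≤-trans : ∀ {x y z} → x < y → y ≤ z → x < z
  <-≤-trans {z = z} x<y y≤z = [ (λ x<z → x<z) , (λ z<y → contradiction z<y y≤z) ] (<-cotrans x<y z)

  ≤-<-trans : ∀ {x y z} → x ≤ y → y < z → x < z
  ≤-<-trans {x} x≤y y<z = [ (λ y<x → contradiction y<x x≤y) , (λ x<z → x<z) ] (<-cotrans y<z x)

  -- Tightness derives equality from two negations, and these follow from the double negation.
  ≈-stable : ∀ {x y} → ¬ ¬ (x ≈ y) → x ≈ y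
  ≈-stable ¬¬x≈y = <-tight (λ x<y → ¬¬x≈y λ x≈y → irrefl x≈y x<y) (λ y<x → ¬¬x≈y λ x≈y → irrefl (sym x≈y) y<x)

  -- The replacement for trichotomy: it can be eliminated into any goal that is a negation, hence
  -- into `≤` and, by stability, into equality.
  ¬¬-compare : ∀ x y → ¬ ¬ (x < y ⊎ x ≈ y ⊎ y < x)
  ¬¬-compare x y k = k (inj₂ (inj₁ (<-tight (k ∘ inj₁) (k ∘ inj₂ ∘ inj₂))))

  -0≈0 : - 0# ≈ 0#
  -0≈0 = solve 0 (:- con (+ 0) := con (+ 0)) refl

  x<y⇒0<y-x : ∀ {x y} → x < y → 0# < y - x
  x<y⇒0<y-x {x} x<y = <-respˡ-≈ (-‿inverseʳ x) (+-monoˡ-< (- x) x<y)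

  0<y-x⇒x<y : ∀ {x y} → 0# < y - x → x < y
  0<y-x⇒x<y {x} {y} 0<d = <-resp-≈ (+-identityˡ x)
    (solve 2 (λ x y → (y :- x) :+ x := y) refl x y) (+-monoˡ-< x 0<d)

  +-pos : ∀ {x y} → 0# < x → 0# < y → 0# < x + y
  +-pos {x} {y} 0<x 0<y = <-trans 0<y (<-respˡ-≈ (+-identityˡ y) (+-monoˡ-< y 0<x))

  +-mono-< : ∀ {x y u v} → x < y → u < v → x + u < y + v
  +-mono-< {x} {y} {u} {v} x<y u<v = <-trans (+-monoˡ-< u x<y)
    (<-resp-≈ (+-comm u y) (+-comm v y) (+-monoˡ-< y u<v))

  neg-< : ∀ {x y} → x < y → - y < - x
  neg-< {x} {y} x<y = <-resp-≈ (solve 2 (λ x y → x :+ (:- x :- y) := :- y) refl x y)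
    (solve 2 (λ x y → y :+ (:- x :- y) := :- x) refl x y) (+-monoˡ-< (- x - y) x<y)

  0≤y-x⇒x≤y : ∀ {x y} → 0# ≤ y - x → x ≤ y
  0≤y-x⇒x≤y {x} {y} 0≤d y<x = 0≤d (<-resp-≈
    (solve 2 (λ x y → y :+ (:- x) := y :- x) refl x y) (-‿inverseʳ x) (+-monoˡ-< (- x) y<x))

  x≤y⇒0≤y-x : ∀ {x y} → x ≤ y → 0# ≤ y - x
  x≤y⇒0≤y-x {x} {y} x≤y d<0 = x≤y (<-resp-≈ (solve 2 (λ x y → (y :- x) :+ x := y) refl x y)
    (+-identityˡ x) (+-monoˡ-< x d<0))

  +-nonneg : ∀ {x y} → 0# ≤ x → 0# ≤ y → 0# ≤ x + y
  +-nonneg {x} {y} 0≤x 0≤y s<0 = [ contra , (λ y<0 → 0≤y y<0) ] (<-cotrans s<0 y)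
    where
    contra : ¬ (x + y < y)
    contra x+y<y = 0≤x (<-resp-≈ (solve 2 (λ x y → (x :+ y) :- y := x) refl x y) (-‿inverseʳ y) (+-monoˡ-< (- y) x+y<y))

  +-mono-≤ : ∀ {x y u v} → x ≤ y → u ≤ v → x + u ≤ y + v
  +-mono-≤ {x} {y} {u} {v} x≤y u≤v = 0≤y-x⇒x≤y (≤-resp-≈ refl
    (solve 4 (λ x y u v → (y :- x) :+ (v :- u) := (y :+ v) :- (x :+ u)) refl x y u v)
    (+-nonneg (x≤y⇒0≤y-x x≤y) (x≤y⇒0≤y-x u≤v)))

  neg-≤ : ∀ {x y} → x ≤ y → - y ≤ - x
  neg-≤ {x} {y} x≤y = 0≤y-x⇒x≤y (≤-resp-≈ refl
    (solve 2 (λ x y → y :- x := (:- x) :- (:- y)) refl x y) (x≤y⇒0≤y-x x≤y))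

  *-nonneg : ∀ {x y} → 0# ≤ x → 0# ≤ y → 0# ≤ x * y
  *-nonneg {x} {y} 0≤x 0≤y xy<0 = ¬¬-compare 0# x λ where
    (inj₂ (inj₂ x<0)) → 0≤x x<0
    (inj₂ (inj₁ 0≈x)) → irrefl (trans (*-congʳ (sym 0≈x)) (zeroˡ y)) xy<0
    (inj₁ 0<x)        → ¬¬-compare 0# y λ where
      (inj₂ (inj₂ y<0)) → 0≤y y<0
      (inj₂ (inj₁ 0≈y)) → irrefl (trans (*-congˡ (sym 0≈y)) (zeroʳ x)) xy<0
      (inj₁ 0<y)        → <⇒≤ (*-pos 0<x 0<y) xy<0

  *-monoʳ-≤ : ∀ {x y z} → 0# ≤ z → x ≤ y → z * x ≤ z * y
  *-monoʳ-≤ {x} {y} {z} 0≤z x≤y = 0≤y-x⇒x≤y (≤-resp-≈ refl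
    (solve 3 (λ x y z → z :* (y :- x) := z :* y :- z :* x) refl x y z) (*-nonneg 0≤z (x≤y⇒0≤y-x x≤y)))

  square-nonneg : ∀ x → 0# ≤ x * x
  square-nonneg x xx<0 = ¬¬-compare 0# x λ where
    (inj₁ 0<x)        → <⇒≤ (*-pos 0<x 0<x) xx<0
    (inj₂ (inj₁ 0≈x)) → irrefl (trans (*-congʳ (sym 0≈x)) (zeroˡ x)) xx<0
    (inj₂ (inj₂ x<0)) → let 0<-x = <-resp-≈ -0≈0 refl (neg-< x<0) in
      <⇒≤ (<-resp-≈ refl (solve 1 (λ x → :- x :* :- x := x :* x) refl x) (*-pos 0<-x 0<-x)) xx<0

  pos⇒*-cancelˡ : ∀ {x y} → 0# < x → x * y ≈ 0# → y ≈ 0#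
  pos⇒*-cancelˡ {x} {y} 0<x xy≈0 with z , xz≈1 ← pos⇒invertible 0<x =
    trans (sym (*-identityˡ y)) (trans (*-congʳ (sym xz≈1))
    (trans (solve 3 (λ x y z → (x :* z) :* y := z :* (x :* y)) refl x y z) (trans (*-congˡ xy≈0) (zeroʳ z))))

  -- From `x ≉ 0` alone no inverse of x can be extracted. The goal is stable, however, so the sign
  -- of x may be split under a double negation.
  ≉0⇒*-cancelˡ : ∀ {x y} → ¬ (x ≈ 0#) → x * y ≈ 0# → y ≈ 0#
  ≉0⇒*-cancelˡ {x} {y} x≉0 xy≈0 = ≈-stable λ y≉0 → ¬¬-compare 0# x λ where
    (inj₁ 0<x)        → y≉0 (pos⇒*-cancelˡ 0<x xy≈0)
    (inj₂ (inj₁ 0≈x)) → x≉0 (sym 0≈x)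
    (inj₂ (inj₂ x<0)) → y≉0 (pos⇒*-cancelˡ (<-respˡ-≈ -0≈0 (neg-< x<0))
      (trans (solve 2 (λ x y → :- x :* y := :- (x :* y)) refl x y) (trans (-‿cong xy≈0) -0≈0)))

  sum-squares≈0 : ∀ {x y} → x * x + y * y ≈ 0# → x ≈ 0#
  sum-squares≈0 {x} {y} eq = ≈-stable λ x≉0 → x≉0 (≉0⇒*-cancelˡ x≉0 (<-tight (square-nonneg x) λ 0<xx →
    square-nonneg y (<-resp-≈ (+-identityˡ _) eq (+-monoˡ-< (y * y) 0<xx))))

  fromℕ-mono-< : ∀ {m n} → m ℕ.< n → fromℕ m < fromℕ n
  fromℕ-mono-< {m} {n} m<n = <-resp-≈ (+-identityˡ _)
    (trans (+-comm _ _) (trans (sym (×-homo-+ 1# m (n ∸ m))) (reflexive (≡.cong fromℕ (ℕₚ.m+[n∸m]≡n (ℕₚ.<⇒≤ m<n))))))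
    (+-monoˡ-< (fromℕ m) (0<fromℕ (n ∸ m) {{ℕ.>-nonZero (ℕₚ.m<n⇒0<n∸m m<n)}}))

  private
    -- Cotransitivity at `y` leaves either the claim or a positive multiple with one summand fewer.
    pos-multiple : ∀ n {y} → 0# < fromℕ n * y → 0# < y
    pos-multiple zero    0<0 = contradiction 0<0 (irrefl (sym (zeroˡ _)))
    pos-multiple (suc n) {y} 0<y+ny with <-cotrans 0<y+ny y
    ... | inj₁ 0<y    = 0<y
    ... | inj₂ y<y+ny = pos-multiple n (<-resp-≈ (-‿inverseʳ y)
      (trans (+-congʳ (trans (distribʳ y 1# (fromℕ n)) (+-congʳ (*-identityˡ y))))
             (solve 2 (λ y z → (y :+ z) :- y := z) refl y (fromℕ n * y)))
      (+-monoˡ-< (- y) y<y+ny))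

  -- The Archimedean axiom stands in for Markov's principle here: y is not
  -- negative, so an integer n > b gives 1 ≤ n y, and then 0 < y by cotransitivity.
  inverse-pos : ∀ {b y} → 0# < b → b * y ≈ 1# → 0# < y
  inverse-pos {b} {y} 0<b by≈1 with n , b<n ← archimedean b = pos-multiple n (<-≤-trans 0<1 (≤-resp-≈ by≈1 refl by≤ny))
    where
    0≤y : 0# ≤ y
    0≤y y<0 = <⇒≤ 0<1 (<-resp-≈ (trans (solve 2 (λ b y → :- (b :* (:- y)) := b :* y) refl b y) by≈1)
      -0≈0
      (neg-< (*-pos 0<b (<-respˡ-≈ -0≈0 (neg-< y<0)))))
    by≤ny : b * y ≤ fromℕ n * y
    by≤ny = ≤-resp-≈ (*-comm y b) (*-comm y _) (*-monoʳ-≤ 0≤y (<⇒≤ b<n))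

  *1/ : ∀ n .{{_ : NonZero n}} → fromℕ n * 1/ n ≈ 1#
  *1/ n = proj₂ (pos⇒invertible (0<fromℕ n))

  0<1/ : ∀ n .{{_ : NonZero n}} → 0# < 1/ n
  0<1/ n = inverse-pos (0<fromℕ n) (*1/ n)

  half : ∀ {ε} → 0# < ε → ∃ λ δ → (0# < δ) × (δ + δ ≈ ε)
  half {ε} 0<ε with h , 2h≈1 ← pos⇒invertible (0<fromℕ 2) = ε * h , *-pos 0<ε (inverse-pos (0<fromℕ 2) 2h≈1) ,
    trans (sym (distribˡ ε h h)) (trans (*-congˡ h+h≈1) (*-identityʳ ε))
    where
    h+h≈1 : h + h ≈ 1#
    h+h≈1 = trans (sym (trans (distribʳ h 1# (1# + 0#))
      (+-cong (*-identityˡ h) (trans (*-congʳ (+-identityʳ 1#)) (*-identityˡ h))))) 2h≈1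

  infix 4 _≺_
  -- This is |x| < ε, written without an absolute value.
  _≺_ : Carrier → Carrier → Set ℓ₂
  x ≺ ε = (x < ε) × (- x < ε)

  ≺-cong : ∀ {x y ε} → x ≈ y → x ≺ ε → y ≺ ε
  ≺-cong x≈y (x<ε , -x<ε) = <-respˡ-≈ x≈y x<ε , <-respˡ-≈ (-‿cong x≈y) -x<ε

  ≺-respʳ : ∀ {x ε δ} → ε ≈ δ → x ≺ ε → x ≺ δ
  ≺-respʳ ε≈δ (x<ε , -x<ε) = <-respʳ-≈ ε≈δ x<ε , <-respʳ-≈ ε≈δ -x<ε

  ≺-neg : ∀ {x ε} → x ≺ ε → (- x) ≺ ε
  ≺-neg {x} (x<ε , -x<ε) = -x<ε , <-respˡ-≈ (solve 1 (λ x → x := :- (:- x)) refl x) x<ε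

  ≺-+ : ∀ {x y ε δ} → x ≺ ε → y ≺ δ → (x + y) ≺ ε + δ
  ≺-+ {x} {y} (x<ε , -x<ε) (y<δ , -y<δ) = +-mono-< x<ε y<δ ,
    <-respˡ-≈ (solve 2 (λ x y → (:- x) :+ (:- y) := :- (x :+ y)) refl x y) (+-mono-< -x<ε -y<δ)

  -- The identity (ε - x)(δ + y) + (ε + x)(δ - y) = 2 (ε δ - x y) has four positive factors on its
  -- left side. Applied to -x it gives the other bound.
  ≺-* : ∀ {x y ε δ} → x ≺ ε → y ≺ δ → (x * y) ≺ ε * δ
  ≺-* {x} {y} {ε} {δ} x≺ε y≺δ = upper x≺ε y≺δ ,
    <-respˡ-≈ (solve 2 (λ x y → (:- x) :* y := :- (x :* y)) refl x y) (upper (≺-neg x≺ε) y≺δ)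
    where
    pos-half : ∀ {z} → 0# < z + z → 0# < z
    pos-half {z} 0<z+z with <-cotrans 0<z+z z
    ... | inj₁ 0<z   = 0<z
    ... | inj₂ z<z+z = <-resp-≈ (-‿inverseʳ z) (solve 1 (λ z → (z :+ z) :- z := z) refl z) (+-monoˡ-< (- z) z<z+z)
    upper : ∀ {x} → x ≺ ε → y ≺ δ → x * y < ε * δ
    upper {x} (x<ε , -x<ε) (y<δ , -y<δ) = 0<y-x⇒x<y (pos-half (<-respʳ-≈
      (solve 4 (λ e d x y → (e :- x) :* (d :+ y) :+ (e :+ x) :* (d :- y) := (e :* d :- x :* y) :+ (e :* d :- x :* y)) refl ε δ x y)
      (+-pos (*-pos (x<y⇒0<y-x x<ε) 0<δ+y) (*-pos 0<ε+x (x<y⇒0<y-x y<δ)))))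
      where
      0<δ+y : 0# < δ + y
      0<δ+y = <-respʳ-≈ (solve 2 (λ d y → d :- (:- y) := d :+ y) refl δ y) (x<y⇒0<y-x -y<δ)
      0<ε+x : 0# < ε + x
      0<ε+x = <-respʳ-≈ (solve 2 (λ d y → d :- (:- y) := d :+ y) refl ε x) (x<y⇒0<y-x -x<ε)

  Eventually : ∀ {p} → (ℕ → Set p) → Set p
  Eventually P = ∃ λ N → ∀ k → N ℕ.≤ k → P k

  eventually-map : ∀ {p q} {P : ℕ → Set p} {Q : ℕ → Set q} → (∀ k → P k → Q k) → Eventually P → Eventually Q
  eventually-map f (N , p) = N , λ k N≤k → f k (p k N≤k)

  eventually-zip : ∀ {p q s} {P : ℕ → Set p} {Q : ℕ → Set q} {T : ℕ → Set s} → (∀ k → P k → Q k → T k) →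
                   Eventually P → Eventually Q → Eventually T
  eventually-zip f (M , p) (N , q) = M ℕ.⊔ N , λ k M⊔N≤k →
    f k (p k (ℕₚ.≤-trans (ℕₚ.m≤m⊔n M N) M⊔N≤k)) (q k (ℕₚ.≤-trans (ℕₚ.m≤n⊔m M N) M⊔N≤k))

  -- Convergence is handled through the differences to the limit, since sequences tending to 0 are
  -- closed under sums, products and scaling.
  Null : (ℕ → Carrier) → Set (c ⊔ ℓ₂)
  Null f = ∀ ε → 0# < ε → Eventually λ k → f k ≺ ε

  ⟶⇒Null : ∀ {f L} → f ⟶ L → Null (λ k → f k - L)
  ⟶⇒Null {f} {L} f⟶L ε 0<ε = eventually-map (λ k (fk<L+ε , L<fk+ε) →
    <-respʳ-≈ (solve 2 (λ l e → (l :+ e) :- l := e) refl L ε) (+-monoˡ-< (- L) fk<L+ε) ,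
    <-resp-≈ (solve 2 (λ l f → l :+ (:- f) := :- (f :- l)) refl L (f k))
             (solve 2 (λ f e → (f :+ e) :- f := e) refl (f k) ε) (+-monoˡ-< (- f k) L<fk+ε)) (f⟶L ε 0<ε)

  Null-cong : ∀ {f g} → (∀ k → f k ≈ g k) → Null f → Null g
  Null-cong f≈g nf ε 0<ε = eventually-map (λ k → ≺-cong (f≈g k)) (nf ε 0<ε)

  Null-+ : ∀ {f g} → Null f → Null g → Null (λ k → f k + g k)
  Null-+ nf ng ε 0<ε = let δ , 0<δ , δ+δ≈ε = half 0<ε in
    eventually-zip (λ k u v → ≺-respʳ δ+δ≈ε (≺-+ u v)) (nf δ 0<δ) (ng δ 0<δ)

  Null-neg : ∀ {f} → Null f → Null (λ k → - f k)
  Null-neg nf ε 0<ε = eventually-map (λ k → ≺-neg) (nf ε 0<ε)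

  Null-* : ∀ {f g} → Null f → Null g → Null (λ k → f k * g k)
  Null-* nf ng ε 0<ε = eventually-zip (λ k u v → ≺-respʳ (*-identityʳ ε) (≺-* u v)) (nf ε 0<ε) (ng 1# 0<1)

  bounded : ∀ x → ∃ λ b → (0# < b) × (x ≺ b)
  bounded x = let m , x<m = archimedean x ; n , -x<n = archimedean (- x) in
    fromℕ (suc (m ℕ.+ n)) , 0<fromℕ (suc (m ℕ.+ n)) ,
    (<-trans x<m (fromℕ-mono-< (ℕ.s≤s (ℕₚ.m≤m+n m n))) , <-trans -x<n (fromℕ-mono-< (ℕ.s≤s (ℕₚ.m≤n+m n m))))

  Null-scale : ∀ x {f} → Null f → Null (λ k → x * f k)
  Null-scale x nf ε 0<ε =
    let b , 0<b , x≺b = bounded x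
        b⁻¹ , bb⁻¹≈1  = pos⇒invertible 0<b
    in eventually-map (λ k fk≺ → ≺-respʳ (trans (sym (*-assoc b b⁻¹ ε)) (trans (*-congʳ bb⁻¹≈1) (*-identityˡ ε))) (≺-* x≺b fk≺))
         (nf (b⁻¹ * ε) (*-pos (inverse-pos 0<b bb⁻¹≈1) 0<ε))

  Null-squeeze : ∀ {f g} → (∀ k → f k ≤ g k) → (∀ k → - f k ≤ g k) → Null g → Null f
  Null-squeeze f≤g -f≤g ng ε 0<ε =
    eventually-map (λ k (gk<ε , _) → ≤-<-trans (f≤g k) gk<ε , ≤-<-trans (-f≤g k) gk<ε) (ng ε 0<ε)

  Null-∘ : ∀ {f} (φ : ℕ → ℕ) → (∀ k → k ℕ.≤ φ k) → Null f → Null (λ k → f (φ k))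
  Null-∘ φ k≤φk nf ε 0<ε = let N , small = nf ε 0<ε in
    N , λ k N≤k → small (φ k) (ℕₚ.≤-trans N≤k (k≤φk k))

  -- If x were positive or negative, x or -x itself could be taken as ε. This yields the uniqueness
  -- of limits.
  Null-const : ∀ {x} → Null (λ _ → x) → x ≈ 0#
  Null-const {x} n = <-tight
    (λ x<0 → let N , small = n (- x) (<-respˡ-≈ -0≈0 (neg-< x<0)) in irrefl refl (proj₂ (small N ℕₚ.≤-refl)))
    (λ 0<x → let N , small = n x 0<x in irrefl refl (proj₁ (small N ℕₚ.≤-refl)))

-- The exponential function

C*k!*[n∸k]!≡n! : ∀ {n k} → k ℕ.≤ n → (n C k) ℕ.* (k ! ℕ.* (n ∸ k) !) ≡ n !
C*k!*[n∸k]!≡n! {n} {k} k≤n = ≡.trans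
  (≡.cong (ℕ._* (k ! ℕ.* (n ∸ k) !)) (nCk≡n!/k![n-k]! k≤n))
  (m/n*n≡m {{k ℕₚ.!* (n ∸ k) !≢0}} (k![n∸k]!∣n! k≤n))

module Convolution {c ℓ} (A : CommutativeRing c ℓ) where
  open CommutativeRing A
  open Sums A
  open Algebra.Properties.Semiring.Mult semiring using (×-assoc-*; ×1-homo-*; ×-congʳ) renaming (_×_ to _·_)
  open Algebra.Properties.Semiring.Exp semiring using (_^_; ^-congˡ)
  open IntegerSolver A using (solve; _:=_; _:*_)
  open Relation.Binary.Reasoning.Setoid setoid

  -- Index sets for the product of two partial sums: i , j < N; the part i + j < N; and the rest i ,
  -- j < N ≤ i + j. In `Corner` the inner index counts from `N ∸ i`.
  Square Triangle Corner : ℕ → (ℕ → ℕ → Carrier) → Carrier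
  Square   N g = Σ N λ i → Σ N λ j → g i j
  Triangle N g = Σ N λ i → Σ (N ∸ i) λ j → g i j
  Corner   N g = Σ N λ i → Σ i λ j → g i (N ∸ i ℕ.+ j)

  Square≈Triangle+Corner : ∀ N g → Square N g ≈ Triangle N g + Corner N g
  Square≈Triangle+Corner N g = begin
    Square N g                ≈⟨ Σ-cong N (λ i i<N → reflexive (≡.cong (λ M → Σ M (g i)) (≡.sym (ℕₚ.m∸n+n≡m (ℕₚ.<⇒≤ i<N))))) ⟩
    Σ N (λ i → Σ (N ∸ i ℕ.+ i) (g i))
                              ≈⟨ Σ-cong N (λ i _ → Σ-split (N ∸ i) i (g i)) ⟩
    Σ N (λ i → Σ (N ∸ i) (g i) + Σ i (λ j → g i (N ∸ i ℕ.+ j)))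
                              ≈⟨ Σ-distrib-+ N _ _ ⟩
    Triangle N g + Corner N g ∎

  Triangle-diagonals : ∀ N g → Triangle N g ≈ Σ N λ m → Σ (suc m) λ i → g i (m ∸ i)
  Triangle-diagonals zero    g = refl
  Triangle-diagonals (suc N) g = begin
    Σ (suc N) (g 0) + Triangle N (g ∘ suc)      ≈⟨ +-congˡ (Triangle-diagonals N (g ∘ suc)) ⟩
    -- `H 0` is an empty sum, so it can be prepended to bring both sums to the length `suc N`.
    Σ (suc N) (g 0) + Σ N (H ∘ suc)             ≈⟨ +-congˡ (+-identityˡ _) ⟨
    Σ (suc N) (g 0) + Σ (suc N) H               ≈⟨ Σ-distrib-+ (suc N) (g 0) H ⟨
    Σ (suc N) (λ m → g 0 m + H m)               ∎
    where
    H : ℕ → Carrier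
    H m = Σ m λ i → g (suc i) (m ∸ suc i)

  -- The weights `w` are the inverse factorials. They are kept abstract because the same Cauchy
  -- product is needed over ℂ and, for its bound, over ℝ.
  module Exponential (w : ℕ → Carrier) (w*!≈1 : ∀ k → w k * ((k !) · 1#) ≈ 1#) where

    term : Carrier → ℕ → Carrier
    term z k = w k * z ^ k

    term-cong : ∀ {x y} → x ≈ y → ∀ k → term x k ≈ term y k
    term-cong x≈y k = *-congˡ (^-congˡ k x≈y)

    private
      w-binomial : ∀ {m k} → k ℕ.≤ m → w k * w (m ∸ k) ≈ w m * ((m C k) · 1#)
      w-binomial {m} {k} k≤m = begin
        w k * w l                                          ≈⟨ trans (*-congʳ (w*!≈1 m)) (*-identityˡ _) ⟨
        (w m * ((m !) · 1#)) * (w k * w l)                   ≈⟨ *-congʳ (*-congˡ factor) ⟩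
        (w m * (C′ * ((k !) · 1# * (l !) · 1#))) * (w k * w l) ≈⟨ solve 6 (λ a b c d e f → (a :* (b :* (c :* d))) :* (e :* f) := (a :* b) :* ((e :* c) :* (f :* d))) refl (w m) C′ ((k !) · 1#) ((l !) · 1#) (w k) (w l) ⟩
        (w m * C′) * ((w k * ((k !) · 1#)) * (w l * ((l !) · 1#)))
                                                           ≈⟨ *-congˡ (trans (*-cong (w*!≈1 k) (w*!≈1 l)) (*-identityˡ 1#)) ⟩
        (w m * C′) * 1#                                    ≈⟨ *-identityʳ _ ⟩
        w m * C′                                           ∎
        where
        l : ℕ
        l = m ∸ k
        C′ : Carrier
        C′ = (m C k) · 1#
        factor : (m !) · 1# ≈ C′ * ((k !) · 1# * (l !) · 1#)
        factor = trans (reflexive (≡.cong (_· 1#) (≡.sym (C*k!*[n∸k]!≡n! k≤m))))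
          (trans (×1-homo-* (m C k) (k ! ℕ.* l !)) (*-congˡ (×1-homo-* (k !) (l !))))

    -- The binomial theorem divided by `m !`: the product `w i * w (m ∸ i)` is `w m` times a
    -- binomial coefficient.
    convolution : ∀ x y m → Σ (suc m) (λ i → term x i * term y (m ∸ i)) ≈ term (x + y) m
    convolution x y m = begin
      Σ (suc m) (λ i → term x i * term y (m ∸ i))                 ≈⟨ Σ-cong (suc m) pointwise ⟩
      Σ (suc m) (λ i → w m * ((m C i) · (x ^ i * y ^ (m ∸ i))))   ≈⟨ *-distribˡ-Σ (suc m) (w m) binomialTerm ⟨
      w m * Σ (suc m) binomialTerm                                ≈⟨ *-congˡ (sum-Σ (suc m) binomialTerm) ⟨
      w m * sum {suc m} (λ i → binomialTerm (toℕ i))              ≈⟨ *-congˡ (Binomial.theorem m x y) ⟨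
      term (x + y) m                                              ∎
      where
      module Binomial = Algebra.Properties.CommutativeSemiring.Binomial commutativeSemiring
      binomialTerm : ℕ → Carrier
      binomialTerm i = (m C i) · (x ^ i * y ^ (m ∸ i))
      pointwise : ∀ i → i ℕ.< suc m → term x i * term y (m ∸ i) ≈ w m * ((m C i) · (x ^ i * y ^ (m ∸ i)))
      pointwise i (s≤s i≤m) = begin
        (w i * x ^ i) * (w (m ∸ i) * y ^ (m ∸ i))   ≈⟨ solve 4 (λ a b c d → (a :* b) :* (c :* d) := (a :* c) :* (b :* d)) refl (w i) (x ^ i) (w (m ∸ i)) (y ^ (m ∸ i)) ⟩
        (w i * w (m ∸ i)) * (x ^ i * y ^ (m ∸ i))   ≈⟨ *-congʳ (w-binomial i≤m) ⟩
        (w m * ((m C i) · 1#)) * (x ^ i * y ^ (m ∸ i))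
                                                    ≈⟨ *-assoc _ _ _ ⟩
        w m * (((m C i) · 1#) * (x ^ i * y ^ (m ∸ i)))
                                                    ≈⟨ *-congˡ (trans (×-assoc-* (m C i) 1# _) (×-congʳ (m C i) (*-identityˡ _))) ⟩
        w m * ((m C i) · (x ^ i * y ^ (m ∸ i)))     ∎

    product : Carrier → Carrier → ℕ → ℕ → Carrier
    product x y i j = term x i * term y j

    Triangle-product : ∀ x y N → Triangle N (product x y) ≈ Σ N (term (x + y))
    Triangle-product x y N = trans (Triangle-diagonals N (product x y)) (Σ-cong N λ m _ → convolution x y m)

    Square-product : ∀ x y N → Square N (product x y) ≈ Σ N (term x) * Σ N (term y)
    Square-product x y N = sym (Σ-*-Σ N N (term x) (term y))

-- The ring of complex numbers

module ComplexRing {c ℓ₁ ℓ₂} (R : Reals c ℓ₁ ℓ₂) where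
  open Complex R
  private
    module ℝ = CommutativeRing (Reals.commutativeRing R)
  open IntegerSolver (Reals.commutativeRing R) using (solve; _:=_; _:+_; _:*_; _:-_; :-_; con)

  ℂ-commutativeRing : CommutativeRing c ℓ₁
  ℂ-commutativeRing = record
    { Carrier = ℂ ; _≈_ = _≈_ ; _+_ = _+_ ; _*_ = _*_ ; -_ = -_ ; 0# = 0ᶜ ; 1# = 1ᶜ
    ; isCommutativeRing = record
      { isRing = record
        { +-isAbelianGroup = record
          { isGroup = record
            { isMonoid = record
              { isSemigroup = record
                { isMagma = record
                  { isEquivalence = record
                    { refl  = mk≈ ℝ.refl ℝ.refl
                    ; sym   = λ (mk≈ a b) → mk≈ (ℝ.sym a) (ℝ.sym b)
                    ; trans = λ (mk≈ a b) (mk≈ a′ b′) → mk≈ (ℝ.trans a a′) (ℝ.trans b b′) }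
                  ; ∙-cong = λ (mk≈ a b) (mk≈ a′ b′) → mk≈ (ℝ.+-cong a a′) (ℝ.+-cong b b′) }
                ; assoc = λ x y z → mk≈ (ℝ.+-assoc _ _ _) (ℝ.+-assoc _ _ _) }
              ; identity = (λ x → mk≈ (ℝ.+-identityˡ _) (ℝ.+-identityˡ _)) , (λ x → mk≈ (ℝ.+-identityʳ _) (ℝ.+-identityʳ _)) }
            ; inverse = (λ x → mk≈ (ℝ.-‿inverseˡ _) (ℝ.-‿inverseˡ _)) , (λ x → mk≈ (ℝ.-‿inverseʳ _) (ℝ.-‿inverseʳ _))
            ; ⁻¹-cong = λ (mk≈ a b) → mk≈ (ℝ.-‿cong a) (ℝ.-‿cong b) }
          ; comm = λ x y → mk≈ (ℝ.+-comm _ _) (ℝ.+-comm _ _) }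
        ; *-cong = λ (mk≈ a b) (mk≈ a′ b′) →
            mk≈ (ℝ.+-cong (ℝ.*-cong a a′) (ℝ.-‿cong (ℝ.*-cong b b′))) (ℝ.+-cong (ℝ.*-cong a b′) (ℝ.*-cong b a′))
        ; *-assoc = λ (x +i y) (u +i v) (s +i t) → mk≈
            (solve 6 (λ x y u v s t → (x :* u :- y :* v) :* s :- (x :* v :+ y :* u) :* t
                                   := x :* (u :* s :- v :* t) :- y :* (u :* t :+ v :* s)) ℝ.refl x y u v s t)
            (solve 6 (λ x y u v s t → (x :* u :- y :* v) :* t :+ (x :* v :+ y :* u) :* s
                                   := x :* (u :* t :+ v :* s) :+ y :* (u :* s :- v :* t)) ℝ.refl x y u v s t)
        ; *-identity = *-identityˡ , λ z → ≈-trans (*-comm z 1ᶜ) (*-identityˡ z)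
        ; distrib = distribˡ , λ z w w′ → ≈-trans (*-comm (w + w′) z) (≈-trans (distribˡ z w w′)
            (mk≈ (ℝ.+-cong (re≈ (*-comm z w)) (re≈ (*-comm z w′))) (ℝ.+-cong (im≈ (*-comm z w)) (im≈ (*-comm z w′))))) }
      ; *-comm = *-comm } }
    where
    ≈-trans : ∀ {x y z} → x ≈ y → y ≈ z → x ≈ z
    ≈-trans (mk≈ a b) (mk≈ a′ b′) = mk≈ (ℝ.trans a a′) (ℝ.trans b b′)
    *-comm : ∀ z w → z * w ≈ w * z
    *-comm (x +i y) (u +i v) = mk≈
      (solve 4 (λ x y u v → x :* u :- y :* v := u :* x :- v :* y) ℝ.refl x y u v)
      (solve 4 (λ x y u v → x :* v :+ y :* u := u :* y :+ v :* x) ℝ.refl x y u v)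
    *-identityˡ : ∀ z → 1ᶜ * z ≈ z
    *-identityˡ (x +i y) = mk≈
      (solve 2 (λ x y → con (+ 1) :* x :- con (+ 0) :* y := x) ℝ.refl x y)
      (solve 2 (λ x y → con (+ 1) :* y :+ con (+ 0) :* x := y) ℝ.refl x y)
    distribˡ : ∀ z w w′ → z * (w + w′) ≈ z * w + z * w′
    distribˡ (x +i y) (u +i v) (s +i t) = mk≈
      (solve 6 (λ x y u v s t → x :* (u :+ s) :- y :* (v :+ t) := (x :* u :- y :* v) :+ (x :* s :- y :* t)) ℝ.refl x y u v s t)
      (solve 6 (λ x y u v s t → x :* (v :+ t) :+ y :* (u :+ s) := (x :* v :+ y :* u) :+ (x :* t :+ y :* s)) ℝ.refl x y u v s t)

-- Doubling the argument of the exponential on the imaginary axis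

module ComplexExponential {c ℓ₁ ℓ₂} (R : Reals c ℓ₁ ℓ₂) where
  open Complex R
  open ComplexRing R
  open OrderedField R
  private
    module ℝ = CommutativeRing (Reals.commutativeRing R)
    module ℂᵣ = CommutativeRing ℂ-commutativeRing
    module Σᴿ = Sums (Reals.commutativeRing R)
    module Σᶜ = Sums ℂ-commutativeRing
    open module Convᴿ = Convolution (Reals.commutativeRing R) using () renaming (Square to Squareᴿ; Triangle to Triangleᴿ; Corner to Cornerᴿ)
    open module Convᶜ = Convolution ℂ-commutativeRing using () renaming (Corner to Cornerᶜ)
    open Algebra.Properties.Semiring.Exp ℝ.semiring using () renaming (_^_ to _^ᴿ_)
    open Algebra.Properties.Semiring.Mult ℂᵣ.semiring using () renaming (_×_ to _·ᶜ_)
  open IntegerSolver (Reals.commutativeRing R) using (solve; _:=_; _:+_; _:*_; _:-_; :-_; con)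
  open Σᴿ using () renaming (Σ to ∑ᴿ)
  open Σᶜ using () renaming (Σ to ∑ᶜ)

  re-Σ : ∀ N f → re (∑ᶜ N f) ≈ᴿ ∑ᴿ N (λ k → re (f k))
  re-Σ zero    f = ℝ.refl
  re-Σ (suc N) f = ℝ.+-congˡ (re-Σ N (λ k → f (suc k)))

  ofReal-* : ∀ x y → ofReal x * ofReal y ≈ ofReal (x *ᴿ y)
  ofReal-* x y = mk≈ (solve 2 (λ x y → x :* y :- con (+ 0) :* con (+ 0) := x :* y) ℝ.refl x y)
                     (solve 2 (λ x y → x :* con (+ 0) :+ con (+ 0) :* y := con (+ 0)) ℝ.refl x y)

  ofReal-^ : ∀ x k → ofReal x ^ k ≈ ofReal (x ^ᴿ k)
  ofReal-^ x zero    = ℂᵣ.refl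
  ofReal-^ x (suc k) = ℂᵣ.trans (ℂᵣ.*-congˡ {ofReal x} (ofReal-^ x k)) (ofReal-* x (x ^ᴿ k))

  ·1ᶜ : ∀ n → n ·ᶜ 1ᶜ ≈ ofReal (fromℕ n)
  ·1ᶜ zero    = ℂᵣ.refl
  ·1ᶜ (suc n) = ℂᵣ.trans (ℂᵣ.+-congˡ {1ᶜ} (·1ᶜ n)) (mk≈ ℝ.refl (ℝ.+-identityˡ 0ᴿ))

  1/! : ℕ → ℝ
  1/! k = (1/ (k !)) {{k ℕₚ.!≢0}}

  private
    1/!*! : ∀ k → 1/! k *ᴿ fromℕ (k !) ≈ᴿ 1ᴿ
    1/!*! k = ℝ.trans (ℝ.*-comm _ _) (*1/ (k !) {{k ℕₚ.!≢0}})

    1/!*!ᶜ : ∀ k → ofReal (1/! k) * ((k !) ·ᶜ 1ᶜ) ≈ 1ᶜ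
    1/!*!ᶜ k = ℂᵣ.trans (ℂᵣ.*-congˡ {ofReal (1/! k)} (·1ᶜ (k !)))
      (ℂᵣ.trans (ofReal-* (1/! k) (fromℕ (k !))) (mk≈ (1/!*! k) ℝ.refl))

  open Convᴿ.Exponential 1/! 1/!*! using () renaming (term to termᴿ; product to productᴿ; Triangle-product to Triangle-productᴿ)
  open Convᶜ.Exponential (λ k → ofReal (1/! k)) 1/!*!ᶜ using () renaming
    (term to termᶜ; product to productᶜ; term-cong to termᶜ-cong; Triangle-product to Triangle-productᶜ; Square-product to Square-productᶜ)

  0≤1/! : ∀ k → 0ᴿ ≤ 1/! k
  0≤1/! k = <⇒≤ (0<1/ (k !) {{k ℕₚ.!≢0}})

  0≤^ : ∀ {y} → 0ᴿ ≤ y → ∀ k → 0ᴿ ≤ y ^ᴿ k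
  0≤^ 0≤y zero    = <⇒≤ (Reals.0<1 R)
  0≤^ 0≤y (suc k) = *-nonneg 0≤y (0≤^ 0≤y k)

  Σ-mono-≤ : ∀ N {f g} → (∀ k → k ℕ.< N → f k ≤ g k) → ∑ᴿ N f ≤ ∑ᴿ N g
  Σ-mono-≤ zero    f≤g = ≤-reflexive ℝ.refl
  Σ-mono-≤ (suc N) f≤g = +-mono-≤ (f≤g 0 (s≤s z≤n)) (Σ-mono-≤ N λ k k<N → f≤g (suc k) (s≤s k<N))

  Σ-nonneg : ∀ N {f} → (∀ k → 0ᴿ ≤ f k) → 0ᴿ ≤ ∑ᴿ N f
  Σ-nonneg zero    0≤f = ≤-reflexive ℝ.refl
  Σ-nonneg (suc N) 0≤f = +-nonneg (0≤f 0) (Σ-nonneg N (λ k → 0≤f (suc k)))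

  Σ-extend-≤ : ∀ M N {f} → (∀ k → 0ᴿ ≤ f k) → ∑ᴿ M f ≤ ∑ᴿ (M ℕ.+ N) f
  Σ-extend-≤ M N {f} 0≤f = ≤-resp-≈ (ℝ.+-identityʳ _) (ℝ.sym (Σᴿ.Σ-split M N f))
    (+-mono-≤ (≤-reflexive ℝ.refl) (Σ-nonneg N (λ k → 0≤f (M ℕ.+ k))))

  -- For i , j < N one has i + j < 2N. Each of the first `N` rows is extended from length `N` to
  -- `N + N ∸ i`, then the remaining `N` rows are added; nonnegativity makes both steps increase the
  -- sum.
  Square≤Triangle : ∀ N {g} → (∀ i j → 0ᴿ ≤ g i j) → Squareᴿ N g ≤ Triangleᴿ (N ℕ.+ N) g
  Square≤Triangle N {g} 0≤g = ≤-trans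
    (Σ-mono-≤ N λ i i<N → ≤-trans (Σ-extend-≤ N (N ∸ i) (0≤g i))
      (≤-reflexive (ℝ.reflexive (≡.cong (λ M → ∑ᴿ M (g i)) (≡.sym (ℕₚ.+-∸-assoc N (ℕₚ.<⇒≤ i<N)))))))
    (Σ-extend-≤ N N λ i → Σ-nonneg (N ℕ.+ N ∸ i) (0≤g i))

  infix 4 _⊑_
  -- Such coordinatewise bounds are not multiplicative in general. They are respected by a
  -- nonnegative real factor and by a factor iy with y ≥ 0, which only exchanges the coordinates up
  -- to sign; the terms of the series at iy are built from these two.
  record _⊑_ (z : ℂ) (r : ℝ) : Set ℓ₂ where
    constructor mk⊑
    field
      re≤  : re z ≤ r
      -re≤ : -ᴿ re z ≤ r
      im≤  : im z ≤ r
      -im≤ : -ᴿ im z ≤ r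

  private
    -0≤ : ∀ {r} → 0ᴿ ≤ r → -ᴿ 0ᴿ ≤ r
    -0≤ = ≤-resp-≈ (ℝ.sym -0≈0) ℝ.refl

    -+≤ : ∀ {x y u v} → -ᴿ x ≤ u → -ᴿ y ≤ v → -ᴿ (x +ᴿ y) ≤ u +ᴿ v
    -+≤ {x} {y} a b = ≤-resp-≈ (solve 2 (λ x y → :- x :+ :- y := :- (x :+ y)) ℝ.refl x y) ℝ.refl (+-mono-≤ a b)

  ⊑-resp-≈ : ∀ {z w r s} → z ≈ w → r ≈ᴿ s → z ⊑ r → w ⊑ s
  ⊑-resp-≈ (mk≈ a b) r≈s (mk⊑ p q s t) = mk⊑
    (≤-resp-≈ a r≈s p) (≤-resp-≈ (ℝ.-‿cong a) r≈s q) (≤-resp-≈ b r≈s s) (≤-resp-≈ (ℝ.-‿cong b) r≈s t)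

  ⊑-+ : ∀ {z w r s} → z ⊑ r → w ⊑ s → z + w ⊑ r +ᴿ s
  ⊑-+ (mk⊑ a b c d) (mk⊑ a′ b′ c′ d′) = mk⊑ (+-mono-≤ a a′) (-+≤ b b′) (+-mono-≤ c c′) (-+≤ d d′)

  ⊑-Σ : ∀ N {f g} → (∀ k → f k ⊑ g k) → ∑ᶜ N f ⊑ ∑ᴿ N g
  ⊑-Σ zero    f⊑g = mk⊑ (≤-reflexive ℝ.refl) (≤-reflexive -0≈0) (≤-reflexive ℝ.refl) (≤-reflexive -0≈0)
  ⊑-Σ (suc N) f⊑g = ⊑-+ (f⊑g 0) (⊑-Σ N (λ k → f⊑g (suc k)))

  1⊑1 : 1ᶜ ⊑ 1ᴿ
  1⊑1 = mk⊑ (≤-reflexive ℝ.refl) (≤-trans (≤-resp-≈ ℝ.refl -0≈0 (neg-≤ 0≤1)) 0≤1) 0≤1 (-0≤ 0≤1)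
    where
    0≤1 : 0ᴿ ≤ 1ᴿ
    0≤1 = <⇒≤ (Reals.0<1 R)

  ⊑-scale : ∀ {x z r} → 0ᴿ ≤ x → z ⊑ r → ofReal x * z ⊑ x *ᴿ r
  ⊑-scale {x} {u +i v} 0≤x (mk⊑ p q s t) = mk⊑
    (≤-resp-≈ (solve 3 (λ x u v → x :* u := x :* u :- con (+ 0) :* v) ℝ.refl x u v) ℝ.refl (*-monoʳ-≤ 0≤x p))
    (≤-resp-≈ (solve 3 (λ x u v → x :* (:- u) := :- (x :* u :- con (+ 0) :* v)) ℝ.refl x u v) ℝ.refl (*-monoʳ-≤ 0≤x q))
    (≤-resp-≈ (solve 3 (λ x u v → x :* v := x :* v :+ con (+ 0) :* u) ℝ.refl x u v) ℝ.refl (*-monoʳ-≤ 0≤x s))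
    (≤-resp-≈ (solve 3 (λ x u v → x :* (:- v) := :- (x :* v :+ con (+ 0) :* u)) ℝ.refl x u v) ℝ.refl (*-monoʳ-≤ 0≤x t))

  ⊑-rotate : ∀ {y z r} → 0ᴿ ≤ y → z ⊑ r → (0ᴿ +i y) * z ⊑ y *ᴿ r
  ⊑-rotate {y} {u +i v} 0≤y (mk⊑ p q s t) = mk⊑
    (≤-resp-≈ (solve 3 (λ y u v → y :* (:- v) := con (+ 0) :* u :- y :* v) ℝ.refl y u v) ℝ.refl (*-monoʳ-≤ 0≤y t))
    (≤-resp-≈ (solve 3 (λ y u v → y :* v := :- (con (+ 0) :* u :- y :* v)) ℝ.refl y u v) ℝ.refl (*-monoʳ-≤ 0≤y s))
    (≤-resp-≈ (solve 3 (λ y u v → y :* u := con (+ 0) :* v :+ y :* u) ℝ.refl y u v) ℝ.refl (*-monoʳ-≤ 0≤y p))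
    (≤-resp-≈ (solve 3 (λ y u v → y :* (:- u) := :- (con (+ 0) :* v :+ y :* u)) ℝ.refl y u v) ℝ.refl (*-monoʳ-≤ 0≤y q))

  ⊑-^ : ∀ {y z r} → 0ᴿ ≤ y → z ⊑ r → ∀ k → (0ᴿ +i y) ^ k * z ⊑ y ^ᴿ k *ᴿ r
  ⊑-^ {z = z} 0≤y z⊑r zero    = ⊑-resp-≈ (ℂᵣ.sym (ℂᵣ.*-identityˡ z)) (ℝ.sym (ℝ.*-identityˡ _)) z⊑r
  ⊑-^ {y} {z} 0≤y z⊑r (suc k) = ⊑-resp-≈ (ℂᵣ.sym (ℂᵣ.*-assoc (0ᴿ +i y) ((0ᴿ +i y) ^ k) z)) (ℝ.sym (ℝ.*-assoc _ _ _))
    (⊑-rotate 0≤y (⊑-^ 0≤y z⊑r k))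

  ⊑-term : ∀ {y z r} → 0ᴿ ≤ y → z ⊑ r → ∀ k → termᶜ (0ᴿ +i y) k * z ⊑ termᴿ y k *ᴿ r
  ⊑-term {y} {z} 0≤y z⊑r k = ⊑-resp-≈ (ℂᵣ.sym (ℂᵣ.*-assoc (ofReal (1/! k)) ((0ᴿ +i y) ^ k) z)) (ℝ.sym (ℝ.*-assoc _ _ _))
    (⊑-scale (0≤1/! k) (⊑-^ 0≤y z⊑r k))

  ⊑-product : ∀ {y} → 0ᴿ ≤ y → ∀ i j → productᶜ (0ᴿ +i y) (0ᴿ +i y) i j ⊑ productᴿ y y i j
  ⊑-product {y} 0≤y i j = ⊑-term 0≤y
    (⊑-resp-≈ (ℂᵣ.*-identityʳ (termᶜ (0ᴿ +i y) j)) (ℝ.*-identityʳ _) (⊑-term 0≤y 1⊑1 j)) i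

  module _ {exp : ℂ → ℂ} (isExp : IsExponential exp) where

    re-exp : ∀ z → Null (λ N → re (∑ᶜ N (termᶜ z)) -ᴿ re (exp z))
    re-exp z = Null-cong (λ N → ℝ.+-congʳ (re≈ (Σᶜ.sum-Σ N (termᶜ z)))) (⟶⇒Null (proj₁ (isExp z)))

    im-exp : ∀ z → Null (λ N → im (∑ᶜ N (termᶜ z)) -ᴿ im (exp z))
    im-exp z = Null-cong (λ N → ℝ.+-congʳ (im≈ (Σᶜ.sum-Σ N (termᶜ z)))) (⟶⇒Null (proj₂ (isExp z)))

    -- The real series converges because it is the real part of the complex one at a real argument.
    -- Its N-th and 2N-th partial sums therefore approach the same limit.
    Cauchy-exp : ∀ x → Null (λ N → ∑ᴿ (N ℕ.+ N) (termᴿ x) -ᴿ ∑ᴿ N (termᴿ x))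
    Cauchy-exp x = Null-cong (λ N → solve 3 (λ a b l → (a :- l) :+ (:- (b :- l)) := a :- b) ℝ.refl _ _ (re (exp (ofReal x))))
      (Null-+ (Null-∘ (λ N → N ℕ.+ N) (λ N → ℕₚ.m≤m+n N N) real) (Null-neg real))
      where
      real : Null (λ N → ∑ᴿ N (termᴿ x) -ᴿ re (exp (ofReal x)))
      real = Null-cong (λ N → ℝ.+-congʳ (ℝ.trans (re-Σ N (termᶜ (ofReal x)))
        (Σᴿ.Σ-cong N λ k _ → re≈ (ℂᵣ.trans (ℂᵣ.*-congˡ {ofReal (1/! k)} (ofReal-^ x k)) (ofReal-* (1/! k) (x ^ᴿ k))))))
        (re-exp (ofReal x))

    -- By the identity f g - a b = (f - a)(g - b) + a (g - b) + b (f - a) all summands tend to 0.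
    Null-product : ∀ {f g : ℕ → ℝ} {a b} → Null (λ N → f N -ᴿ a) → Null (λ N → g N -ᴿ b) → Null (λ N → f N *ᴿ g N -ᴿ a *ᴿ b)
    Null-product {f} {g} {a} {b} nf ng = Null-cong
      (λ N → solve 4 (λ f g a b → (f :- a) :* (g :- b) :+ (a :* (g :- b) :+ b :* (f :- a)) := f :* g :- a :* b) ℝ.refl (f N) (g N) a b)
      (Null-+ (Null-* nf ng) (Null-+ (Null-scale a ng) (Null-scale b nf)))

    -- The difference between the square of the N-th partial sum at iy and the
    -- N-th partial sum at 2iy is a sum over the corner i , j < N ≤ i + j.  It
    -- is dominated by the same corner at the real point y, which lies between
    -- the N-th and the 2N-th partial sums at 2y.
    exp-double : ∀ {y} → 0ᴿ ≤ y → ∀ {w} → (0ᴿ +i y) + (0ᴿ +i y) ≈ w → exp (0ᴿ +i y) * exp (0ᴿ +i y) ≈ exp w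
    exp-double {y} 0≤y {w} z+z≈w = mk≈ (limit re-square re-difference (re-exp w)) (limit im-square im-difference (im-exp w))
      where
      z : ℂ
      z = 0ᴿ +i y

      E W : ℕ → ℂ
      E N = ∑ᶜ N (termᶜ z)
      W N = ∑ᶜ N (termᶜ w)

      E²≈W+Corner : ∀ N → E N * E N ≈ W N + Cornerᶜ N (productᶜ z z)
      E²≈W+Corner N = ℂᵣ.trans (ℂᵣ.sym (Square-productᶜ z z N))
        (ℂᵣ.trans (Convᶜ.Square≈Triangle+Corner N (productᶜ z z))
        (ℂᵣ.+-congʳ {Cornerᶜ N (productᶜ z z)} (ℂᵣ.trans (Triangle-productᶜ z z N) (Σᶜ.Σ-cong N λ k _ → termᶜ-cong z+z≈w k))))

      bound : ℕ → ℝ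
      bound N = ∑ᴿ (N ℕ.+ N) (termᴿ (y +ᴿ y)) -ᴿ ∑ᴿ N (termᴿ (y +ᴿ y))

      Corner≤bound : ∀ N → Cornerᴿ N (productᴿ y y) ≤ bound N
      Corner≤bound N = ≤-resp-≈ corner (ℝ.+-cong (Triangle-productᴿ y y (N ℕ.+ N)) (ℝ.-‿cong (Triangle-productᴿ y y N)))
        (+-mono-≤ (Square≤Triangle N λ i j → *-nonneg (0≤term i) (0≤term j)) (≤-reflexive ℝ.refl))
        where
        0≤term : ∀ k → 0ᴿ ≤ termᴿ y k
        0≤term k = *-nonneg (0≤1/! k) (0≤^ 0≤y k)
        corner : Squareᴿ N (productᴿ y y) -ᴿ Triangleᴿ N (productᴿ y y) ≈ᴿ Cornerᴿ N (productᴿ y y)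
        corner = ℝ.trans (ℝ.+-congʳ (Convᴿ.Square≈Triangle+Corner N (productᴿ y y)))
          (solve 2 (λ t c → (t :+ c) :- t := c) ℝ.refl _ _)

      Corner⊑ : ∀ N → Cornerᶜ N (productᶜ z z) ⊑ Cornerᴿ N (productᴿ y y)
      Corner⊑ N = ⊑-Σ N λ i → ⊑-Σ i λ j → ⊑-product 0≤y i (N ∸ i ℕ.+ j)

      cancel : ∀ {x t d} → x ≈ᴿ t +ᴿ d → d ≈ᴿ x -ᴿ t
      cancel {t = t} {d} eq = ℝ.trans (solve 2 (λ t d → d := (t :+ d) :- t) ℝ.refl t d) (ℝ.+-congʳ (ℝ.sym eq))

      re-difference : Null (λ N → re (E N * E N) -ᴿ re (W N))
      re-difference = Null-cong (λ N → cancel (re≈ (E²≈W+Corner N))) (Null-squeeze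
        (λ N → ≤-trans (_⊑_.re≤ (Corner⊑ N)) (Corner≤bound N)) (λ N → ≤-trans (_⊑_.-re≤ (Corner⊑ N)) (Corner≤bound N)) (Cauchy-exp (y +ᴿ y)))

      im-difference : Null (λ N → im (E N * E N) -ᴿ im (W N))
      im-difference = Null-cong (λ N → cancel (im≈ (E²≈W+Corner N))) (Null-squeeze
        (λ N → ≤-trans (_⊑_.im≤ (Corner⊑ N)) (Corner≤bound N)) (λ N → ≤-trans (_⊑_.-im≤ (Corner⊑ N)) (Corner≤bound N)) (Cauchy-exp (y +ᴿ y)))

      re-square : Null (λ N → re (E N * E N) -ᴿ re (exp z * exp z))
      re-square = Null-cong (λ N → solve 4 (λ a b c d → (a :- c) :+ (:- (b :- d)) := (a :- b) :- (c :- d)) ℝ.refl _ _ _ _)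
        (Null-+ (Null-product (re-exp z) (re-exp z)) (Null-neg (Null-product (im-exp z) (im-exp z))))

      im-square : Null (λ N → im (E N * E N) -ᴿ im (exp z * exp z))
      im-square = Null-cong (λ N → solve 4 (λ a b c d → (a :- c) :+ (b :- d) := (a :+ b) :- (c :+ d)) ℝ.refl _ _ _ _)
        (Null-+ (Null-product (re-exp z) (im-exp z)) (Null-product (im-exp z) (re-exp z)))

      limit : ∀ {s t : ℕ → ℝ} {a b} → Null (λ N → s N -ᴿ a) → Null (λ N → s N -ᴿ t N) → Null (λ N → t N -ᴿ b) → a ≈ᴿ b
      limit {s} {t} {a} {b} s→a s-t t→b = ℝ.trans (solve 2 (λ a b → a := (a :- b) :+ b) ℝ.refl a b)
        (ℝ.trans (ℝ.+-congʳ (Null-const (Null-cong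
          (λ N → solve 4 (λ s t a b → (:- (s :- a)) :+ ((s :- t) :+ (t :- b)) := a :- b) ℝ.refl (s N) (t N) a b)
          (Null-+ (Null-neg s→a) (Null-+ s-t t→b))))) (ℝ.+-identityˡ b))

    module _ {π : ℝ} (isPi : IsPi exp π) where

      -- sin y ≉ 0 at y = π k / n, so the square of exp (iy) is not 1: a vanishing
      -- imaginary part 2 cos y sin y would force cos y = 0 and real part - sin² y.
      e^2πi≉1 : ∀ k n .{{_ : NonZero n}} → 0 ℕ.< k → k ℕ.< n → ¬ (e^2πi exp π k n ≈ 1ᶜ)
      e^2πi≉1 k n 0<k k<n e≈1 = irrefl (ℝ.sym 1≈0) (Reals.0<1 R)
        where
        open IsPi isPi
        y : ℝ
        y = fromℕ k *ᴿ π *ᴿ 1/ n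
        0<y : 0ᴿ <ᴿ y
        0<y = Reals.*-pos R (Reals.*-pos R (Reals.0<fromℕ R k {{ℕ.>-nonZero 0<k}}) positive) (0<1/ n)
        y<π : y <ᴿ π
        y<π = 0<y-x⇒x<y (<-respʳ-≈
          (ℝ.trans (solve 4 (λ n k p h → (n :- k) :* (p :* h) := (n :* h) :* p :- k :* p :* h) ℝ.refl (fromℕ n) (fromℕ k) π (1/ n))
            (ℝ.+-congʳ (ℝ.trans (ℝ.*-congʳ (*1/ n)) (ℝ.*-identityˡ π))))
          (Reals.*-pos R (x<y⇒0<y-x (fromℕ-mono-< k<n)) (Reals.*-pos R positive (0<1/ n))))
        cos-y sin-y : ℝ
        cos-y = re (exp (0ᴿ +i y))
        sin-y = im (exp (0ᴿ +i y))
        fromℕ-2* : fromℕ k +ᴿ fromℕ k ≈ᴿ fromℕ (2 ℕ.* k)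
        fromℕ-2* = ℝ.trans (ℝ.sym (×-homo-+ 1ᴿ k k)) (ℝ.reflexive (≡.cong (λ m → fromℕ (k ℕ.+ m)) (≡.sym (ℕₚ.+-identityʳ k))))
          where open Algebra.Properties.Semiring.Mult ℝ.semiring using (×-homo-+)
        square≈1 : exp (0ᴿ +i y) * exp (0ᴿ +i y) ≈ 1ᶜ
        square≈1 = ℂᵣ.trans (exp-double (<⇒≤ 0<y) (mk≈ (ℝ.+-identityˡ 0ᴿ) (ℝ.trans
          (solve 3 (λ k p h → k :* p :* h :+ k :* p :* h := (k :+ k) :* p :* h) ℝ.refl (fromℕ k) π (1/ n))
          (ℝ.*-congʳ (ℝ.*-congʳ fromℕ-2*))))) e≈1
        cos-y≈0 : cos-y ≈ᴿ 0ᴿ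
        cos-y≈0 = sum-squares≈0 (ℝ.trans (ℝ.sym (ℝ.distribˡ cos-y cos-y cos-y)) (ℝ.trans (ℝ.*-congˡ 2cos-y≈0) (ℝ.zeroʳ cos-y)))
          where
          2cos-y≈0 : cos-y +ᴿ cos-y ≈ᴿ 0ᴿ
          2cos-y≈0 = ≉0⇒*-cancelˡ (least y 0<y y<π)
            (ℝ.trans (solve 2 (λ c s → s :* (c :+ c) := c :* s :+ s :* c) ℝ.refl cos-y sin-y) (im≈ square≈1))
        1≈0 : 1ᴿ ≈ᴿ 0ᴿ
        1≈0 = sum-squares≈0 {1ᴿ} {sin-y} (ℝ.trans (ℝ.+-congʳ (ℝ.trans (ℝ.*-identityˡ 1ᴿ) (ℝ.sym (re≈ square≈1))))
          (ℝ.trans (solve 2 (λ c s → (c :* c :- s :* s) :+ s :* s := c :* c) ℝ.refl cos-y sin-y)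
          (ℝ.trans (ℝ.*-congʳ cos-y≈0) (ℝ.zeroˡ cos-y))))

-- Solutions of x = y + 1 in a cyclic group, weighted by characters

module DifferenceSums {c ℓ} (A : CommutativeRing c ℓ) where
  open CommutativeRing A
  open Sums A
  open Algebra.Properties.Semiring.Exp semiring
  open Algebra.Properties.CommutativeSemiring.Exp commutativeSemiring using (^-distrib-*)
  open IntegerSolver A using (solve; _:=_; _:+_; _:*_; _:-_; :-_; con)
  open Relation.Binary.Reasoning.Setoid setoid

  Σ² : ℕ → (ℕ → ℕ → Carrier) → Carrier
  Σ² N f = Σ N λ i → Σ N λ j → f i j

  Σ²-cong : ∀ N {f g} → (∀ i j → i ℕ.< N → j ℕ.< N → f i j ≈ g i j) → Σ² N f ≈ Σ² N g
  Σ²-cong N eq = Σ-cong N λ i i<N → Σ-cong N λ j j<N → eq i j i<N j<N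

  Σ²-comm : ∀ M N (f : ℕ → ℕ → ℕ → ℕ → Carrier) →
            Σ² M (λ i j → Σ² N λ s t → f i j s t) ≈ Σ² N (λ s t → Σ² M λ i j → f i j s t)
  Σ²-comm M N f = begin
    Σ M (λ i → Σ M λ j → Σ N λ s → Σ N λ t → f i j s t)   ≈⟨ Σ-cong M (λ i _ → Σ-comm M N λ j s → Σ N λ t → f i j s t) ⟩
    Σ M (λ i → Σ N λ s → Σ M λ j → Σ N λ t → f i j s t)   ≈⟨ Σ-comm M N (λ i s → Σ M λ j → Σ N λ t → f i j s t) ⟩
    Σ N (λ s → Σ M λ i → Σ M λ j → Σ N λ t → f i j s t)   ≈⟨ Σ-cong N (λ s _ → Σ-cong M λ i _ → Σ-comm M N λ j t → f i j s t) ⟩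
    Σ N (λ s → Σ M λ i → Σ N λ t → Σ M λ j → f i j s t)   ≈⟨ Σ-cong N (λ s _ → Σ-comm M N λ i t → Σ M λ j → f i j s t) ⟩
    Σ N (λ s → Σ N λ t → Σ M λ i → Σ M λ j → f i j s t)   ∎

  *-distribˡ-Σ² : ∀ N x f → x * Σ² N f ≈ Σ² N λ i j → x * f i j
  *-distribˡ-Σ² N x f = trans (*-distribˡ-Σ N x _) (Σ-cong N λ i _ → *-distribˡ-Σ N x (f i))

  *-distribʳ-Σ² : ∀ N x f → Σ² N f * x ≈ Σ² N λ i j → f i j * x
  *-distribʳ-Σ² N x f = trans (*-distribʳ-Σ N x _) (Σ-cong N λ i _ → *-distribʳ-Σ N x (f i))

  Σ²-*-Σ² : ∀ M N f g → Σ² M f * Σ² N g ≈ Σ² M λ i j → Σ² N λ s t → f i j * g s t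
  Σ²-*-Σ² M N f g = trans (*-distribʳ-Σ² M (Σ² N g) f) (Σ²-cong M λ i j _ _ → *-distribˡ-Σ² N (f i j) g)

  1^ : ∀ k → 1# ^ k ≈ 1#
  1^ zero    = refl
  1^ (suc k) = trans (*-identityˡ _) (1^ k)

  ^-swap : ∀ x j k → (x ^ j) ^ k ≈ (x ^ k) ^ j
  ^-swap x j k = trans (^-assocʳ x j k) (trans (^-congʳ x (ℕₚ.*-comm j k)) (sym (^-assocʳ x k j)))

  root-^ : ∀ {x n} → x ^ n ≈ 1# → ∀ j → (x ^ j) ^ n ≈ 1#
  root-^ {x} {n} xⁿ≈1 j = trans (^-swap x j n) (trans (^-congˡ j xⁿ≈1) (1^ j))

  ^-periodic : ∀ {x n} → x ^ n ≈ 1# → ∀ j → x ^ (j ℕ.+ n) ≈ x ^ j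
  ^-periodic {x} {n} xⁿ≈1 j = trans (^-homo-* x j n) (trans (*-congˡ xⁿ≈1) (*-identityʳ _))

  -- Telescoping, in a form free of division: for a root of unity the two ones cancel, leaving (ω -
  -- 1) times the sum equal to 0.
  geometric : ∀ N ω → (ω - 1#) * Σ N (ω ^_) + 1# ≈ ω ^ N
  geometric N ω = begin
    (ω - 1#) * X + 1#               ≈⟨ +-congʳ (trans (distribʳ X ω (- 1#)) (+-congˡ (solve 1 (λ x → (:- con (+ 1)) :* x := :- x) refl X))) ⟩
    (ω * X - X) + 1#                ≈⟨ solve 3 (λ a x o → (a :- x) :+ o := (o :+ a) :- x) refl (ω * X) X 1# ⟩
    (1# + ω * X) - X                ≈⟨ +-congʳ (+-congˡ (*-distribˡ-Σ N ω (ω ^_))) ⟩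
    Σ (suc N) (ω ^_) - X            ≈⟨ +-congʳ (Σ-last N (ω ^_)) ⟩
    (X + ω ^ N) - X                 ≈⟨ solve 2 (λ x w → (x :+ w) :- x := w) refl X (ω ^ N) ⟩
    ω ^ N                           ∎
    where
    X : Carrier
    X = Σ N (ω ^_)

  module _ {m : ℕ} .{{_ : NonZero m}} (g : ℤ/ m) where

    D : ℕ → ℕ → Carrier
    D j k = [ g ^ₘ j Finₚ.≟ g ^ₘ k +ₘ 1ₘ ]

    -- With ζ = χ(α) and ε = χ(-1) this is ε ^ v J(χ ^ u , χ ^ v) for α and ζ,
    -- and ε ^ v c(u , v) for β and ζ⁻¹.
    K : ℕ → Carrier → ℕ → ℕ → Carrier
    K N θ u v = Σ² N λ j k → D j k * ((θ ^ j) ^ u * (θ ^ k) ^ v)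

  module _ {m : ℕ} .{{_ : NonZero m}} {g : ℤ/ m} (unit : IsUnit g) {N : ℕ} (g^N≡1 : g ^ₘ N ≡ 1ₘ) where

    private
      power-periodic : ∀ j → g ^ₘ (j ℕ.+ N) ≡ g ^ₘ j
      power-periodic = ^ₘ-periodic g {N} g^N≡1

      D-periodicˡ : ∀ j k → D g (j ℕ.+ N) k ≈ D g j k
      D-periodicˡ j k = reflexive (≡.cong (λ x → [ x Finₚ.≟ g ^ₘ k +ₘ 1ₘ ]) (power-periodic j))

      D-periodicʳ : ∀ j k → D g j (k ℕ.+ N) ≈ D g j k
      D-periodicʳ j k = reflexive (≡.cong (λ x → [ g ^ₘ j Finₚ.≟ x +ₘ 1ₘ ]) (power-periodic k))

      -- x = y + 1 becomes x / y = 1 / y + 1.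
      D-divide : ∀ j {k} → k ℕ.< N → D g (j ℕ.+ k) k ≈ D g j (N ∸ k)
      D-divide j {k} k<N = []-⇔ (g ^ₘ (j ℕ.+ k) Finₚ.≟ _) (g ^ₘ j Finₚ.≟ _)
        (λ eq → *ₘ-cancelˡ-unit (g ^ₘ k) (^ₘ-unit g unit k) _ _ (≡.trans (≡.sym left) (≡.trans eq right)))
        (λ eq → ≡.trans left (≡.trans (≡.cong (g ^ₘ k *ₘ_) eq) (≡.sym right)))
        where
        left : g ^ₘ (j ℕ.+ k) ≡ g ^ₘ k *ₘ g ^ₘ j
        left = ≡.trans (^ₘ-homo-+ g j k) (*ₘ-comm (g ^ₘ j) (g ^ₘ k))
        right : g ^ₘ k +ₘ 1ₘ ≡ g ^ₘ k *ₘ (g ^ₘ (N ∸ k) +ₘ 1ₘ)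
        right = ≡.sym (≡.trans (*ₘ-distribˡ-+ₘ (g ^ₘ k) _ 1ₘ)
          (≡.trans (≡.cong₂ _+ₘ_ inverse (≡.trans (*ₘ-comm _ 1ₘ) (*ₘ-identityˡ _))) (+ₘ-comm 1ₘ _)))
          where
          inverse : g ^ₘ k *ₘ g ^ₘ (N ∸ k) ≡ 1ₘ
          inverse = ≡.trans (≡.sym (^ₘ-homo-+ g k (N ∸ k)))
            (≡.trans (≡.cong (g ^ₘ_) (ℕₚ.m+[n∸m]≡n (ℕₚ.<⇒≤ k<N))) g^N≡1)

    module _ {θ : Carrier} (θ^N≈1 : θ ^ N ≈ 1#) where

      -- If exponent u + v is trivial, then xᵘ yᵛ = (x / y)ᵘ depends on x / y alone, and this is
      -- again the left side of a solution, with 1 / y on the right. In exponents the substitution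
      -- is j to j + k, followed by k to N - k.
      K-antidiagonal : ∀ u v → (∀ k → (θ ^ k) ^ (u ℕ.+ v) ≈ 1#) → K g N θ u v ≈ K g N θ u 0
      K-antidiagonal u v trivial = begin
        K g N θ u v                                           ≈⟨ Σ-comm N N _ ⟩
        Σ N (λ k → Σ N λ j → summand j k)                     ≈⟨ Σ-cong N (λ k _ → Σ-shift N (λ j → summand j k) (periodicˡ k) k) ⟨
        Σ N (λ k → Σ N λ j → summand (j ℕ.+ k) k)             ≈⟨ Σ-cong N (λ k k<N → Σ-cong N λ j _ → *-cong (D-divide j k<N) (weight j k)) ⟩
        Σ N (λ k → F (N ∸ k))                                 ≈⟨ Σ-reflect N F periodic ⟩
        Σ N F                                                 ≈⟨ Σ-comm N N _ ⟨
        Σ² N (λ j k → D g j k * (θ ^ j) ^ u)                  ≈⟨ Σ²-cong N (λ j k _ _ → *-congˡ (*-identityʳ _)) ⟨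
        K g N θ u 0                                           ∎
        where
        summand : ℕ → ℕ → Carrier
        summand j k = D g j k * ((θ ^ j) ^ u * (θ ^ k) ^ v)
        F : ℕ → Carrier
        F k = Σ N λ j → D g j k * (θ ^ j) ^ u
        periodicˡ : ∀ k → Periodic N (λ j → summand j k)
        periodicˡ k j = *-cong (D-periodicˡ j k) (*-congʳ (^-congˡ u (^-periodic θ^N≈1 j)))
        periodic : Periodic N F
        periodic k = Σ-cong N λ j _ → *-congʳ (D-periodicʳ j k)
        weight : ∀ j k → (θ ^ (j ℕ.+ k)) ^ u * (θ ^ k) ^ v ≈ (θ ^ j) ^ u
        weight j k = begin
          (θ ^ (j ℕ.+ k)) ^ u * (θ ^ k) ^ v              ≈⟨ *-congʳ (trans (^-congˡ u (^-homo-* θ j k)) (^-distrib-* _ _ u)) ⟩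
          ((θ ^ j) ^ u * (θ ^ k) ^ u) * (θ ^ k) ^ v      ≈⟨ *-assoc _ _ _ ⟩
          (θ ^ j) ^ u * ((θ ^ k) ^ u * (θ ^ k) ^ v)      ≈⟨ *-congˡ (trans (sym (^-homo-* (θ ^ k) u v)) (trivial k)) ⟩
          (θ ^ j) ^ u * 1#                               ≈⟨ *-identityʳ _ ⟩
          (θ ^ j) ^ u                                    ∎

      -- x = y + 1 becomes - y = - x + 1.
      K-swap : ∀ {h} → g ^ₘ h ≡ -ₘ 1ₘ → ∀ u v → K g N θ u v * ((θ ^ h) ^ u * (θ ^ h) ^ v) ≈ K g N θ v u
      K-swap {h} g^h≡-1 u v = sym (begin
        K g N θ v u                                                ≈⟨ Σ-shift N _ periodicˡ h ⟨
        Σ N (λ j → Σ N λ k → summand (j ℕ.+ h) k)                  ≈⟨ Σ-cong N (λ j _ → Σ-shift N _ (periodicʳ (j ℕ.+ h)) h) ⟨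
        Σ N (λ j → Σ N λ k → summand (j ℕ.+ h) (k ℕ.+ h))          ≈⟨ Σ²-cong N (λ j k _ _ → trans (*-cong (D-negate j k) (weight j k)) (sym (*-assoc _ _ _))) ⟩
        Σ² N (λ j k → D g k j * ((θ ^ k) ^ u * (θ ^ j) ^ v) * w)   ≈⟨ *-distribʳ-Σ² N w _ ⟨
        Σ² N (λ j k → D g k j * ((θ ^ k) ^ u * (θ ^ j) ^ v)) * w   ≈⟨ *-congʳ (Σ-comm N N _) ⟩
        K g N θ u v * w                                            ∎)
        where
        w : Carrier
        w = (θ ^ h) ^ u * (θ ^ h) ^ v
        summand : ℕ → ℕ → Carrier
        summand j k = D g j k * ((θ ^ j) ^ v * (θ ^ k) ^ u)
        periodicʳ : ∀ j → Periodic N (summand j)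
        periodicʳ j k = *-cong (D-periodicʳ j k) (*-congˡ (^-congˡ u (^-periodic θ^N≈1 k)))
        periodicˡ : Periodic N (λ j → Σ N λ k → summand j k)
        periodicˡ j = Σ-cong N λ k _ → *-cong (D-periodicˡ j k) (*-congʳ (^-congˡ v (^-periodic θ^N≈1 j)))
        shift : ∀ j x → (θ ^ (j ℕ.+ h)) ^ x ≈ (θ ^ j) ^ x * (θ ^ h) ^ x
        shift j x = trans (^-congˡ x (^-homo-* θ j h)) (^-distrib-* _ _ x)
        weight : ∀ j k → (θ ^ (j ℕ.+ h)) ^ v * (θ ^ (k ℕ.+ h)) ^ u ≈ ((θ ^ k) ^ u * (θ ^ j) ^ v) * w
        weight j k = trans (*-cong (shift j v) (shift k u))
          (solve 4 (λ a b c d → (a :* b) :* (c :* d) := (c :* a) :* (d :* b)) refl _ _ _ _)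
        D-negate : ∀ j k → D g (j ℕ.+ h) (k ℕ.+ h) ≈ D g k j
        D-negate j k = []-⇔ (g ^ₘ (j ℕ.+ h) Finₚ.≟ _) (g ^ₘ k Finₚ.≟ _) to from
          where
          open IntegerSolver (ℤ/-commutativeRing {m}) renaming (solve to solveₘ; _:=_ to _:=ₘ_; _:+_ to _:+ₘ_; :-_ to :-ₘ_)
          negative : ∀ i → g ^ₘ (i ℕ.+ h) ≡ -ₘ (g ^ₘ i)
          negative i = ≡.trans (^ₘ-homo-+ g i h) (≡.trans (≡.cong (g ^ₘ i *ₘ_) g^h≡-1)
            (≡.trans (*ₘ-comm (g ^ₘ i) (-ₘ 1ₘ)) (Algebra.Properties.Ring.-1*x≈-x (CommutativeRing.ring ℤ/-commutativeRing) (g ^ₘ i))))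
          x y : ℤ/ m
          x = g ^ₘ j
          y = g ^ₘ k
          to : g ^ₘ (j ℕ.+ h) ≡ g ^ₘ (k ℕ.+ h) +ₘ 1ₘ → y ≡ x +ₘ 1ₘ
          to eq = ≡.trans (solveₘ 2 (λ x y → y :=ₘ x :+ₘ (:-ₘ x :+ₘ y)) ≡.refl x y)
            (≡.cong (x +ₘ_) (≡.trans (≡.cong (_+ₘ y) (≡.trans (≡.sym (negative j)) (≡.trans eq (≡.cong (_+ₘ 1ₘ) (negative k)))))
              (solveₘ 2 (λ y o → (:-ₘ y :+ₘ o) :+ₘ y :=ₘ o) ≡.refl y 1ₘ)))
          from : y ≡ x +ₘ 1ₘ → g ^ₘ (j ℕ.+ h) ≡ g ^ₘ (k ℕ.+ h) +ₘ 1ₘ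
          from eq = ≡.trans (negative j) (≡.trans
            (solveₘ 2 (λ x o → :-ₘ x :=ₘ :-ₘ (x :+ₘ o) :+ₘ o) ≡.refl x 1ₘ)
            (≡.cong (_+ₘ 1ₘ) (≡.trans (≡.cong (λ z → -ₘ z) (≡.sym eq)) (≡.sym (negative k)))))

-- Folding a symmetric double sum onto 1 ≤ i ≤ j < n - i

module Folding {c ℓ} (A : CommutativeRing c ℓ) where
  open import Data.Nat.Base using (_<_; _≤_)
  open import Data.Nat.Properties using (_≟_)
  open CommutativeRing A
  open Sums A
  open DifferenceSums A
  open Algebra.Properties.Semiring.Mult semiring using () renaming (_×_ to _·_)
  open IntegerSolver A using (solve; _:=_; _:+_; _:*_; _:-_; :-_; con)
  open Relation.Binary.Reasoning.Setoid setoid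

  Below : ℕ → ℕ → ℕ → Set
  Below n i j = 1 ≤ i × i ≤ j × j < n ∸ i

  below? : ∀ n i j → Dec (Below n i j)
  below? n i j = (1 ≤? i) ×-dec (i ≤? j) ×-dec (j <? n ∸ i)

  -- The outer 2 stands for the index pair and its reflection (n - i , n - j), the factor 2 - δ for
  -- the pair and its transpose, which coincide on the diagonal.
  weight : ℕ → ℕ → Carrier
  weight i j = 2 · 1# * (2 · 1# - δ i j · 1#)

  private
    [<]+[≡]+[>] : ∀ i j → 1# ≈ [ i <? j ] + ([ i ≟ j ] + [ j <? i ])
    [<]+[≡]+[>] i j with ℕₚ.<-cmp i j
    ... | tri< i<j i≢j j≮i = sym (trans (+-cong ([]-yes (i <? j) i<j) (+-cong ([]-no (i ≟ j) i≢j) ([]-no (j <? i) j≮i)))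
      (trans (+-congˡ (+-identityˡ 0#)) (+-identityʳ 1#)))
    ... | tri≈ i≮j i≡j j≮i = sym (trans (+-cong ([]-no (i <? j) i≮j) (+-cong ([]-yes (i ≟ j) i≡j) ([]-no (j <? i) j≮i)))
      (trans (+-identityˡ _) (+-identityʳ 1#)))
    ... | tri> i≮j i≢j j<i = sym (trans (+-cong ([]-no (i <? j) i≮j) (+-cong ([]-no (i ≟ j) i≢j) ([]-yes (j <? i) j<i)))
      (trans (+-identityˡ _) (+-identityˡ 1#)))

    -- Each pair off the diagonal is counted twice and each diagonal pair once.
    split-< : ∀ i j → [ i <? j ] + [ i <? j ] + [ i ≟ j ] ≈ [ i ≤? j ] * (2 · 1# - δ i j · 1#)
    split-< i j with ℕₚ.<-cmp i j
    ... | tri< i<j i≢j _ = trans (+-cong (+-cong ([]-yes (i <? j) i<j) ([]-yes (i <? j) i<j)) ([]-no (i ≟ j) i≢j))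
      (sym (trans (*-cong ([]-yes (i ≤? j) (ℕₚ.<⇒≤ i<j)) (+-congˡ (-‿cong (reflexive (≡.cong (_· 1#) (δ-≢ i≢j))))))
        (solve 0 (con (+ 1) :* ((con (+ 1) :+ (con (+ 1) :+ con (+ 0))) :- con (+ 0)) := (con (+ 1) :+ con (+ 1)) :+ con (+ 0)) refl)))
      where
      δ-≢ : ∀ {i j} → i ≢ j → δ i j ≡ 0
      δ-≢ {i} {j} i≢j rewrite dec-false (i ≟ j) i≢j = ≡.refl
    ... | tri≈ i≮j ≡.refl _ = trans (+-cong (+-cong ([]-no (i <? i) i≮j) ([]-no (i <? i) i≮j)) ([]-yes (i ≟ i) ≡.refl))
      (sym (trans (*-cong ([]-yes (i ≤? i) ℕₚ.≤-refl) (+-congˡ (-‿cong (reflexive (≡.cong (_· 1#) δ-refl)))))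
        (solve 0 (con (+ 1) :* ((con (+ 1) :+ (con (+ 1) :+ con (+ 0))) :- (con (+ 1) :+ con (+ 0))) := (con (+ 0) :+ con (+ 0)) :+ con (+ 1)) refl)))
      where
      δ-refl : δ i i ≡ 1
      δ-refl rewrite dec-true (i ≟ i) ≡.refl = ≡.refl
    ... | tri> i≮j i≢j j<i = trans (+-cong (+-cong ([]-no (i <? j) i≮j) ([]-no (i <? j) i≮j)) ([]-no (i ≟ j) i≢j))
      (trans (trans (+-congʳ (+-identityˡ 0#)) (+-identityˡ 0#)) (sym (trans (*-congʳ ([]-no (i ≤? j) (ℕₚ.<⇒≱ j<i))) (zeroˡ _))))

  module _ (m : ℕ) (τ : ℕ → ℕ → Carrier) {b : Carrier}
    (symmetric    : ∀ u v → τ u v ≈ τ v u)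
    (edge         : Σ m (λ u → τ (suc u) 0) ≈ b)
    (antidiagonal : ∀ u → 0 < u → u < suc m → τ u (suc m ∸ u) ≈ τ u 0)
    (reflection   : ∀ u v → 0 < u → u < suc m → 0 < v → v < suc m → τ (suc m ∸ u) (suc m ∸ v) ≈ τ u v) where

    private
      n : ℕ
      n = suc m

      -- The inner square 1 ≤ u , v < n, with both indices lowered by one; it is cut below according
      -- to whether u + v is less than, equal to or greater than n.
      σ : ℕ → ℕ → Carrier
      σ u v = τ (suc u) (suc v)

      low middle high : Carrier
      low    = Σ² m λ u v → [ suc u ℕ.+ suc v <? n ] * σ u v
      middle = Σ² m λ u v → [ suc u ℕ.+ suc v ≟ n ] * σ u v
      high   = Σ² m λ u v → [ n <? suc u ℕ.+ suc v ] * σ u v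

      Σ²-distrib-+ : ∀ (f g : ℕ → ℕ → Carrier) → Σ² m (λ u v → f u v + g u v) ≈ Σ² m f + Σ² m g
      Σ²-distrib-+ f g = trans (Σ-cong m λ u _ → Σ-distrib-+ m (f u) (g u)) (Σ-distrib-+ m _ _)

      split : Σ² m σ ≈ low + (middle + high)
      split = begin
        Σ² m σ                      ≈⟨ Σ²-cong m (λ u v _ _ → pointwise u v) ⟩
        Σ² m (λ u v → [ suc u ℕ.+ suc v <? n ] * σ u v + ([ suc u ℕ.+ suc v ≟ n ] * σ u v + [ n <? suc u ℕ.+ suc v ] * σ u v))
                                    ≈⟨ trans (Σ²-distrib-+ _ _) (+-congˡ (Σ²-distrib-+ _ _)) ⟩
        low + (middle + high)       ∎
        where
        pointwise : ∀ u v → σ u v ≈ [ suc u ℕ.+ suc v <? n ] * σ u v + ([ suc u ℕ.+ suc v ≟ n ] * σ u v + [ n <? suc u ℕ.+ suc v ] * σ u v)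
        pointwise u v = trans (sym (*-identityˡ _)) (trans (*-congʳ ([<]+[≡]+[>] (suc u ℕ.+ suc v) n))
          (solve 4 (λ x y z s → (x :+ (y :+ z)) :* s := x :* s :+ (y :* s :+ z :* s)) refl _ _ _ (σ u v)))

      n∸suc : ∀ {u} → u < m → suc (m ∸ suc u) ≡ m ∸ u
      n∸suc u<m = ≡.sym (ℕₚ.+-∸-assoc 1 u<m)

      -- Each u meets the antidiagonal once. There the value equals the one on the edge v = 0, so
      -- the edge sum appears. The witness `m ∸ suc u` is the lowered index of n - u.
      middle≈b : middle ≈ b
      middle≈b = trans (Σ-cong m λ u u<m → trans
        (Σ-only (λ v → suc u ℕ.+ suc v ≟ n) (σ u) (m ∸ suc u) (ℕₚ.∸-monoʳ-< (s≤s z≤n) u<m)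
          (≡.trans (≡.cong (suc u ℕ.+_) (n∸suc u<m)) (≡.cong suc (ℕₚ.m+[n∸m]≡n (ℕₚ.<⇒≤ u<m))))
          λ v _ eq → ℕₚ.suc-injective (ℕₚ.+-cancelˡ-≡ (suc u) _ _
            (≡.trans eq (≡.sym (≡.trans (≡.cong (suc u ℕ.+_) (n∸suc u<m)) (≡.cong suc (ℕₚ.m+[n∸m]≡n (ℕₚ.<⇒≤ u<m))))))))
        (trans (reflexive (≡.cong (τ (suc u)) (n∸suc u<m))) (antidiagonal (suc u) (s≤s z≤n) (s≤s u<m)))) edge

      -- The pair (n - u , n - v) has sum 2n - (u + v), so reversing both sums exchanges the two
      -- sides of the antidiagonal.
      high≈low : high ≈ low
      high≈low = begin
        high                                                   ≈⟨ Σ-reverse m (λ u → Σ m (H u)) ⟨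
        Σ m (λ u → Σ m (H (m ∸ suc u)))                        ≈⟨ Σ-cong m (λ u _ → Σ-reverse m (H (m ∸ suc u))) ⟨
        Σ² m (λ u v → H (m ∸ suc u) (m ∸ suc v))               ≈⟨ Σ²-cong m pointwise ⟩
        low                                                    ∎
        where
        H : ℕ → ℕ → Carrier
        H u v = [ n <? suc u ℕ.+ suc v ] * σ u v
        complement : ∀ {u v} → u < m → v < m → (n < (m ∸ u) ℕ.+ (m ∸ v) → suc u ℕ.+ suc v < n) × (suc u ℕ.+ suc v < n → n < (m ∸ u) ℕ.+ (m ∸ v))
        complement {u} {v} u<m v<m =
          (λ n<x → ℕₚ.+-cancelʳ-< n _ n (ℕₚ.<-≤-trans (ℕₚ.+-monoʳ-< (suc u ℕ.+ suc v) n<x) (ℕₚ.≤-reflexive total))) ,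
          (λ y<n → ℕₚ.+-cancelˡ-< (suc u ℕ.+ suc v) n _ (ℕₚ.<-≤-trans (ℕₚ.+-monoˡ-< n y<n) (ℕₚ.≤-reflexive (≡.sym total))))
          where
          total : (suc u ℕ.+ suc v) ℕ.+ ((m ∸ u) ℕ.+ (m ∸ v)) ≡ n ℕ.+ n
          total = ≡.trans (ℕₚ.+-assoc (suc u) (suc v) _) (≡.trans (≡.cong (suc u ℕ.+_) (≡.trans (≡.sym (ℕₚ.+-assoc (suc v) (m ∸ u) _))
            (≡.trans (≡.cong (ℕ._+ (m ∸ v)) (ℕₚ.+-comm (suc v) (m ∸ u))) (ℕₚ.+-assoc (m ∸ u) (suc v) _))))
            (≡.trans (≡.sym (ℕₚ.+-assoc (suc u) (m ∸ u) _)) (≡.cong₂ ℕ._+_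
              (≡.cong suc (ℕₚ.m+[n∸m]≡n (ℕₚ.<⇒≤ u<m))) (≡.cong suc (ℕₚ.m+[n∸m]≡n (ℕₚ.<⇒≤ v<m))))))
        pointwise : ∀ u v → u < m → v < m → H (m ∸ suc u) (m ∸ suc v) ≈ [ suc u ℕ.+ suc v <? n ] * σ u v
        pointwise u v u<m v<m = begin
          [ n <? suc (m ∸ suc u) ℕ.+ suc (m ∸ suc v) ] * τ (suc (m ∸ suc u)) (suc (m ∸ suc v))
            ≈⟨ reflexive (≡.cong₂ (λ x y → [ n <? x ℕ.+ y ] * τ x y) (n∸suc u<m) (n∸suc v<m)) ⟩
          [ n <? (m ∸ u) ℕ.+ (m ∸ v) ] * τ (m ∸ u) (m ∸ v)
            ≈⟨ *-cong ([]-⇔ (n <? _) (_ <? n) (proj₁ (complement u<m v<m)) (proj₂ (complement u<m v<m)))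
                      (reflection (suc u) (suc v) (s≤s z≤n) (s≤s u<m) (s≤s z≤n) (s≤s v<m)) ⟩
          [ suc u ℕ.+ suc v <? n ] * σ u v ∎

      G : ℕ → ℕ → Carrier
      G i j = [ below? n i j ] * (weight i j * τ i j)

      -- The second copy is what `high` has become. In each copy the part v < u is transposed onto u
      -- < v, which leaves the part u < v twice and the diagonal once.
      low+low : low + low ≈ Σ² m λ u v → G (suc u) (suc v)
      low+low = begin
        low + low
          ≈⟨ +-cong low-split low-split ⟩
        (Σ² m (λ u v → f u v * [ u <? v ]) + Σ² m (λ u v → f u v * ([ u ≟ v ] + [ v <? u ])))
          + (Σ² m (λ u v → f u v * [ u <? v ]) + Σ² m (λ u v → f u v * ([ u ≟ v ] + [ v <? u ])))
          ≈⟨ +-cong fold fold ⟩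
        Σ² m (λ u v → f u v * ([ u <? v ] + [ u <? v ] + [ u ≟ v ])) + Σ² m (λ u v → f u v * ([ u <? v ] + [ u <? v ] + [ u ≟ v ]))
          ≈⟨ Σ²-distrib-+ _ _ ⟨
        Σ² m (λ u v → f u v * ([ u <? v ] + [ u <? v ] + [ u ≟ v ]) + f u v * ([ u <? v ] + [ u <? v ] + [ u ≟ v ]))
          ≈⟨ Σ²-cong m (λ u v _ _ → pointwise u v) ⟩
        Σ² m (λ u v → G (suc u) (suc v)) ∎
        where
        f : ℕ → ℕ → Carrier
        f u v = [ suc u ℕ.+ suc v <? n ] * σ u v
        f-sym : ∀ u v → f u v ≈ f v u
        f-sym u v = *-cong (reflexive (≡.cong (λ x → [ x <? n ]) (ℕₚ.+-comm (suc u) (suc v)))) (symmetric (suc u) (suc v))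
        low-split : low ≈ Σ² m (λ u v → f u v * [ u <? v ]) + Σ² m (λ u v → f u v * ([ u ≟ v ] + [ v <? u ]))
        low-split = trans (Σ²-cong m λ u v _ _ → trans (sym (*-identityʳ _)) (trans (*-congˡ ([<]+[≡]+[>] u v)) (distribˡ _ _ _)))
          (Σ²-distrib-+ _ _)
        swap : Σ² m (λ u v → f u v * [ v <? u ]) ≈ Σ² m (λ u v → f u v * [ u <? v ])
        swap = trans (Σ-comm m m _) (Σ²-cong m λ u v _ _ → *-congʳ (f-sym v u))
        fold : Σ² m (λ u v → f u v * [ u <? v ]) + Σ² m (λ u v → f u v * ([ u ≟ v ] + [ v <? u ]))
             ≈ Σ² m (λ u v → f u v * ([ u <? v ] + [ u <? v ] + [ u ≟ v ]))
        fold = begin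
          X + Σ² m (λ u v → f u v * ([ u ≟ v ] + [ v <? u ]))
            ≈⟨ +-congˡ (trans (Σ²-cong m λ u v _ _ → distribˡ _ _ _) (trans (Σ²-distrib-+ _ _) (+-congˡ swap))) ⟩
          X + (Σ² m (λ u v → f u v * [ u ≟ v ]) + X)
            ≈⟨ solve 2 (λ x y → x :+ (y :+ x) := (x :+ x) :+ y) refl X _ ⟩
          (X + X) + Σ² m (λ u v → f u v * [ u ≟ v ])
            ≈⟨ trans (Σ²-distrib-+ _ _) (+-congʳ (Σ²-distrib-+ _ _)) ⟨
          Σ² m (λ u v → f u v * [ u <? v ] + f u v * [ u <? v ] + f u v * [ u ≟ v ])
            ≈⟨ Σ²-cong m (λ u v _ _ → trans (+-congʳ (sym (distribˡ _ _ _))) (sym (distribˡ _ _ _))) ⟩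
          Σ² m (λ u v → f u v * ([ u <? v ] + [ u <? v ] + [ u ≟ v ])) ∎
          where
          X : Carrier
          X = Σ² m (λ u v → f u v * [ u <? v ])
        below-⇔ : ∀ u v → [ below? n (suc u) (suc v) ] ≈ [ suc u ℕ.+ suc v <? n ] * [ u ≤? v ]
        below-⇔ u v = trans ([]-⇔ (below? n (suc u) (suc v)) ((suc u ℕ.+ suc v <? n) ×-dec (u ≤? v))
          -- The subtraction does not truncate here: with `m ∸ u` equal to 0 no index could lie
          -- below it.
          (λ (_ , su≤sv , v<n∸u) → ℕₚ.<-≤-trans (ℕₚ.+-monoʳ-< (suc u) v<n∸u)
             (ℕₚ.≤-reflexive (ℕₚ.m+[n∸m]≡n {suc u} {n} (s≤s (ℕₚ.<⇒≤ (ℕₚ.m∸n≢0⇒n<m {m} {u} λ n∸u≡0 → contradiction (≡.subst (suc v <_) n∸u≡0 v<n∸u) λ ()))))) , ℕₚ.≤-pred su≤sv)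
          (λ (u+v<n , u≤v) → s≤s z≤n , s≤s u≤v , ℕₚ.m+n≤o⇒m≤o∸n (suc (suc v))
             (ℕₚ.≤-trans (ℕₚ.≤-reflexive (≡.cong suc (ℕₚ.+-comm (suc v) (suc u)))) u+v<n)))
          ([]-× (suc u ℕ.+ suc v <? n) (u ≤? v))
        pointwise : ∀ u v → f u v * ([ u <? v ] + [ u <? v ] + [ u ≟ v ]) + f u v * ([ u <? v ] + [ u <? v ] + [ u ≟ v ]) ≈ G (suc u) (suc v)
        pointwise u v = begin
          f u v * ([ u <? v ] + [ u <? v ] + [ u ≟ v ]) + f u v * ([ u <? v ] + [ u <? v ] + [ u ≟ v ])
            ≈⟨ +-cong (*-congˡ (split-< u v)) (*-congˡ (split-< u v)) ⟩
          f u v * ([ u ≤? v ] * d) + f u v * ([ u ≤? v ] * d)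
            ≈⟨ solve 4 (λ a s i d → a :* s :* (i :* d) :+ a :* s :* (i :* d)
                 := a :* i :* ((con (+ 1) :+ (con (+ 1) :+ con (+ 0))) :* d :* s)) refl [ suc u ℕ.+ suc v <? n ] (σ u v) [ u ≤? v ] d ⟩
          [ suc u ℕ.+ suc v <? n ] * [ u ≤? v ] * (2 · 1# * d * σ u v)
            ≈⟨ *-congʳ (below-⇔ u v) ⟨
          G (suc u) (suc v) ∎
          where
          d : Carrier
          -- On successors `δ` computes to its value at u and v, so this is the second factor of
          -- `weight (suc u) (suc v)`.
          d = 2 · 1# - δ u v · 1#

      Σ²-G : Σ² n G ≈ Σ² m λ u v → G (suc u) (suc v)
      Σ²-G = trans (+-cong (Σ-0 n λ j _ → trans (*-congʳ {weight 0 j * τ 0 j} ([]-no (below? n 0 j) λ ())) (zeroˡ _))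
        (Σ-cong m λ u _ → trans (+-congʳ (trans (*-congʳ ([]-no (below? n (suc u) 0) λ ())) (zeroˡ _))) (+-identityˡ _)))
        (+-identityˡ _)

    -- The three `b` come from the row u = 0, the column v = 0 and the antidiagonal; the last sum is
    -- `low` together with its reflected copy.
    fold-sum : Σ² n τ ≈ τ 0 0 + (b + b + b) + Σ² n G
    fold-sum = begin
      (τ 0 0 + Σ m (λ v → τ 0 (suc v))) + Σ m (λ u → τ (suc u) 0 + Σ m (σ u))
        ≈⟨ +-cong (+-congˡ (trans (Σ-cong m λ v _ → symmetric 0 (suc v)) edge)) (trans (Σ-distrib-+ m _ _) (+-cong edge split)) ⟩
      (τ 0 0 + b) + (b + (low + (middle + high)))
        ≈⟨ +-congˡ (+-congˡ (+-congˡ (+-cong middle≈b high≈low))) ⟩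
      (τ 0 0 + b) + (b + (low + (b + low)))
        ≈⟨ solve 3 (λ t b l → (t :+ b) :+ (b :+ (l :+ (b :+ l))) := (t :+ (b :+ b :+ b)) :+ (l :+ l)) refl (τ 0 0) b low ⟩
      (τ 0 0 + (b + b + b)) + (low + low)
        ≈⟨ +-congˡ (trans low+low (sym Σ²-G)) ⟩
      τ 0 0 + (b + b + b) + Σ² n G ∎

  -- Here the edge sum includes the corner u = 0, as it does when it arises from sums over all
  -- characters; the corner is cancelled before folding.
  fold-symmetric : ∀ n .{{_ : NonZero n}} (τ : ℕ → ℕ → Carrier) {b : Carrier} →
    (∀ u v → τ u v ≈ τ v u) →
    Σ n (λ u → τ u 0) ≈ τ 0 0 + b →
    (∀ u → 0 < u → u < n → τ u (n ∸ u) ≈ τ u 0) →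
    (∀ u v → 0 < u → u < n → 0 < v → v < n → τ (n ∸ u) (n ∸ v) ≈ τ u v) →
    Σ² n τ ≈ τ 0 0 + (b + b + b) + Σ² n (λ i j → [ below? n i j ] * (weight i j * τ i j))
  fold-symmetric (suc m) τ symmetric edge = fold-sum m τ symmetric (+-cancelˡ (τ 0 0) _ _ edge)
    where open import Algebra.Properties.Ring ring using (+-cancelˡ)

module _ {n ℓ} {P : Pred (Fin n) ℓ} (P? : Decidable P) where

  ∈-comprehension⁺ : ∀ {x} → P x → x ∈ comprehension P?
  ∈-comprehension⁺ {x} p = lookup⇒[]= x (comprehension P?) (≡.trans (lookup∘tabulate _ x) (dec-true (P? x) p))

  ∈-comprehension⁻ : ∀ {x} → x ∈ comprehension P? → P x
  ∈-comprehension⁻ {x} x∈ with P? x | ≡.trans (≡.sym (lookup∘tabulate (does ∘ P?) x)) ([]=⇒lookup x∈)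
  ... | yes p | _  = p
  ... | no _  | ()

-- Conjugation, norms and roots of unity

module ComplexRoots {c ℓ₁ ℓ₂} (R : Reals c ℓ₁ ℓ₂) where
  open Complex R
  open ComplexRing R
  open OrderedField R
  private
    module ℝ = CommutativeRing (Reals.commutativeRing R)
    module ℂᵣ = CommutativeRing ℂ-commutativeRing
  open Sums ℂ-commutativeRing using (Σ; [_])
  open IntegerSolver (Reals.commutativeRing R) using (solve; _:=_; _:+_; _:*_; _:-_; :-_; con)
  open Algebra.Properties.Semiring.Exp ℝ.semiring using () renaming (_^_ to _^ᴿ_)
  open DifferenceSums ℂ-commutativeRing using (D; K; geometric)

  conj : ℂ → ℂ
  conj (x +i y) = x +i (-ᴿ y)

  conj-cong : ∀ {z w} → z ≈ w → conj z ≈ conj w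
  conj-cong (mk≈ a b) = mk≈ a (ℝ.-‿cong b)

  conj-0 : conj 0ᶜ ≈ 0ᶜ
  conj-0 = mk≈ ℝ.refl -0≈0

  conj-1 : conj 1ᶜ ≈ 1ᶜ
  conj-1 = mk≈ ℝ.refl -0≈0

  conj-+ : ∀ z w → conj (z + w) ≈ conj z + conj w
  conj-+ (x +i y) (u +i v) = mk≈ ℝ.refl (solve 2 (λ y v → :- (y :+ v) := :- y :+ :- v) ℝ.refl y v)

  conj-* : ∀ z w → conj (z * w) ≈ conj z * conj w
  conj-* (x +i y) (u +i v) = mk≈
    (solve 4 (λ x y u v → x :* u :- y :* v := x :* u :- :- y :* :- v) ℝ.refl x y u v)
    (solve 4 (λ x y u v → :- (x :* v :+ y :* u) := x :* :- v :+ :- y :* u) ℝ.refl x y u v)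

  conj-^ : ∀ z k → conj (z ^ k) ≈ conj z ^ k
  conj-^ z zero    = conj-1
  conj-^ z (suc k) = ℂᵣ.trans (conj-* z (z ^ k)) (ℂᵣ.*-congˡ {conj z} (conj-^ z k))

  conj-Σ : ∀ N f → conj (Σ N f) ≈ Σ N (λ k → conj (f k))
  conj-Σ zero    f = conj-0
  conj-Σ (suc N) f = ℂᵣ.trans (conj-+ (f 0) _) (ℂᵣ.+-congˡ {conj (f 0)} (conj-Σ N (λ k → f (suc k))))

  conj-[] : ∀ {p} {P : Set p} (P? : Dec P) → conj [ P? ] ≈ [ P? ]
  conj-[] (yes _) = conj-1
  conj-[] (no _)  = conj-0

  -- The square of the absolute value, which avoids square roots and remains multiplicative.
  norm : ℂ → ℝ
  norm (x +i y) = x *ᴿ x +ᴿ y *ᴿ y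

  norm-cong : ∀ {z w} → z ≈ w → norm z ≈ᴿ norm w
  norm-cong (mk≈ a b) = ℝ.+-cong (ℝ.*-cong a a) (ℝ.*-cong b b)

  norm-1 : norm 1ᶜ ≈ᴿ 1ᴿ
  norm-1 = solve 0 (con (+ 1) :* con (+ 1) :+ con (+ 0) :* con (+ 0) := con (+ 1)) ℝ.refl

  norm-* : ∀ z w → norm (z * w) ≈ᴿ norm z *ᴿ norm w
  norm-* (x +i y) (u +i v) = solve 4 (λ x y u v →
    (x :* u :- y :* v) :* (x :* u :- y :* v) :+ (x :* v :+ y :* u) :* (x :* v :+ y :* u)
      := (x :* x :+ y :* y) :* (u :* u :+ v :* v)) ℝ.refl x y u v

  norm-^ : ∀ z k → norm (z ^ k) ≈ᴿ norm z ^ᴿ k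
  norm-^ z zero    = norm-1
  norm-^ z (suc k) = ℝ.trans (norm-* z (z ^ k)) (ℝ.*-congˡ (norm-^ z k))

  *-conj : ∀ z → z * conj z ≈ ofReal (norm z)
  *-conj (x +i y) = mk≈
    (solve 2 (λ x y → x :* x :- y :* :- y := x :* x :+ y :* y) ℝ.refl x y)
    (solve 2 (λ x y → x :* :- y :+ y :* x := con (+ 0)) ℝ.refl x y)

  norm≈0 : ∀ {z} → norm z ≈ᴿ 0ᴿ → z ≈ 0ᶜ
  norm≈0 eq = mk≈ (sum-squares≈0 eq) (sum-squares≈0 (ℝ.trans (ℝ.+-comm _ _) eq))

  -- The norm is multiplicative and vanishes only at 0, so cancellation can take place in ℝ.
  ≉0⇒*-cancelˡᶜ : ∀ {z w} → ¬ (z ≈ 0ᶜ) → z * w ≈ 0ᶜ → w ≈ 0ᶜ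
  ≉0⇒*-cancelˡᶜ {z} {w} z≉0 zw≈0 = norm≈0 (≉0⇒*-cancelˡ (z≉0 ∘ norm≈0)
    (ℝ.trans (ℝ.sym (norm-* z w)) (ℝ.trans (norm-cong zw≈0) (solve 0 (con (+ 0) :* con (+ 0) :+ con (+ 0) :* con (+ 0) := con (+ 0)) ℝ.refl))))

  private
    pow≤ : ∀ {x} → 0ᴿ ≤ x → x ≤ 1ᴿ → ∀ k → (0ᴿ ≤ x ^ᴿ k) × (x ^ᴿ k ≤ 1ᴿ)
    pow≤ 0≤x x≤1 zero    = <⇒≤ (Reals.0<1 R) , ≤-reflexive ℝ.refl
    pow≤ 0≤x x≤1 (suc k) with 0≤xᵏ , xᵏ≤1 ← pow≤ 0≤x x≤1 k = *-nonneg 0≤x 0≤xᵏ ,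
      ≤-trans (≤-resp-≈ ℝ.refl (ℝ.*-identityʳ _) (*-monoʳ-≤ 0≤x xᵏ≤1)) x≤1

    1≤pow : ∀ {x} → 1ᴿ ≤ x → ∀ k → 1ᴿ ≤ x ^ᴿ k
    1≤pow 1≤x zero    = ≤-reflexive ℝ.refl
    1≤pow 1≤x (suc k) = ≤-trans 1≤x (≤-resp-≈ (ℝ.*-identityʳ _) ℝ.refl
      (*-monoʳ-≤ (≤-trans (<⇒≤ (Reals.0<1 R)) 1≤x) (1≤pow 1≤x k)))

  -- For x < 1 the power is at most x, for x > 1 it is at least x; both contradict the value 1, and
  -- tightness concludes.
  nonneg-root : ∀ {x} n .{{_ : NonZero n}} → 0ᴿ ≤ x → x ^ᴿ n ≈ᴿ 1ᴿ → x ≈ᴿ 1ᴿ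
  nonneg-root {x} (suc n) 0≤x xⁿ≈1 = Reals.<-tight R
    (λ x<1 → ≤-resp-≈ xⁿ≈1 (ℝ.*-identityʳ x) (*-monoʳ-≤ 0≤x (proj₂ (pow≤ 0≤x (<⇒≤ x<1) n))) x<1)
    (λ 1<x → ≤-resp-≈ (ℝ.*-identityʳ x) xⁿ≈1 (*-monoʳ-≤ 0≤x (1≤pow (<⇒≤ 1<x) n)) 1<x)

  -- The norm is a nonnegative real whose n-th power is 1, hence it is 1. This makes the conjugate
  -- an inverse.
  root*conj : ∀ {z} n .{{_ : NonZero n}} → z ^ n ≈ 1ᶜ → z * conj z ≈ 1ᶜ
  root*conj {z@(x +i y)} n zⁿ≈1 = ℂᵣ.trans (*-conj z) (mk≈
    (nonneg-root n (+-nonneg (square-nonneg x) (square-nonneg y)) (ℝ.trans (ℝ.sym (norm-^ z n)) (ℝ.trans (norm-cong zⁿ≈1) norm-1))) ℝ.refl)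

  root-sum : ∀ {N ω} → ω ^ N ≈ 1ᶜ → ¬ (ω ≈ 1ᶜ) → Σ N (ω ^_) ≈ 0ᶜ
  root-sum {N} {ω} ωᴺ≈1 ω≉1 = ≉0⇒*-cancelˡᶜ (ω≉1 ∘ x∙y⁻¹≈ε⇒x≈y ω 1ᶜ)
    (+-cancelʳ 1ᶜ _ _ (ℂᵣ.trans (geometric N ω) (ℂᵣ.trans ωᴺ≈1 (ℂᵣ.sym (ℂᵣ.+-identityˡ 1ᶜ)))))
    where open Algebra.Properties.Ring ℂᵣ.ring using (+-cancelʳ; x∙y⁻¹≈ε⇒x≈y)

  conj-K : ∀ {m} .{{_ : NonZero m}} (g : ℤ/ m) N θ u v → conj (K g N θ u v) ≈ K g N (conj θ) u v
  conj-K g N θ u v = ℂᵣ.trans (conj-Σ N _) (Sums.Σ-cong ℂ-commutativeRing N λ j _ →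
    ℂᵣ.trans (conj-Σ N _) (Sums.Σ-cong ℂ-commutativeRing N λ k _ →
      ℂᵣ.trans (conj-* (D g j k) _) (ℂᵣ.*-cong (conj-[] (g ^ₘ j Finₚ.≟ _))
        (ℂᵣ.trans (conj-* _ _) (ℂᵣ.*-cong (power j u) (power k v))))))
    where
    open Algebra.Properties.Semiring.Exp ℂᵣ.semiring using (^-congˡ)
    power : ∀ j u → conj ((θ ^ j) ^ u) ≈ (conj θ ^ j) ^ u
    power j u = ℂᵣ.trans (conj-^ (θ ^ j) u) (^-congˡ u (conj-^ θ j))

-- Sets of powers as sums over exponents, and detection by orthogonality

module PowerSums {c ℓ} (A : CommutativeRing c ℓ) where
  open CommutativeRing A
  open Sums A
  open DifferenceSums A
  open Algebra.Properties.Semiring.Exp semiring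
  open Algebra.Properties.Semiring.Mult semiring using () renaming (_×_ to _·_)
  open IntegerSolver A using (solve; _:=_; _:*_)
  open Relation.Binary.Reasoning.Setoid setoid

  sum-Σ-comm : ∀ {M} N (f : Fin M → ℕ → Carrier) → sum (λ x → Σ N (f x)) ≈ Σ N (λ j → sum (λ x → f x j))
  sum-Σ-comm {M} zero    f = sum-replicate-zero M
  sum-Σ-comm {M} (suc N) f = trans (∑-distrib-+ (λ x → f x 0) (λ x → Σ N (λ j → f x (suc j))))
    (+-congˡ (sum-Σ-comm N λ x j → f x (suc j)))

  sum-sift : ∀ {M} N (G : ℕ → Fin M) (F : Fin M → Carrier) →
             sum (λ x → Σ N (λ j → [ G j Finₚ.≟ x ]) * F x) ≈ Σ N (λ j → F (G j))
  sum-sift N G F = begin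
    sum (λ x → Σ N (λ j → [ G j Finₚ.≟ x ]) * F x)   ≈⟨ sum-cong-≋ (λ x → *-distribʳ-Σ N (F x) _) ⟩
    sum (λ x → Σ N (λ j → [ G j Finₚ.≟ x ] * F x))   ≈⟨ sum-Σ-comm N (λ x j → [ G j Finₚ.≟ x ] * F x) ⟩
    Σ N (λ j → sum (λ x → [ G j Finₚ.≟ x ] * F x))   ≈⟨ Σ-cong N (λ j _ → sum-≟ (G j) F) ⟩
    Σ N (λ j → F (G j))                              ∎

  module _ {m : ℕ} .{{_ : NonZero m}} {g : ℤ/ m} {N : ℕ} .{{_ : NonZero N}} (order : Order g N) where
    open Order order

    -- The decision is left free so that the same count serves a decidable membership and, through
    -- the unit type, an element already known to be a power.
    Σ-powers : ∀ {q} {Q : Set q} x (Q? : Dec Q) → (x ∈⟨ g ⟩ → Q) → (Q → x ∈⟨ g ⟩) → Σ N (λ j → [ g ^ₘ j Finₚ.≟ x ]) ≈ [ Q? ]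
    Σ-powers x Q? to from = Σ-∃ N (λ j → g ^ₘ j Finₚ.≟ x) Q?
      (λ j k j<N k<N p q → injective j<N k<N (≡.trans p (≡.sym q)))
      (λ j _ p → to (j , p))
      (λ q → let j , g^j≡x = from q in j % N , m%n<n j N , ≡.trans (^ₘ-% g power≡1 j) g^j≡x)

  module _ {q n : ℕ} .{{_ : NonZero q}} .{{_ : NonZero n}} {β : ℤ/ q} (unit : IsUnit β) (ord : HasOrder β n) where
    open IntegerSolver (ℤ/-commutativeRing {q}) using () renaming (solve to solveₘ; _:=_ to _:=ₘ_; _:+_ to _:+ₘ_; _:-_ to _:-ₘ_)

    -- An element b of the set has unique exponents s and t below n with b = βˢ and b - 1 = βᵗ, so
    -- the set is parametrised by the solutions of βˢ = βᵗ + 1.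
    consecutive-sum : ∀ (F : ℤ/ q → Carrier) →
      sum (λ b → [ b ∈? consecutive ord ] * F b) ≈ Σ² n λ s t → D β s t * F (β ^ₘ s)
    consecutive-sum F = begin
      sum (λ b → [ b ∈? consecutive ord ] * F b)
        ≈⟨ sum-cong-≋ (λ b → trans (*-congʳ (indicator b)) (*-assoc _ _ _)) ⟩
      sum (λ b → Σ n (λ s → [ β ^ₘ s Finₚ.≟ b ]) * (Σ n (λ t → [ β ^ₘ t Finₚ.≟ b -ₘ 1ₘ ]) * F b))
        ≈⟨ sum-sift n (β ^ₘ_) _ ⟩
      Σ n (λ s → Σ n (λ t → [ β ^ₘ t Finₚ.≟ β ^ₘ s -ₘ 1ₘ ]) * F (β ^ₘ s))
        ≈⟨ Σ-cong n (λ s _ → trans (*-distribʳ-Σ n _ _) (Σ-cong n λ t _ → *-congʳ ([]-⇔ (β ^ₘ t Finₚ.≟ _) (β ^ₘ s Finₚ.≟ _)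
             (λ eq → ≡.trans (solveₘ 2 (λ x o → x :=ₘ (x :-ₘ o) :+ₘ o) ≡.refl (β ^ₘ s) 1ₘ) (≡.cong (_+ₘ 1ₘ) (≡.sym eq)))
             (λ eq → ≡.trans (solveₘ 2 (λ y o → y :=ₘ (y :+ₘ o) :-ₘ o) ≡.refl (β ^ₘ t) 1ₘ) (≡.cong (_-ₘ 1ₘ) (≡.sym eq)))))) ⟩
      Σ² n (λ s t → D β s t * F (β ^ₘ s)) ∎
      where
      indicator : ∀ b → [ b ∈? consecutive ord ] ≈ Σ n (λ s → [ β ^ₘ s Finₚ.≟ b ]) * Σ n (λ t → [ β ^ₘ t Finₚ.≟ b -ₘ 1ₘ ])
      indicator b = begin
        [ b ∈? consecutive ord ]
          ≈⟨ []-⇔ (b ∈? consecutive ord) (∈⟨ ord ⟩? b ×-dec ∈⟨ ord ⟩? (b -ₘ 1ₘ)) (∈-comprehension⁻ member?) (∈-comprehension⁺ member?) ⟩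
        [ ∈⟨ ord ⟩? b ×-dec ∈⟨ ord ⟩? (b -ₘ 1ₘ) ]
          ≈⟨ []-× (∈⟨ ord ⟩? b) (∈⟨ ord ⟩? (b -ₘ 1ₘ)) ⟩
        [ ∈⟨ ord ⟩? b ] * [ ∈⟨ ord ⟩? (b -ₘ 1ₘ) ]
          ≈⟨ *-cong (Σ-powers (HasOrder⇒Order β unit ord) b (∈⟨ ord ⟩? b) (λ x → x) (λ x → x))
                    (Σ-powers (HasOrder⇒Order β unit ord) (b -ₘ 1ₘ) (∈⟨ ord ⟩? (b -ₘ 1ₘ)) (λ x → x) (λ x → x)) ⟨
        Σ n (λ s → [ β ^ₘ s Finₚ.≟ b ]) * Σ n (λ t → [ β ^ₘ t Finₚ.≟ b -ₘ 1ₘ ]) ∎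
        where
        member? : Decidable (λ b → b ∈⟨ β ⟩ × (b -ₘ 1ₘ) ∈⟨ β ⟩)
        member? b = ∈⟨ ord ⟩? b ×-dec ∈⟨ ord ⟩? (b -ₘ 1ₘ)

  module _ {p q : ℕ} .{{_ : NonZero (p ℕ.* q)}} .{{_ : NonZero (p ∸ 1)}} {a : ℤ/ (p ℕ.* q)} (order : Order a (p ∸ 1)) where
    open Order order

    private
      P : ℕ
      P = p ∸ 1
      T : Subset (p ℕ.* q)
      T = S p q a
      power? : Decidable (λ x → ∃ λ (j : Fin P) → a ^ₘ toℕ j ≡ x)
      power? x = any? (λ j → a ^ₘ toℕ j Finₚ.≟ x)

    -- An element of the intersection is both aʲ and aᵏ + 1. The exponent range of `S` is a full
    -- period of a, which makes j and k unique.
    ∣S∩S+1∣ : ∣ T ∩ translate T ∣ · 1# ≈ Σ² P (D a)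
    ∣S∩S+1∣ = begin
      ∣ T ∩ translate T ∣ · 1#
        ≈⟨ ∣∣-sum (T ∩ translate T) ⟩
      sum (λ x → [ x ∈? (T ∩ translate T) ])
        ≈⟨ sum-cong-≋ (λ x → trans ([]-⇔ (x ∈? (T ∩ translate T)) ((x ∈? T) ×-dec (x ∈? translate T)) (x∈p∩q⁻ T _) x∈p∩q⁺)
             (trans ([]-× (x ∈? T) (x ∈? translate T)) (sym (*-cong (in-T x) (in-T+1 x))))) ⟩
      sum (λ x → Σ P (λ j → [ a ^ₘ j Finₚ.≟ x ]) * Σ P (λ k → [ a ^ₘ k +ₘ 1ₘ Finₚ.≟ x ]))
        ≈⟨ sum-sift P (a ^ₘ_) _ ⟩
      Σ² P (λ j k → [ a ^ₘ k +ₘ 1ₘ Finₚ.≟ a ^ₘ j ])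
        ≈⟨ Σ²-cong P (λ j k _ _ → []-⇔ (_ Finₚ.≟ a ^ₘ j) (a ^ₘ j Finₚ.≟ _) ≡.sym ≡.sym) ⟩
      Σ² P (D a) ∎
      where
      power∈T : ∀ j → j ℕ.< P → a ^ₘ j ∈ T
      power∈T j j<P = ∈-comprehension⁺ power? (fromℕ< j<P , ≡.cong (a ^ₘ_) (Finₚ.toℕ-fromℕ< j<P))
      in-T : ∀ x → Σ P (λ j → [ a ^ₘ j Finₚ.≟ x ]) ≈ [ x ∈? T ]
      in-T x = Σ-∃ P (λ j → a ^ₘ j Finₚ.≟ x) (x ∈? T)
        (λ j k j<P k<P p q → injective j<P k<P (≡.trans p (≡.sym q)))
        (λ j j<P eq → ≡.subst (_∈ T) eq (power∈T j j<P))
        (λ x∈T → let j , eq = ∈-comprehension⁻ power? x∈T in toℕ j , Finₚ.toℕ<n j , eq)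
      shift? : Decidable (λ x → ∃ λ s → s ∈ T × s +ₘ 1ₘ ≡ x)
      shift? x = any? (λ s → (s ∈? T) ×-dec (s +ₘ 1ₘ Finₚ.≟ x))
      in-T+1 : ∀ x → Σ P (λ k → [ a ^ₘ k +ₘ 1ₘ Finₚ.≟ x ]) ≈ [ x ∈? translate T ]
      in-T+1 x = Σ-∃ P (λ k → a ^ₘ k +ₘ 1ₘ Finₚ.≟ x) (x ∈? translate T)
        (λ j k j<P k<P p q → injective j<P k<P (+-cancelʳ 1ₘ _ _ (≡.trans p (≡.sym q))))
        (λ k k<P eq → ∈-comprehension⁺ shift? (a ^ₘ k , power∈T k k<P , eq))
        (λ x∈ → let s , s∈T , s+1≡x = ∈-comprehension⁻ shift? x∈
                    k , a^k≡s = ∈-comprehension⁻ power? s∈T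
                in toℕ k , Finₚ.toℕ<n k , ≡.trans (≡.cong (_+ₘ 1ₘ) a^k≡s) s+1≡x)
        where open Algebra.Properties.Ring (CommutativeRing.ring (ℤ/-commutativeRing {p ℕ.* q})) using (+-cancelʳ)

  module _ {p q : ℕ} .{{_ : NonZero p}} .{{_ : NonZero q}} (α : ℤ/ p) {β : ℤ/ q} {n : ℕ} .{{_ : NonZero n}} (order : Order β n)
    {ζ ξ : Carrier} (orthogonality : ∀ j s → Σ n (λ u → (ξ ^ s) ^ u * (ζ ^ j) ^ u) ≈ n · 1# * [ β ^ₘ j Finₚ.≟ β ^ₘ s ]) where

    -- After expansion the sums over u and v involve only the character values, and orthogonality
    -- turns them into n² times the conditions βʲ = βˢ and βᵏ = βᵗ. These single out one pair s , t
    -- below n and allow `D β s t` to be replaced by `D β j k`.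
    detect-powers : ∀ N → n · 1# * (n · 1#) * Σ² N (λ j k → D α j k * D β j k) ≈ Σ² n λ u v → K β n ξ u v * K α N ζ u v
    detect-powers N = sym (begin
      Σ² n (λ u v → K β n ξ u v * K α N ζ u v)
        ≈⟨ Σ²-cong n (λ u v _ _ → Σ²-*-Σ² n N _ _) ⟩
      Σ² n (λ u v → Σ² n λ s t → Σ² N λ j k → f u v s t j k)
        ≈⟨ Σ²-comm n n (λ u v s t → Σ² N λ j k → f u v s t j k) ⟩
      Σ² n (λ s t → Σ² n λ u v → Σ² N λ j k → f u v s t j k)
        ≈⟨ Σ²-cong n (λ s t _ _ → Σ²-comm n N λ u v j k → f u v s t j k) ⟩
      Σ² n (λ s t → Σ² N λ j k → Σ² n λ u v → f u v s t j k)
        ≈⟨ Σ²-comm n N (λ s t j k → Σ² n λ u v → f u v s t j k) ⟩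
      Σ² N (λ j k → Σ² n λ s t → Σ² n λ u v → f u v s t j k)
        ≈⟨ Σ²-cong N (λ j k _ _ → Σ²-cong n λ s t _ _ → characters s t j k) ⟩
      Σ² N (λ j k → Σ² n λ s t → (ν * ν * (D α j k * D β j k)) * (E j s * E k t))
        ≈⟨ Σ²-cong N (λ j k _ _ → collapse j k) ⟩
      Σ² N (λ j k → ν * ν * (D α j k * D β j k))
        ≈⟨ *-distribˡ-Σ² N (ν * ν) _ ⟨
      ν * ν * Σ² N (λ j k → D α j k * D β j k) ∎)
      where
      ν : Carrier
      ν = n · 1#
      E : ℕ → ℕ → Carrier
      E j s = [ β ^ₘ j Finₚ.≟ β ^ₘ s ]
      f : ℕ → ℕ → ℕ → ℕ → ℕ → ℕ → Carrier
      f u v s t j k = (D β s t * ((ξ ^ s) ^ u * (ξ ^ t) ^ v)) * (D α j k * ((ζ ^ j) ^ u * (ζ ^ k) ^ v))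
      E-replace : ∀ s t j k → D β s t * (E j s * E k t) ≈ D β j k * (E j s * E k t)
      E-replace s t j k = begin
        D β s t * (E j s * E k t)    ≈⟨ solve 3 (λ d x y → d :* (x :* y) := x :* (y :* d)) refl _ _ _ ⟩
        E j s * (E k t * D β s t)    ≈⟨ []-*-cong (β ^ₘ j Finₚ.≟ β ^ₘ s) (λ eq → []-*-cong (β ^ₘ k Finₚ.≟ β ^ₘ t) λ eq′ →
                                          reflexive (≡.cong₂ (λ x y → [ x Finₚ.≟ y +ₘ 1ₘ ]) (≡.sym eq) (≡.sym eq′))) ⟩
        E j s * (E k t * D β j k)    ≈⟨ solve 3 (λ d x y → d :* (x :* y) := x :* (y :* d)) refl _ _ _ ⟨
        D β j k * (E j s * E k t)    ∎
      characters : ∀ s t j k → Σ² n (λ u v → f u v s t j k) ≈ (ν * ν * (D α j k * D β j k)) * (E j s * E k t)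
      characters s t j k = begin
        Σ² n (λ u v → f u v s t j k)
          ≈⟨ Σ²-cong n (λ u v _ _ → solve 6 (λ d e a b x y → (d :* (a :* b)) :* (e :* (x :* y)) := (d :* e) :* ((a :* x) :* (b :* y))) refl _ _ _ _ _ _) ⟩
        Σ² n (λ u v → (D β s t * D α j k) * (((ξ ^ s) ^ u * (ζ ^ j) ^ u) * ((ξ ^ t) ^ v * (ζ ^ k) ^ v)))
          ≈⟨ *-distribˡ-Σ² n _ _ ⟨
        (D β s t * D α j k) * Σ² n (λ u v → ((ξ ^ s) ^ u * (ζ ^ j) ^ u) * ((ξ ^ t) ^ v * (ζ ^ k) ^ v))
          ≈⟨ *-congˡ (trans (sym (Σ-*-Σ n n _ _)) (*-cong (orthogonality j s) (orthogonality k t))) ⟩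
        (D β s t * D α j k) * ((ν * E j s) * (ν * E k t))
          ≈⟨ solve 5 (λ d e n x y → (d :* e) :* ((n :* x) :* (n :* y)) := (n :* n :* e) :* (d :* (x :* y))) refl _ _ ν _ _ ⟩
        (ν * ν * D α j k) * (D β s t * (E j s * E k t))
          ≈⟨ *-congˡ (E-replace s t j k) ⟩
        (ν * ν * D α j k) * (D β j k * (E j s * E k t))
          ≈⟨ solve 5 (λ n d e x y → (n :* n :* d) :* (e :* (x :* y)) := (n :* n :* (d :* e)) :* (x :* y)) refl ν _ _ _ _ ⟩
        (ν * ν * (D α j k * D β j k)) * (E j s * E k t) ∎
      Σ-E : ∀ j → Σ n (E j) ≈ 1#
      Σ-E j = trans (Σ-cong n λ s _ → []-⇔ (β ^ₘ j Finₚ.≟ β ^ₘ s) (β ^ₘ s Finₚ.≟ β ^ₘ j) ≡.sym ≡.sym)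
        (Σ-powers order (β ^ₘ j) (yes tt) (λ _ → tt) (λ _ → j , ≡.refl))
      collapse : ∀ j k → Σ² n (λ s t → (ν * ν * (D α j k * D β j k)) * (E j s * E k t)) ≈ ν * ν * (D α j k * D β j k)
      collapse j k = trans (sym (*-distribˡ-Σ² n _ _)) (trans (*-congˡ (trans (sym (Σ-*-Σ n n (E j) (E k)))
        (trans (*-cong (Σ-E j) (Σ-E k)) (*-identityˡ 1#)))) (*-identityʳ _))

-- The theorem

-- If p - 1 were odd, 2 would divide p, and irreducibility would force p = 2.
odd-prime-half : ∀ {p} → Prime p → 2 ℕ.< p → (p ∸ 1) / 2 ℕ.+ (p ∸ 1) / 2 ≡ p ∸ 1
odd-prime-half {suc P} pr 2<p with P % 2 | m%n<n P 2 | m≡m%n+[m/n]*n P 2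
... | zero  | _ | P≡ = ≡.sym (≡.trans P≡ (≡.trans (ℕₚ.*-comm (P / 2) 2) (≡.cong (P / 2 ℕ.+_) (ℕₚ.+-identityʳ (P / 2)))))
... | suc zero | _ | P≡ with prime⇒irreducible pr (divides (suc (P / 2)) (≡.cong suc P≡))
...   | inj₁ ()
...   | inj₂ 2≡p = contradiction (≡.subst (2 ℕ.<_) (≡.sym 2≡p) 2<p) (ℕₚ.<-irrefl ≡.refl)
odd-prime-half {suc P} pr 2<p | suc (suc r) | s≤s (s≤s ()) | _

module Counting {c ℓ₁ ℓ₂} (R : Reals c ℓ₁ ℓ₂) where
  open Complex R

  module _ {exp : ℂ → ℂ} (isExp : IsExponential exp) {π : ℝ} (isPi : IsPi exp π)
    {p q : ℕ} .{{_ : NonZero p}} .{{_ : NonZero q}} .{{pq≢0 : NonZero (p ℕ.* q)}}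
    (1<q : 1 ℕ.< q) (p-prime : Prime p) (q<p : q ℕ.< p)
    {a : ℤ/ (p ℕ.* q)} (a-unit : IsUnit a) (a^h≡-1 : a ^ₘ ((p ∸ 1) / 2) ≡ -ₘ 1ₘ)
    (generates : GeneratesUnits (reduce p a)) {n : ℕ} .{{_ : NonZero n}} (ord : HasOrder (reduce q a) n)
    {ψ : ℤ/ q → μ n} (ψ-value : ∀ j → val (ψ (reduce q a ^ₘ j)) ≈ e^2πi exp π j n)
    (χ : Character p) (χ-value : ∀ j → ⟦ χ ⟧ (reduce p a ^ₘ j) ≈ e^2πi exp π j n)
    (χ^_ : ℕ → Character p) (χ^-power : ∀ i → (χ^ i) IsPower i Of χ) where

    open import Data.Nat.Base using (_<_)
    open ComplexRing R
    open ComplexExponential R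
    open ComplexRoots R
    open OrderedField R using (*1/)
    private
      module ℝ = CommutativeRing (Reals.commutativeRing R)
      module Σᴿ = Sums (Reals.commutativeRing R)
      module Dᴿ = DifferenceSums (Reals.commutativeRing R)
    open CommutativeRing ℂ-commutativeRing using
      (refl; sym; trans; reflexive; setoid; semiring; commutativeSemiring; +-cong; +-congˡ; *-cong; *-congˡ; *-congʳ; +-identityˡ; +-identityʳ;
       *-identityˡ; *-identityʳ; zeroˡ; zeroʳ; *-assoc; *-comm; distribˡ)
    open Sums ℂ-commutativeRing hiding (sum)
    open DifferenceSums ℂ-commutativeRing
    open PowerSums ℂ-commutativeRing
    open Algebra.Properties.Semiring.Exp semiring using (^-congˡ; ^-homo-*)
    open Algebra.Properties.CommutativeSemiring.Exp commutativeSemiring using (^-distrib-*)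
    open Algebra.Properties.Semiring.Mult semiring using () renaming (_×_ to _·_)
    open IntegerSolver ℂ-commutativeRing using (solve; _:=_; _:*_)
    open Relation.Binary.Reasoning.Setoid setoid

    α : ℤ/ p
    α = reduce p a

    β : ℤ/ q
    β = reduce q a

    P h : ℕ
    P = p ∸ 1
    h = P / 2

    1<p : 1 < p
    1<p = ℕₚ.<-trans 1<q q<p

    h+h≡P : h ℕ.+ h ≡ P
    h+h≡P = odd-prime-half p-prime (ℕₚ.≤-<-trans 1<q q<p)

    instance
      P≢0 : NonZero P
      P≢0 = ℕ.>-nonZero (ℕₚ.m<n⇒0<n∸m 1<p)

    p∣pq : p ∣ p ℕ.* q
    p∣pq = m∣m*n q

    q∣pq : q ∣ p ℕ.* q
    q∣pq = n∣m*n p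

    α-unit : IsUnit α
    α-unit = reduce-unit p∣pq a a-unit

    β-unit : IsUnit β
    β-unit = reduce-unit q∣pq a a-unit

    module _ {k : ℕ} .{{_ : NonZero k}} (k∣pq : k ∣ p ℕ.* q) where

      reduce^h≡-1 : reduce k a ^ₘ h ≡ -ₘ 1ₘ
      reduce^h≡-1 = ≡.trans (≡.sym (reduce-homo-^ k∣pq a h)) (≡.trans (≡.cong (reduce k) a^h≡-1)
        (≡.trans (reduce-homo-- k∣pq 1ₘ) (≡.cong (λ x → -ₘ x) (reduce-homo-1 k∣pq))))

    -1*-1≡1 : ∀ {m} .{{_ : NonZero m}} → (-ₘ 1ₘ) *ₘ (-ₘ 1ₘ) ≡ 1ₘ {m}
    -1*-1≡1 {m} = ≡.trans (-1*x≈-x (-ₘ 1ₘ)) (-‿involutive 1ₘ)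
      where open Algebra.Properties.Ring (CommutativeRing.ring (ℤ/-commutativeRing {m}))

    -- Negation as a shift of the exponent: it shows 1 - b to be a power of β when b - 1 is, and
    -- turns c + d = 1 into an equation of the form x = y + 1.
    power-negate : ∀ {m} .{{_ : NonZero m}} {g : ℤ/ m} {h} → g ^ₘ h ≡ -ₘ 1ₘ → ∀ i → g ^ₘ (i ℕ.+ h) ≡ -ₘ (g ^ₘ i)
    power-negate {m} {g} {h} g^h≡-1 i = ≡.trans (^ₘ-homo-+ g i h) (≡.trans (≡.cong (g ^ₘ i *ₘ_) g^h≡-1)
      (≡.trans (*ₘ-comm (g ^ₘ i) (-ₘ 1ₘ)) (-1*x≈-x (g ^ₘ i))))
      where open Algebra.Properties.Ring (CommutativeRing.ring (ℤ/-commutativeRing {m})) using (-1*x≈-x)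

    a^P≡1 : a ^ₘ P ≡ 1ₘ
    a^P≡1 = ≡.trans (≡.cong (a ^ₘ_) (≡.sym h+h≡P)) (≡.trans (^ₘ-homo-+ a h h) (≡.trans (≡.cong₂ _*ₘ_ a^h≡-1 a^h≡-1) -1*-1≡1))

    α^P≡1 : α ^ₘ P ≡ 1ₘ
    α^P≡1 = ≡.trans (≡.sym (reduce-homo-^ p∣pq a P)) (≡.trans (≡.cong (reduce p) a^P≡1) (reduce-homo-1 p∣pq))

    α^h≡-1 : α ^ₘ h ≡ -ₘ 1ₘ
    α^h≡-1 = reduce^h≡-1 p∣pq

    β^h≡-1 : β ^ₘ h ≡ -ₘ 1ₘ
    β^h≡-1 = reduce^h≡-1 q∣pq

    β^n≡1 : β ^ₘ n ≡ 1ₘ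
    β^n≡1 = HasOrder.power≡1 ord

    α-order : Order α P
    α-order = generator-order p-prime α generates (ℕₚ.m+[n∸m]≡n {1} (ℕₚ.<⇒≤ 1<p)) α^P≡1

    β-order : Order β n
    β-order = HasOrder⇒Order β β-unit ord

    -- Powers of a that agree modulo p q agree modulo p, where the generator α already separates
    -- them.
    a-order : Order a P
    a-order = record
      { power≡1   = a^P≡1
      ; injective = λ {j} {k} j<P k<P eq → Order.injective α-order j<P k<P
          (≡.trans (≡.sym (reduce-homo-^ p∣pq a j)) (≡.trans (≡.cong (reduce p) eq) (reduce-homo-^ p∣pq a k))) }

    -- The root of unity ζ = χ(α), its inverse ξ, and orthogonality

    ζ ξ : ℂ
    ζ = ⟦ χ ⟧ α
    ξ = conj ζ

    χ-power : ∀ j → ⟦ χ ⟧ (α ^ₘ j) ≈ ζ ^ j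
    χ-power zero    = Character.1-homo χ
    χ-power (suc j) = trans (Character.*-homo χ α (α ^ₘ j) α-unit (^ₘ-unit α α-unit j)) (*-congˡ {ζ} (χ-power j))

    -- Both ψ(βʲ) and χ(αʲ) are given by the same exponential, so the multiplicativity of χ carries
    -- over to ψ on powers of β.
    ψ-power : ∀ j → val (ψ (β ^ₘ j)) ≈ ζ ^ j
    ψ-power j = trans (ψ-value j) (trans (sym (χ-value j)) (χ-power j))

    -- Since βⁿ = β⁰ and ψ is a function of the residue, ζⁿ = ζ⁰. The period of the exponential
    -- function does not enter.
    ζⁿ≈1 : ζ ^ n ≈ 1ᶜ
    ζⁿ≈1 = trans (sym (ψ-power n)) (trans (reflexive (≡.cong (val ∘ ψ) β^n≡1)) (ψ-power 0))

    ζᴾ≈1 : ζ ^ P ≈ 1ᶜ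
    ζᴾ≈1 = trans (sym (χ-power P)) (trans (reflexive (≡.cong ⟦ χ ⟧ α^P≡1)) (Character.1-homo χ))

    ζ-primitive : ∀ k → 0 < k → k < n → ¬ (ζ ^ k ≈ 1ᶜ)
    ζ-primitive k 0<k k<n ζᵏ≈1 = e^2πi≉1 isExp isPi k n 0<k k<n (trans (sym (χ-value k)) (trans (χ-power k) ζᵏ≈1))

    ζ*ξ≈1 : ζ * ξ ≈ 1ᶜ
    ζ*ξ≈1 = root*conj n ζⁿ≈1

    ζʲ*ξʲ≈1 : ∀ j → ζ ^ j * ξ ^ j ≈ 1ᶜ
    ζʲ*ξʲ≈1 j = trans (sym (^-distrib-* ζ ξ j)) (trans (^-congˡ j ζ*ξ≈1) (1^ j))

    ξⁿ≈1 : ξ ^ n ≈ 1ᶜ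
    ξⁿ≈1 = trans (sym (conj-^ ζ n)) (trans (conj-cong ζⁿ≈1) conj-1)

    -- The record `μ n` carries some inverse of ζʲ; inverses being unique, it is ξʲ.
    ψ⁻¹-power : ∀ j → val⁻¹ (ψ (β ^ₘ j)) ≈ ξ ^ j
    ψ⁻¹-power j = begin
      val⁻¹ (ψ (β ^ₘ j))                              ≈⟨ *-identityˡ _ ⟨
      1ᶜ * val⁻¹ (ψ (β ^ₘ j))                         ≈⟨ *-congʳ (ζʲ*ξʲ≈1 j) ⟨
      (ζ ^ j * ξ ^ j) * val⁻¹ (ψ (β ^ₘ j))            ≈⟨ solve 3 (λ x y z → (x :* y) :* z := y :* (x :* z)) refl _ _ _ ⟩
      ξ ^ j * (ζ ^ j * val⁻¹ (ψ (β ^ₘ j)))            ≈⟨ *-congˡ {ξ ^ j} (*-congʳ (sym (ψ-power j))) ⟩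
      ξ ^ j * (val (ψ (β ^ₘ j)) * val⁻¹ (ψ (β ^ₘ j))) ≈⟨ *-congˡ {ξ ^ j} (μ.val*val⁻¹ (ψ (β ^ₘ j))) ⟩
      ξ ^ j * 1ᶜ                                      ≈⟨ *-identityʳ _ ⟩
      ξ ^ j                                           ∎

    χⁱ-power : ∀ i j → ⟦ χ^ i ⟧ (α ^ₘ j) ≈ (ζ ^ j) ^ i
    χⁱ-power i j = trans (χ^-power i (α ^ₘ j) (^ₘ-unit α α-unit j)) (^-congˡ i (χ-power j))

    -- The value ζⁱ ≠ 1 at α makes χⁱ nontrivial, so the convention for the argument 0 applies.
    χⁱ-0 : ∀ i → 0 < i → i < n → ⟦ χ^ i ⟧ 0ₘ ≈ 0ᶜ
    χⁱ-0 i 0<i i<n = Character.nontrivial⇒0↦0 (χ^ i) λ trivial →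
      ζ-primitive i 0<i i<n (trans (sym (χ^-power i α α-unit)) (trivial α α-unit))

    private
      root-injective-< : ∀ {j s} → j < s → s < n → ¬ (ζ ^ j ≈ ζ ^ s)
      root-injective-< {j} {s} j<s s<n eq = ζ-primitive (s ∸ j) (ℕₚ.m<n⇒0<n∸m j<s) (ℕₚ.≤-<-trans (ℕₚ.m∸n≤m s j) s<n) (begin
        ζ ^ (s ∸ j)                          ≈⟨ *-identityˡ _ ⟨
        1ᶜ * ζ ^ (s ∸ j)                     ≈⟨ *-congʳ (ζʲ*ξʲ≈1 j) ⟨
        (ζ ^ j * ξ ^ j) * ζ ^ (s ∸ j)        ≈⟨ solve 3 (λ x y z → (x :* y) :* z := (x :* z) :* y) refl _ _ _ ⟩
        (ζ ^ j * ζ ^ (s ∸ j)) * ξ ^ j        ≈⟨ *-congʳ (^-homo-* ζ j (s ∸ j)) ⟨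
        ζ ^ (j ℕ.+ (s ∸ j)) * ξ ^ j          ≈⟨ *-congʳ (reflexive (≡.cong (ζ ^_) (ℕₚ.m+[n∸m]≡n (ℕₚ.<⇒≤ j<s)))) ⟩
        ζ ^ s * ξ ^ j                        ≈⟨ *-congʳ eq ⟨
        ζ ^ j * ξ ^ j                        ≈⟨ ζʲ*ξʲ≈1 j ⟩
        1ᶜ                                   ∎)

    ζ-% : ∀ j → ζ ^ (j % n) ≈ ζ ^ j
    ζ-% j = trans (sym (ψ-power (j % n))) (trans (reflexive (≡.cong (val ∘ ψ) (^ₘ-% β β^n≡1 j))) (ψ-power j))

    ζ-injective : ∀ j s → ζ ^ j ≈ ζ ^ s → β ^ₘ j ≡ β ^ₘ s
    ζ-injective j s eq with ℕₚ.<-cmp (j % n) (s % n)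
    ... | tri≈ _ j≡s _ = ≡.trans (≡.sym (^ₘ-% β β^n≡1 j)) (≡.trans (≡.cong (β ^ₘ_) j≡s) (^ₘ-% β β^n≡1 s))
    ... | tri< j<s _ _ = contradiction (trans (ζ-% j) (trans eq (sym (ζ-% s)))) (root-injective-< j<s (m%n<n s n))
    ... | tri> _ _ s<j = contradiction (trans (ζ-% s) (trans (sym eq) (sym (ζ-% j)))) (root-injective-< s<j (m%n<n j n))

    -- The summands are the powers of ω = ζʲ / ζˢ, an n-th root of unity. Equal powers of β give ω =
    -- 1 because ψ is well defined; the converse holds because ζ is primitive.
    orthogonality : ∀ j s → Σ n (λ u → (ξ ^ s) ^ u * (ζ ^ j) ^ u) ≈ n · 1ᶜ * [ β ^ₘ j Finₚ.≟ β ^ₘ s ]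
    orthogonality j s = trans (Σ-cong n λ u _ → sym (^-distrib-* (ξ ^ s) (ζ ^ j) u)) (by-cases (β ^ₘ j Finₚ.≟ β ^ₘ s))
      where
      ω : ℂ
      ω = ξ ^ s * ζ ^ j
      ωⁿ≈1 : ω ^ n ≈ 1ᶜ
      ωⁿ≈1 = trans (^-distrib-* (ξ ^ s) (ζ ^ j) n) (trans (*-cong (root-^ {ξ} {n} ξⁿ≈1 s) (root-^ {ζ} {n} ζⁿ≈1 j)) (*-identityˡ 1ᶜ))
      ω*ζˢ≈ζʲ : ω * ζ ^ s ≈ ζ ^ j
      ω*ζˢ≈ζʲ = trans (solve 3 (λ x y z → (x :* y) :* z := (z :* x) :* y) refl (ξ ^ s) (ζ ^ j) (ζ ^ s))
        (trans (*-congʳ (ζʲ*ξʲ≈1 s)) (*-identityˡ _))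
      by-cases : (eq? : Dec (β ^ₘ j ≡ β ^ₘ s)) → Σ n (λ u → ω ^ u) ≈ n · 1ᶜ * [ eq? ]
      by-cases (yes eq) = trans (Σ-cong n λ u _ → trans (^-congˡ u ω≈1) (1^ u)) (trans (Σ-const n) (sym (*-identityʳ _)))
        where
        ω≈1 : ω ≈ 1ᶜ
        ω≈1 = trans (*-congˡ {ξ ^ s} (trans (sym (ψ-power j)) (trans (reflexive (≡.cong (val ∘ ψ) eq)) (ψ-power s))))
          (trans (*-comm _ _) (ζʲ*ξʲ≈1 s))
      by-cases (no β≢) = trans (root-sum {n} {ω} ωⁿ≈1 λ ω≈1 → β≢ (ζ-injective j s
        (trans (sym ω*ζˢ≈ζʲ) (trans (*-congʳ ω≈1) (*-identityˡ _))))) (sym (zeroʳ _))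

    -- Edge values and symmetries of the products T

    Kα Kβ T : ℕ → ℕ → ℂ
    Kα = K α P ζ
    Kβ = K β n ξ
    T u v = Kβ u v * Kα u v

    ≢1⇒power : ∀ {x : ℤ/ p} → x ≢ 1ₘ → ∃ λ k → x ≡ α ^ₘ k +ₘ 1ₘ
    ≢1⇒power {x} x≢1 = let k , α^k≡x-1 = proj₂ generates (x -ₘ 1ₘ) (≢0⇒unit p-prime (x -ₘ 1ₘ) (x≢1 ∘ x∙y⁻¹≈ε⇒x≈y x 1ₘ)) in
      k , ≡.trans (solveₘ 2 (λ x o → x :=ₘ (x :-ₘ o) :+ₘ o) ≡.refl x 1ₘ) (≡.cong (_+ₘ 1ₘ) (≡.sym α^k≡x-1))
      where
      open Algebra.Properties.Ring (CommutativeRing.ring (ℤ/-commutativeRing {p})) using (x∙y⁻¹≈ε⇒x≈y)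
      open IntegerSolver (ℤ/-commutativeRing {p}) using () renaming (solve to solveₘ; _:=_ to _:=ₘ_; _:+_ to _:+ₘ_; _:-_ to _:-ₘ_)

    -- The equation would force `g ^ₘ k` to be 0, which is not a unit for m > 1.
    power-≢-power+1 : ∀ {m} .{{_ : NonZero m}} → 1 < m → ∀ (g : ℤ/ m) → IsUnit g → ∀ k → 1ₘ ≢ g ^ₘ k +ₘ 1ₘ
    power-≢-power+1 {m} 1<m g unit k eq = unit⇒≢0 1<m (g ^ₘ k) (^ₘ-unit g unit k)
      (+-cancelʳ 1ₘ _ _ (≡.trans (≡.sym eq) (≡.sym (+ₘ-identityˡ 1ₘ))))
      where open Algebra.Properties.Ring (CommutativeRing.ring (ℤ/-commutativeRing {m})) using (+-cancelʳ)

    -- Each x ≠ 1 in the group has one partner y, as x - 1 is nonzero and thus a power of α. What is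
    -- missing from the full character sum is therefore the term x = 1.
    Kα-row : ∀ u → Kα u 0 + 1ᶜ ≈ Σ P ((ζ ^ u) ^_)
    Kα-row u = begin
      Kα u 0 + 1ᶜ
        -- The added 1 is the term of x = 1, found at the exponent j = 0.
        ≈⟨ +-cong row (sym (trans at-0 (1^ u))) ⟩
      Σ P (λ j → [ ¬? (α ^ₘ j Finₚ.≟ 1ₘ) ] * (ζ ^ j) ^ u) + Σ P (λ j → [ α ^ₘ j Finₚ.≟ 1ₘ ] * (ζ ^ j) ^ u)
        ≈⟨ Σ-distrib-+ P _ _ ⟨
      Σ P (λ j → [ ¬? (α ^ₘ j Finₚ.≟ 1ₘ) ] * (ζ ^ j) ^ u + [ α ^ₘ j Finₚ.≟ 1ₘ ] * (ζ ^ j) ^ u)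
        ≈⟨ Σ-cong P (λ j _ → trans (complement (α ^ₘ j Finₚ.≟ 1ₘ)) (^-swap ζ j u)) ⟩
      Σ P ((ζ ^ u) ^_) ∎
      where
      complement : ∀ {ℓ} {Q : Set ℓ} (Q? : Dec Q) {z} → [ ¬? Q? ] * z + [ Q? ] * z ≈ z
      complement (yes _) {z} = trans (+-cong (zeroˡ z) (*-identityˡ z)) (+-identityˡ z)
      complement (no _)  {z} = trans (+-cong (*-identityˡ z) (zeroˡ z)) (+-identityʳ z)
      column : ∀ j → Σ P (D α j) ≈ [ ¬? (α ^ₘ j Finₚ.≟ 1ₘ) ]
      column j = Σ-∃ P (λ k → α ^ₘ j Finₚ.≟ α ^ₘ k +ₘ 1ₘ) (¬? (α ^ₘ j Finₚ.≟ 1ₘ))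
        (λ k l k<P l<P x y → Order.injective α-order k<P l<P (+-cancelʳ 1ₘ _ _ (≡.trans (≡.sym x) y)))
        (λ k _ x α^j≡1 → power-≢-power+1 1<p α α-unit k (≡.trans (≡.sym α^j≡1) x))
        (λ α^j≢1 → let k , x = ≢1⇒power α^j≢1 in
          k % P , m%n<n k P , ≡.trans x (≡.cong (_+ₘ 1ₘ) (≡.sym (^ₘ-% α {P} α^P≡1 k))))
        where open Algebra.Properties.Ring (CommutativeRing.ring (ℤ/-commutativeRing {p})) using (+-cancelʳ)
      row : Kα u 0 ≈ Σ P (λ j → [ ¬? (α ^ₘ j Finₚ.≟ 1ₘ) ] * (ζ ^ j) ^ u)
      row = Σ-cong P λ j _ → trans (Σ-cong P λ k _ → *-congˡ {D α j k} (*-identityʳ ((ζ ^ j) ^ u)))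
        (trans (sym (*-distribʳ-Σ P ((ζ ^ j) ^ u) (D α j))) (*-congʳ (column j)))
      at-0 : Σ P (λ j → [ α ^ₘ j Finₚ.≟ 1ₘ ] * (ζ ^ j) ^ u) ≈ 1ᶜ ^ u
      at-0 = Σ-only {P} (λ j → α ^ₘ j Finₚ.≟ 1ₘ) (λ j → (ζ ^ j) ^ u) 0 0<P ≡.refl
        λ j j<P α^j≡1 → Order.injective α-order j<P 0<P α^j≡1
        where
        0<P : 0 < P
        0<P = ℕₚ.m<n⇒0<n∸m 1<p

    Kα-00 : Kα 0 0 + 1ᶜ ≈ P · 1ᶜ
    Kα-00 = trans (Kα-row 0) (trans (Σ-cong P λ j _ → 1^ j) (Σ-const P))

    Kα-u0 : ∀ u → 0 < u → u < n → Kα u 0 + 1ᶜ ≈ 0ᶜ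
    Kα-u0 u 0<u u<n = trans (Kα-row u) (root-sum {P} {ζ ^ u} (root-^ {ζ} {P} ζᴾ≈1 u) (ζ-primitive u 0<u u<n))

    -- Summation over u tests for βˢ = 1, which fails whenever βˢ = βᵗ + 1.
    Kβ-column : Σ n (λ u → Kβ u 0) ≈ 0ᶜ
    Kβ-column = begin
      Σ n (λ u → Σ² n λ s t → D β s t * ((ξ ^ s) ^ u * 1ᶜ))     ≈⟨ Σ-comm n n _ ⟩
      Σ n (λ s → Σ n λ u → Σ n λ t → D β s t * ((ξ ^ s) ^ u * 1ᶜ))
                                                                ≈⟨ Σ-cong n (λ s _ → Σ-comm n n _) ⟩
      Σ² n (λ s t → Σ n λ u → D β s t * ((ξ ^ s) ^ u * 1ᶜ))     ≈⟨ Σ-0 n (λ s _ → Σ-0 n λ t _ → vanish s t) ⟩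
      0ᶜ                                                        ∎
      where
      vanish : ∀ s t → Σ n (λ u → D β s t * ((ξ ^ s) ^ u * 1ᶜ)) ≈ 0ᶜ
      vanish s t = begin
        Σ n (λ u → D β s t * ((ξ ^ s) ^ u * 1ᶜ))         ≈⟨ *-distribˡ-Σ n (D β s t) _ ⟨
        -- Rewriting 1 as `(ζ ^ 0) ^ u` gives the inner sum the shape of orthogonality at j = 0.
        D β s t * Σ n (λ u → (ξ ^ s) ^ u * 1ᶜ)           ≈⟨ *-congˡ {D β s t} (Σ-cong n λ u _ → *-congˡ {(ξ ^ s) ^ u} (sym (1^ u))) ⟩
        D β s t * Σ n (λ u → (ξ ^ s) ^ u * (ζ ^ 0) ^ u)  ≈⟨ *-congˡ {D β s t} (orthogonality 0 s) ⟩
        D β s t * (n · 1ᶜ * [ 1ₘ Finₚ.≟ β ^ₘ s ])        ≈⟨ []-*-cong (β ^ₘ s Finₚ.≟ β ^ₘ t +ₘ 1ₘ) (λ eq →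
                                                              trans (*-congˡ {n · 1ᶜ} ([]-no (1ₘ Finₚ.≟ β ^ₘ s) λ 1≡β^s → power-≢-power+1 1<q β β-unit t (≡.trans 1≡β^s eq))) (zeroʳ _)) ⟩
        D β s t * 0ᶜ                                     ≈⟨ zeroʳ _ ⟩
        0ᶜ                                               ∎

    T-antidiagonal : ∀ u → u < n → T u (n ∸ u) ≈ T u 0
    T-antidiagonal u u<n = *-cong (K-antidiagonal {g = β} β-unit {n} β^n≡1 {ξ} ξⁿ≈1 u (n ∸ u) (trivial {ξ} ξⁿ≈1))
                                  (K-antidiagonal {g = α} α-unit {P} α^P≡1 {ζ} ζᴾ≈1 u (n ∸ u) (trivial {ζ} ζⁿ≈1))
      where
      trivial : ∀ {θ} → θ ^ n ≈ 1ᶜ → ∀ k → (θ ^ k) ^ (u ℕ.+ (n ∸ u)) ≈ 1ᶜ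
      trivial {θ} θⁿ≈1 k = trans (reflexive (≡.cong ((θ ^ k) ^_) (ℕₚ.m+[n∸m]≡n (ℕₚ.<⇒≤ u<n)))) (root-^ {θ} {n} θⁿ≈1 k)

    ξᵏ*ζᵏ-power : ∀ k u → (ξ ^ k) ^ u * (ζ ^ k) ^ u ≈ 1ᶜ
    ξᵏ*ζᵏ-power k u = trans (sym (^-distrib-* (ξ ^ k) (ζ ^ k) u)) (trans (^-congˡ u (trans (*-comm _ _) (ζʲ*ξʲ≈1 k))) (1^ u))

    -- Exchanging u and v costs `Kα` and `Kβ` a factor each, built from `ζ ^ h` and `ξ ^ h`
    -- respectively; these are inverse to each other, so the product is symmetric.
    T-symmetric : ∀ u v → T u v ≈ T v u
    T-symmetric u v = begin
      Kβ u v * Kα u v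
        ≈⟨ trans (*-congˡ {Kβ u v * Kα u v} (trans (*-cong (ξᵏ*ζᵏ-power h u) (ξᵏ*ζᵏ-power h v)) (*-identityˡ 1ᶜ))) (*-identityʳ _) ⟨
      (Kβ u v * Kα u v) * (((ξ ^ h) ^ u * (ζ ^ h) ^ u) * ((ξ ^ h) ^ v * (ζ ^ h) ^ v))
        ≈⟨ solve 6 (λ c k x z y w → (c :* k) :* ((x :* z) :* (y :* w)) := (c :* (x :* y)) :* (k :* (z :* w))) refl _ _ _ _ _ _ ⟩
      (Kβ u v * ((ξ ^ h) ^ u * (ξ ^ h) ^ v)) * (Kα u v * ((ζ ^ h) ^ u * (ζ ^ h) ^ v))
        ≈⟨ *-cong (K-swap {g = β} β-unit {n} β^n≡1 {ξ} ξⁿ≈1 {h} β^h≡-1 u v) (K-swap {g = α} α-unit {P} α^P≡1 {ζ} ζᴾ≈1 {h} α^h≡-1 u v) ⟩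
      Kβ v u * Kα v u ∎

    -- As θⁿ = 1, the exponent n - u amounts to -u, and the inverse of a root of unity is its
    -- conjugate. The indicators are real.
    K-reflection : ∀ {m} .{{_ : NonZero m}} (g : ℤ/ m) N {θ} → θ ^ n ≈ 1ᶜ → ∀ u v → u < n → v < n →
                   K g N θ (n ∸ u) (n ∸ v) ≈ conj (K g N θ u v)
    K-reflection g N {θ} θⁿ≈1 u v u<n v<n = trans
      (Σ²-cong N λ j k _ _ → *-congˡ {D g j k} (*-cong (reflect u u<n j) (reflect v v<n k))) (sym (conj-K g N θ u v))
      where
      reflect : ∀ u → u < n → ∀ j → (θ ^ j) ^ (n ∸ u) ≈ (conj θ ^ j) ^ u
      reflect u u<n j = begin
        x ^ (n ∸ u)                       ≈⟨ *-identityʳ _ ⟨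
        x ^ (n ∸ u) * 1ᶜ                  ≈⟨ *-congˡ {x ^ (n ∸ u)} (trans (sym (^-distrib-* x y u)) (trans (^-congˡ u xy≈1) (1^ u))) ⟨
        x ^ (n ∸ u) * (x ^ u * y ^ u)     ≈⟨ *-assoc _ _ _ ⟨
        (x ^ (n ∸ u) * x ^ u) * y ^ u     ≈⟨ *-congʳ (^-homo-* x (n ∸ u) u) ⟨
        x ^ (n ∸ u ℕ.+ u) * y ^ u         ≈⟨ *-congʳ (trans (reflexive (≡.cong (x ^_) (ℕₚ.m∸n+n≡m (ℕₚ.<⇒≤ u<n)))) (root-^ {θ} {n} θⁿ≈1 j)) ⟩
        1ᶜ * y ^ u                        ≈⟨ *-identityˡ _ ⟩
        y ^ u                             ∎
        where
        x y : ℂ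
        x = θ ^ j
        y = conj θ ^ j
        xy≈1 : x * y ≈ 1ᶜ
        xy≈1 = trans (sym (^-distrib-* θ (conj θ) j)) (trans (^-congˡ j (root*conj n θⁿ≈1)) (1^ j))

    -- Reflection replaces T by its conjugate, so it is an invariance of the real part only; for
    -- this reason the folding is applied to `τ`.
    T-reflection : ∀ u v → u < n → v < n → re (T (n ∸ u) (n ∸ v)) ≈ᴿ re (T u v)
    T-reflection u v u<n v<n = re≈ (trans (*-cong (K-reflection β n {ξ} ξⁿ≈1 u v u<n v<n) (K-reflection α P {ζ} ζⁿ≈1 u v u<n v<n))
      (sym (conj-* (Kβ u v) (Kα u v))))

    -- Jacobi sums and the coefficients as sums over exponents

    units-sum : ∀ (F : ℤ/ p → ℂ) → F 0ₘ ≈ 0ᶜ → sum F ≈ Σ P (λ j → F (α ^ₘ j))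
    units-sum F F0≈0 = trans (Sums.sum-cong-≋ ℂ-commutativeRing {p} λ x → by-cases x (x Finₚ.≟ 0ₘ)) (sum-sift P (α ^ₘ_) F)
      where
      by-cases : ∀ (x : ℤ/ p) → Dec (x ≡ 0ₘ) → F x ≈ Σ P (λ j → [ α ^ₘ j Finₚ.≟ x ]) * F x
      by-cases x (yes x≡0) = trans Fx≈0 (sym (trans (*-congˡ {Σ P _} Fx≈0) (zeroʳ _)))
        where
        Fx≈0 : F x ≈ 0ᶜ
        Fx≈0 = trans (reflexive (≡.cong F x≡0)) F0≈0
      by-cases x (no x≢0) = sym (trans (*-congʳ (Σ-powers α-order x (yes tt) (λ _ → tt) λ _ →
        proj₂ generates x (≢0⇒unit p-prime x x≢0))) (*-identityˡ _))

    -- Both characters vanish at 0, so c and d range over powers of α. Writing d = -y shifts its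
    -- exponent by h: the condition becomes c = y + 1, and χʲ(-1) comes out as the factor
    -- `(ζ ^ h) ^ j`.
    Jacobi : ∀ i j → 0 < i → i < n → 0 < j → j < n → J (χ^ i) (χ^ j) ≈ (ζ ^ h) ^ j * Kα i j
    Jacobi i j 0<i i<n 0<j j<n = begin
      J (χ^ i) (χ^ j)
        ≈⟨ Sums.sum-cong-≋ ℂ-commutativeRing (λ u → trans (Sums.sum-cong-≋ ℂ-commutativeRing λ v → if-[] (u +ₘ v Finₚ.≟ 1ₘ) _)
             (units-sum (λ v → f u v) (trans (*-congˡ {[ u +ₘ 0ₘ Finₚ.≟ 1ₘ ]} (trans (*-congˡ {⟦ χ^ i ⟧ u} (χⁱ-0 j 0<j j<n)) (zeroʳ _))) (zeroʳ _)))) ⟩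
      sum (λ u → Σ P λ t → f u (α ^ₘ t))
        ≈⟨ units-sum (λ u → Σ P λ t → f u (α ^ₘ t)) (Σ-0 P λ t _ →
             trans (*-congˡ {[ 0ₘ +ₘ α ^ₘ t Finₚ.≟ 1ₘ ]} (trans (*-congʳ (χⁱ-0 i 0<i i<n)) (zeroˡ _))) (zeroʳ _)) ⟩
      Σ² P (λ s t → f (α ^ₘ s) (α ^ₘ t))
        ≈⟨ Σ-cong P (λ s _ → Σ-shift P (λ t → f (α ^ₘ s) (α ^ₘ t)) (λ t → reflexive (≡.cong (f (α ^ₘ s)) (^ₘ-periodic α α^P≡1 t))) h) ⟨
      Σ² P (λ s t → f (α ^ₘ s) (α ^ₘ (t ℕ.+ h)))
        ≈⟨ Σ²-cong P (λ s t _ _ → pointwise s t) ⟩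
      Σ² P (λ s t → (ζ ^ h) ^ j * (D α s t * ((ζ ^ s) ^ i * (ζ ^ t) ^ j)))
        ≈⟨ *-distribˡ-Σ² P ((ζ ^ h) ^ j) _ ⟨
      (ζ ^ h) ^ j * Kα i j ∎
      where
      f : ℤ/ p → ℤ/ p → ℂ
      f u v = [ u +ₘ v Finₚ.≟ 1ₘ ] * (⟦ χ^ i ⟧ u * ⟦ χ^ j ⟧ v)
      pointwise : ∀ s t → f (α ^ₘ s) (α ^ₘ (t ℕ.+ h)) ≈ (ζ ^ h) ^ j * (D α s t * ((ζ ^ s) ^ i * (ζ ^ t) ^ j))
      pointwise s t = begin
        [ α ^ₘ s +ₘ α ^ₘ (t ℕ.+ h) Finₚ.≟ 1ₘ ] * (⟦ χ^ i ⟧ (α ^ₘ s) * ⟦ χ^ j ⟧ (α ^ₘ (t ℕ.+ h)))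
          ≈⟨ *-cong (negate-⇔ s t) (*-cong (χⁱ-power i s) (trans (χⁱ-power j (t ℕ.+ h))
               (trans (^-congˡ j (^-homo-* ζ t h)) (^-distrib-* (ζ ^ t) (ζ ^ h) j)))) ⟩
        D α s t * ((ζ ^ s) ^ i * ((ζ ^ t) ^ j * (ζ ^ h) ^ j))
          ≈⟨ solve 4 (λ d x y z → d :* (x :* (y :* z)) := z :* (d :* (x :* y))) refl _ _ _ _ ⟩
        (ζ ^ h) ^ j * (D α s t * ((ζ ^ s) ^ i * (ζ ^ t) ^ j)) ∎
        where
        open IntegerSolver (ℤ/-commutativeRing {p}) using () renaming (solve to solveₘ; _:=_ to _:=ₘ_; _:+_ to _:+ₘ_; _:-_ to _:-ₘ_; :-_ to :-ₘ_)
        negate-⇔ : ∀ s t → [ α ^ₘ s +ₘ α ^ₘ (t ℕ.+ h) Finₚ.≟ 1ₘ ] ≈ D α s t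
        negate-⇔ s t = []-⇔ (α ^ₘ s +ₘ α ^ₘ (t ℕ.+ h) Finₚ.≟ 1ₘ) (α ^ₘ s Finₚ.≟ α ^ₘ t +ₘ 1ₘ)
          (λ eq → ≡.trans (solveₘ 2 (λ x y → x :=ₘ y :+ₘ (x :-ₘ y)) ≡.refl (α ^ₘ s) (α ^ₘ t))
            (≡.cong (α ^ₘ t +ₘ_) (≡.trans (≡.cong (α ^ₘ s +ₘ_) (≡.sym (power-negate α^h≡-1 t))) eq)))
          (λ eq → ≡.trans (≡.cong₂ _+ₘ_ eq (power-negate α^h≡-1 t)) (solveₘ 2 (λ y o → (y :+ₘ o) :-ₘ y :=ₘ o) ≡.refl (α ^ₘ t) 1ₘ))

    -- With b = βˢ and b - 1 = βᵗ one has 1 - b = -βᵗ, the power of β with exponent t + h.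
    coeff-sum : ∀ i j → coeff ψ (consecutive ord) i j ≈ (ξ ^ h) ^ j * Kβ i j
    coeff-sum i j = begin
      coeff ψ (consecutive ord) i j
        ≈⟨ Sums.sum-cong-≋ ℂ-commutativeRing (λ b → if-[] (b ∈? consecutive ord) (F b)) ⟩
      sum (λ b → [ b ∈? consecutive ord ] * F b)
        ≈⟨ consecutive-sum β-unit ord F ⟩
      Σ² n (λ s t → D β s t * F (β ^ₘ s))
        ≈⟨ Σ²-cong n (λ s t _ _ → []-*-cong (β ^ₘ s Finₚ.≟ β ^ₘ t +ₘ 1ₘ) (F-power s t)) ⟩
      Σ² n (λ s t → D β s t * ((ξ ^ s) ^ i * ((ξ ^ t) ^ j * (ξ ^ h) ^ j)))
        ≈⟨ Σ²-cong n (λ s t _ _ → solve 4 (λ d x y z → d :* (x :* (y :* z)) := z :* (d :* (x :* y))) refl _ _ _ _) ⟩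
      Σ² n (λ s t → (ξ ^ h) ^ j * (D β s t * ((ξ ^ s) ^ i * (ξ ^ t) ^ j)))
        ≈⟨ *-distribˡ-Σ² n ((ξ ^ h) ^ j) _ ⟨
      (ξ ^ h) ^ j * Kβ i j ∎
      where
      F : ℤ/ q → ℂ
      F b = val⁻¹ (ψ b) ^ i * val⁻¹ (ψ (1ₘ -ₘ b)) ^ j
      open IntegerSolver (ℤ/-commutativeRing {q}) using () renaming (solve to solveₘ; _:=_ to _:=ₘ_; _:+_ to _:+ₘ_; _:-_ to _:-ₘ_; :-_ to :-ₘ_)
      F-power : ∀ s t → β ^ₘ s ≡ β ^ₘ t +ₘ 1ₘ → F (β ^ₘ s) ≈ (ξ ^ s) ^ i * ((ξ ^ t) ^ j * (ξ ^ h) ^ j)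
      F-power s t eq = *-cong (^-congˡ i (ψ⁻¹-power s))
        (trans (^-congˡ j (trans (reflexive (≡.cong (val⁻¹ ∘ ψ) 1-β^s)) (trans (ψ⁻¹-power (t ℕ.+ h)) (^-homo-* ξ t h)))) (^-distrib-* (ξ ^ t) (ξ ^ h) j))
        where
        1-β^s : 1ₘ -ₘ β ^ₘ s ≡ β ^ₘ (t ℕ.+ h)
        1-β^s = ≡.trans (≡.cong (λ b → 1ₘ -ₘ b) eq) (≡.trans (solveₘ 2 (λ y o → o :-ₘ (y :+ₘ o) :=ₘ :-ₘ y) ≡.refl (β ^ₘ t) 1ₘ) (≡.sym (power-negate β^h≡-1 t)))

    -- The factors `(ξ ^ h) ^ j` and `(ζ ^ h) ^ j` multiply to 1, so T can be formed from `Kβ` and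
    -- `Kα` without them.
    coeff*J : ∀ i j → 0 < i → i < n → 0 < j → j < n → coeff ψ (consecutive ord) i j * J (χ^ i) (χ^ j) ≈ T i j
    coeff*J i j 0<i i<n 0<j j<n = trans (*-cong (coeff-sum i j) (Jacobi i j 0<i i<n 0<j j<n))
      (trans (solve 4 (λ x c z k → (x :* c) :* (z :* k) := (x :* z) :* (c :* k)) refl _ _ _ _)
      (trans (*-congʳ (ξᵏ*ζᵏ-power h j)) (*-identityˡ _)))

    -- Evaluation of the sum

    ∣B∣ ∣S∩[S+1]∣ : ℕ
    ∣B∣       = ∣ consecutive ord ∣
    ∣S∩[S+1]∣ = ∣ S p q a ∩ translate (S p q a) ∣

    Kβ-00 : Kβ 0 0 ≈ ofReal (fromℕ ∣B∣)
    Kβ-00 = begin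
      Kβ 0 0                                                    ≈⟨ Σ²-cong n (λ s t _ _ → *-congˡ {D β s t} (*-identityˡ 1ᶜ)) ⟩
      Σ² n (λ s t → D β s t * 1ᶜ)                              ≈⟨ consecutive-sum β-unit ord (λ _ → 1ᶜ) ⟨
      sum (λ b → [ b ∈? consecutive ord ] * 1ᶜ)                ≈⟨ Sums.sum-cong-≋ ℂ-commutativeRing {q} (λ b → *-identityʳ [ b ∈? consecutive ord ]) ⟩
      sum (λ b → [ b ∈? consecutive ord ])                     ≈⟨ ∣∣-sum (consecutive ord) ⟨
      ∣B∣ · 1ᶜ                                                 ≈⟨ ·1ᶜ ∣B∣ ⟩
      ofReal (fromℕ ∣B∣)                                       ∎

    -- Adding the vanishing sum of `Kβ u 0` makes each term `Kβ u 0 * (Kα u 0 + 1)`, which is 0 for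
    -- u ≠ 0. The term at u = 0 remains.
    T-edge : Σ n (λ u → T u 0) ≈ T 0 0 + Kβ 0 0
    T-edge = begin
      Σ n (λ u → T u 0)                                        ≈⟨ +-identityʳ _ ⟨
      Σ n (λ u → T u 0) + 0ᶜ                                   ≈⟨ +-congˡ {Σ n (λ u → T u 0)} Kβ-column ⟨
      Σ n (λ u → T u 0) + Σ n (λ u → Kβ u 0)                    ≈⟨ Σ-distrib-+ n (λ u → T u 0) (λ u → Kβ u 0) ⟨
      Σ n F                                                    ≈⟨ Σ-cong n (λ u u<n → only-0 u u<n (u ℕₚ.≟ 0)) ⟩
      Σ n (λ u → [ u ℕₚ.≟ 0 ] * F u)                           ≈⟨ Σ-only {n} (ℕₚ._≟ 0) F 0 (ℕ.>-nonZero⁻¹ n) ≡.refl (λ _ _ eq → eq) ⟩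
      T 0 0 + Kβ 0 0                                            ∎
      where
      F : ℕ → ℂ
      F u = T u 0 + Kβ u 0
      only-0 : ∀ u → u < n → (u≟0 : Dec (u ≡ 0)) → F u ≈ [ u≟0 ] * F u
      only-0 u u<n (yes _)  = sym (*-identityˡ (F u))
      only-0 u u<n (no u≢0) = begin
        Kβ u 0 * Kα u 0 + Kβ u 0      ≈⟨ +-congˡ {Kβ u 0 * Kα u 0} (*-identityʳ (Kβ u 0)) ⟨
        Kβ u 0 * Kα u 0 + Kβ u 0 * 1ᶜ ≈⟨ distribˡ (Kβ u 0) (Kα u 0) 1ᶜ ⟨
        Kβ u 0 * (Kα u 0 + 1ᶜ)       ≈⟨ *-congˡ {Kβ u 0} (Kα-u0 u (ℕₚ.n≢0⇒n>0 u≢0) u<n) ⟩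
        Kβ u 0 * 0ᶜ                  ≈⟨ zeroʳ (Kβ u 0) ⟩
        0ᶜ                          ≈⟨ zeroˡ (F u) ⟨
        0ᶜ * F u                    ∎

    D-CRT : ∀ j k → D a j k ≈ D α j k * D β j k
    D-CRT j k = trans ([]-⇔ (a ^ₘ j Finₚ.≟ _) ((α ^ₘ j Finₚ.≟ _) ×-dec (β ^ₘ j Finₚ.≟ _))
      (λ eq → project p∣pq eq , project q∣pq eq)
      (λ (eqₚ , eq-q) → reduce-injective (prime⇒coprime p-prime q<p) (lift p∣pq eqₚ) (lift q∣pq eq-q)))
      ([]-× (α ^ₘ j Finₚ.≟ _) (β ^ₘ j Finₚ.≟ _))
      where
      module _ {m : ℕ} .{{_ : NonZero m}} (m∣pq : m ∣ p ℕ.* q) where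
        reduce-successor : reduce m (a ^ₘ k +ₘ 1ₘ) ≡ reduce m a ^ₘ k +ₘ 1ₘ
        reduce-successor = ≡.trans (reduce-homo-+ m∣pq (a ^ₘ k) 1ₘ) (≡.cong₂ _+ₘ_ (reduce-homo-^ m∣pq a k) (reduce-homo-1 m∣pq))
        project : a ^ₘ j ≡ a ^ₘ k +ₘ 1ₘ → reduce m a ^ₘ j ≡ reduce m a ^ₘ k +ₘ 1ₘ
        project eq = ≡.trans (≡.sym (reduce-homo-^ m∣pq a j)) (≡.trans (≡.cong (reduce m) eq) reduce-successor)
        lift : reduce m a ^ₘ j ≡ reduce m a ^ₘ k +ₘ 1ₘ → reduce m (a ^ₘ j) ≡ reduce m (a ^ₘ k +ₘ 1ₘ)
        lift eq = ≡.trans (reduce-homo-^ m∣pq a j) (≡.trans eq (≡.sym reduce-successor))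

    n²-count : (n ℕ.* n) · 1ᶜ * (∣S∩[S+1]∣ · 1ᶜ) ≈ Σ² n T
    n²-count = trans (*-cong (×1-homo-* n n) (trans (∣S∩S+1∣ {p} {q} {a} a-order) (Σ²-cong P λ j k _ _ → D-CRT j k)))
      (detect-powers α β-order {ζ} {ξ} orthogonality P)
      where open Algebra.Properties.Semiring.Mult semiring using (×1-homo-*)

    open Folding (Reals.commutativeRing R) using (below?; weight; fold-symmetric)
    open Σᴿ using () renaming (Σ to ∑ʳ; [_] to [_]ᴿ)
    open Dᴿ using () renaming (Σ² to ∑²ʳ)

    τ : ℕ → ℕ → ℝ
    τ u v = re (T u v)

    b : ℝ
    b = fromℕ ∣B∣

    n²-countᴿ : fromℕ (n ℕ.* n) *ᴿ fromℕ ∣S∩[S+1]∣ ≈ᴿ ∑²ʳ n τ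
    n²-countᴿ = ℝ.trans (ℝ.sym (re≈ (trans (*-cong (·1ᶜ (n ℕ.* n)) (·1ᶜ ∣S∩[S+1]∣)) (ofReal-* (fromℕ (n ℕ.* n)) (fromℕ ∣S∩[S+1]∣)))))
      (ℝ.trans (re≈ n²-count) (ℝ.trans (re-Σ n (λ u → Σ n (T u))) (Σᴿ.Σ-cong n λ u _ → re-Σ n (T u))))

    -- One of the three `b` completes `τ 0 0` to p - 1 times `b`; the other two raise the factor to
    -- p + 1.
    main-term : τ 0 0 +ᴿ (b +ᴿ b +ᴿ b) ≈ᴿ fromℕ (p ℕ.+ 1) *ᴿ b
    main-term = ℝ.trans (ℝ.trans (ℝ.+-congˡ {τ 0 0} (ℝ.+-assoc b b b)) (ℝ.sym (ℝ.+-assoc (τ 0 0) b (b +ᴿ b))))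
      (ℝ.trans (ℝ.+-congʳ {b +ᴿ b} T00+b) (ℝ.trans (distribute b (fromℕ P)) (ℝ.*-congʳ (ℝ.reflexive (≡.cong fromℕ p+1≡2+P)))))
      where
      p+1≡2+P : suc (suc P) ≡ p ℕ.+ 1
      p+1≡2+P = ≡.trans (≡.cong suc (ℕₚ.m+[n∸m]≡n {1} (ℕₚ.<⇒≤ 1<p))) (ℕₚ.+-comm 1 p)
      distribute : ∀ x y → x *ᴿ y +ᴿ (x +ᴿ x) ≈ᴿ (1ᴿ +ᴿ (1ᴿ +ᴿ y)) *ᴿ x
      distribute = solveᴿ 2 (λ x y → x :*ᴿ y :+ᴿ (x :+ᴿ x) :=ᴿ (conᴿ (+ 1) :+ᴿ (conᴿ (+ 1) :+ᴿ y)) :*ᴿ x) ℝ.refl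
        where open IntegerSolver (Reals.commutativeRing R) renaming (solve to solveᴿ; _:=_ to _:=ᴿ_; _:+_ to _:+ᴿ_; _:*_ to _:*ᴿ_; con to conᴿ)
      T00+b : τ 0 0 +ᴿ b ≈ᴿ b *ᴿ fromℕ P
      T00+b = ℝ.trans (ℝ.+-congˡ {τ 0 0} (ℝ.sym (re≈ Kβ-00))) (re≈ (begin
        Kβ 0 0 * Kα 0 0 + Kβ 0 0                    ≈⟨ +-congˡ {Kβ 0 0 * Kα 0 0} (*-identityʳ (Kβ 0 0)) ⟨
        Kβ 0 0 * Kα 0 0 + Kβ 0 0 * 1ᶜ               ≈⟨ distribˡ (Kβ 0 0) (Kα 0 0) 1ᶜ ⟨
        Kβ 0 0 * (Kα 0 0 + 1ᶜ)                     ≈⟨ *-cong Kβ-00 (trans Kα-00 (·1ᶜ P)) ⟩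
        ofReal b * ofReal (fromℕ P)               ≈⟨ ofReal-* b (fromℕ P) ⟩
        ofReal (b *ᴿ fromℕ P)                     ∎))

    off-diagonal : ℝ
    off-diagonal = sumᴿ (λ (i : Fin n) → ∑ᴿ[ (λ (j : Fin n) → below? n (toℕ i) (toℕ j)) ]
      (λ j → weight (toℕ i) (toℕ j) *ᴿ re (coeff ψ (consecutive ord) (toℕ i) (toℕ j) * J (χ^ (toℕ i)) (χ^ (toℕ j)))))

    off-diagonal≈ : off-diagonal ≈ᴿ ∑²ʳ n (λ i j → [ below? n i j ]ᴿ *ᴿ (weight i j *ᴿ τ i j))
    off-diagonal≈ = ℝ.trans (Σᴿ.sum-cong-≋ {n} λ i → ℝ.trans
        (Σᴿ.sum-cong-≋ {n} λ j → ℝ.trans (Σᴿ.if-[] (below? n (toℕ i) (toℕ j)) _)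
          -- The bracket supplies 0 < i ≤ j. At exponent 0 the Jacobi sum would also have terms with
          -- argument 0, which T leaves out.
          (Σᴿ.[]-*-cong (below? n (toℕ i) (toℕ j)) λ (0<i , i≤j , j<n∸i) → ℝ.*-congˡ
            (re≈ (coeff*J (toℕ i) (toℕ j) 0<i (Finₚ.toℕ<n i) (ℕₚ.<-≤-trans 0<i i≤j) (Finₚ.toℕ<n j)))))
        (Σᴿ.sum-Σ n (G (toℕ i))))
      (Σᴿ.sum-Σ n (λ i → ∑ʳ n (G i)))
      where
      G : ℕ → ℕ → ℝ
      G i j = [ below? n i j ]ᴿ *ᴿ (weight i j *ᴿ τ i j)

    count : fromℕ ∣S∩[S+1]∣ ≈ᴿ (1/ (n ℕ.* n)) {{m*n≢0 n n}} *ᴿ (fromℕ (p ℕ.+ 1) *ᴿ b +ᴿ off-diagonal)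
    count = divide (ℝ.trans n²-countᴿ (ℝ.trans
        (fold-symmetric n τ (λ u v → re≈ (T-symmetric u v)) edge (λ u _ u<n → re≈ (T-antidiagonal u u<n))
          (λ u v _ u<n _ v<n → T-reflection u v u<n v<n))
        (ℝ.+-cong main-term (ℝ.sym off-diagonal≈))))
      where
      edge : ∑ʳ n (λ u → τ u 0) ≈ᴿ τ 0 0 +ᴿ b
      edge = ℝ.trans (ℝ.sym (re-Σ n (λ u → T u 0))) (ℝ.trans (re≈ T-edge) (ℝ.+-congˡ {τ 0 0} (re≈ Kβ-00)))
      divide : ∀ {x y} → fromℕ (n ℕ.* n) *ᴿ x ≈ᴿ y → x ≈ᴿ (1/ (n ℕ.* n)) {{m*n≢0 n n}} *ᴿ y
      divide {x} eq = ℝ.trans (ℝ.sym (ℝ.*-identityˡ x)) (ℝ.trans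
        (ℝ.*-congʳ (ℝ.trans (ℝ.sym (*1/ (n ℕ.* n) {{m*n≢0 n n}})) (ℝ.*-comm _ _)))
        (ℝ.trans (ℝ.*-assoc _ _ x) (ℝ.*-congˡ eq)))

open import Data.Nat.Base using (_<_)

mainTheorem9 : ∀ {c ℓ₁ ℓ₂} (R : Reals c ℓ₁ ℓ₂) → let open Complex R in
    (exp : ℂ → ℂ) → IsExponential exp →
    (π : ℝ) → IsPi exp π →
    (p q : ℕ) .{{_ : NonZero p}} .{{_ : NonZero q}} →
    let instance
          pq≢0 : NonZero (p ℕ.* q)
          pq≢0 = m*n≢0 p q
    in
    ¬ (2 ∣ q) → 1 < q → Prime p → q < p →
    (a : ℤ/ (p ℕ.* q)) → IsUnit a →
    a ^ₘ ((p ∸ 1) / 2) ≡ -ₘ 1ₘ →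
    let α = reduce p a
        β = reduce q a
    in
    GeneratesUnits α →
    (n : ℕ) .{{_ : NonZero n}} (ord : HasOrder β n) →
    (ψ : ℤ/ q → μ n) → (∀ j → val (ψ (β ^ₘ j)) ≈ e^2πi exp π j n) →
    (χ : Character p) → (∀ j → ⟦ χ ⟧ (α ^ₘ j) ≈ e^2πi exp π j n) →
    (χ^_ : ℕ → Character p) → (∀ i → (χ^ i) IsPower i Of χ) →
    let B = consecutive ord
        cᵢⱼ = coeff ψ B
    in
    fromℕ ∣ S p q a ∩ translate (S p q a) ∣
      ≈ᴿ (1/ (n ℕ.* n)) {{m*n≢0 n n}} *ᴿ
         ( fromℕ (p ℕ.+ 1) *ᴿ fromℕ ∣ B ∣
         +ᴿ sumᴿ (λ (i : Fin n) →
              ∑ᴿ[ (λ (j : Fin n) → (1 ≤? toℕ i) ×-dec (toℕ i ≤? toℕ j) ×-dec (toℕ j <? n ∸ toℕ i)) ]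
                (λ j → fromℕ 2 *ᴿ (fromℕ 2 -ᴿ fromℕ (δ (toℕ i) (toℕ j)))
                         *ᴿ re (cᵢⱼ (toℕ i) (toℕ j) * J (χ^ (toℕ i)) (χ^ (toℕ j))))) )
mainTheorem9 R exp isExp π isPi p q _ 1<q p-prime q<p a a-unit a^h≡-1 generates n ord ψ ψ-value χ χ-value χ^_ χ^-power =
  Counting.count R isExp isPi {{pq≢0 = m*n≢0 p q}} 1<q p-prime q<p a-unit a^h≡-1 generates ord {ψ} ψ-value χ χ-value χ^_ χ^-power
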